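{- Let $G$ be a finite simple connected graph with edges $e_1,\dots,e_m$, let $x\in P(G)$, and let $\mu>0$ be a simple (multiplicity one) eigenvalue of the Laplacian of the weighted graph $G(x)$, with corresponding eigenvector $f:V(G)\to\mathbf{R}$. Then $\mu$ is critical if and only if there is a constant $c$ such that $|f(u)-f(v)|=c$ for every edge $(uv)$ of $G$.
   Context: The weighted edge polytope is $P(G)=\{(x_1,\dots,x_m): x_j\ge 0,\ \sum_{j=1}^m x_j=m\}$; $G(x)$ is $G$ with weight $x_j$ on $e_j$. The Laplacian $\mathbf{L}(x)$ of $G(x)$ is the matrix with $L_{ii}$ equal to the sum of the weights of the edges at $v_i$, $L_{ij}=-x_k$ if $e_k=(v_iv_j)$ is an edge, and $L_{ij}=0$ if $i\neq j$ and $v_i,v_j$ are not adjacent. For $y\in\mathbf{R}^m$ with $\sum_j y_j=0$, consider the linear family of matrices $\mathbf{L}(x+ty)=\mathbf{L}(x)+tB$ (with $\mathbf L$ defined by the same formula for arbitrary real weights); near $t=0$ the simple eigenvalue $\mu$ extends to an analytic eigenvalue branch $\mu(t)$ with $\mu(0)=\mu$. The simple eigenvalue $\mu$ is called critical if $\mu'(0)=0$ for every such $y$; equivalently, $\langle Bf,f\rangle=0$ for every such $B$. -}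

module Defs where

open import Algebra.Bundles using (CommutativeRing)
open import Algebra.Structures using (IsCommutativeRing)
open import Data.Bool.Base using (if_then_else_)
open import Data.Fin.Base using (Fin; toℕ)
open import Data.Fin.Properties using (_≟_; any?)
open import Data.Nat.Base as ℕ using (ℕ)
open import Data.Product.Base using (_×_; _,_; ∃; ∃-syntax)
open import Data.Sum.Base using (_⊎_; inj₁; inj₂)
open import Data.Vec.Functional using (Vector)
open import Relation.Binary.Construct.Closure.ReflexiveTransitive using (Star)
import Relation.Binary.Construct.NonStrictToStrict as Strict
open import Relation.Binary.Core using (Rel; _Preserves_⟶_)
open import Relation.Binary.PropositionalEquality.Core using (_≡_)
open import Relation.Binary.Structures using (IsTotalOrder)
open import Relation.Nullary using (¬_; Dec; yes; no; does; _×-dec_; _⊎-dec_)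
open import Level using (0ℓ)

-- The real numbers, characterised (up to isomorphism, in classical logic) as
-- a Dedekind-complete ordered field; the equality of reals is _≈_.

record CompleteOrderedField : Set₁ where
  infixl 7 _*_
  infixl 6 _+_
  infix  8 -_
  infix  4 _≈_ _≤_
  field
    Carrier           : Set
    _≈_ _≤_           : Rel Carrier 0ℓ
    _+_ _*_           : Carrier → Carrier → Carrier
    -_                : Carrier → Carrier
    0# 1#             : Carrier
    isCommutativeRing : IsCommutativeRing _≈_ _+_ _*_ -_ 0# 1#
    isTotalOrder      : IsTotalOrder _≈_ _≤_
    0≉1               : ¬ (0# ≈ 1#)
    inverse           : ∀ x → ¬ (x ≈ 0#) → ∃[ y ] x * y ≈ 1#
    +-monoˡ-≤         : ∀ z {x y} → x ≤ y → x + z ≤ y + z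
    *-nonNeg          : ∀ {x y} → 0# ≤ x → 0# ≤ y → 0# ≤ x * y

  UpperBound : (Carrier → Set) → Carrier → Set
  UpperBound P b = ∀ x → P x → x ≤ b

  field
    supremum : (P : Carrier → Set) → ∃ P → ∃ (UpperBound P) →
               ∃[ s ] (UpperBound P s × (∀ b → UpperBound P b → s ≤ b))

  commutativeRing : CommutativeRing 0ℓ 0ℓ
  commutativeRing = record { isCommutativeRing = isCommutativeRing }

  open CommutativeRing commutativeRing public using (semiring; _-_)
  open Strict _≈_ _≤_ public using (_<_)
  open IsTotalOrder isTotalOrder public using (total)

  ∣_∣ : Carrier → Carrier
  ∣ x ∣ with total 0# x
  ... | inj₁ _ = x
  ... | inj₂ _ = - x

-- A finite simple graph with vertices Fin n and edges e₁,…,eₘ.  The choice of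
-- which end of an edge is its source carries no meaning: edges are used only
-- through Joins and Incident, which are symmetric in the two ends.

record SimpleGraph (n m : ℕ) : Set where
  field
    source target : Fin m → Fin n

  Joins : Fin m → Fin n → Fin n → Set
  Joins e u v = (source e ≡ u × target e ≡ v) ⊎ (source e ≡ v × target e ≡ u)

  joins? : ∀ e u v → Dec (Joins e u v)
  joins? e u v = (source e ≟ u ×-dec target e ≟ v) ⊎-dec
                 (source e ≟ v ×-dec target e ≟ u)

  field
    noLoops         : ∀ e u → ¬ Joins e u u
    noMultipleEdges : ∀ {e e′ u v} → Joins e u v → Joins e′ u v → e ≡ e′

  Adjacent : Rel (Fin n) 0ℓ
  Adjacent u v = ∃[ e ] Joins e u v

  Incident : Fin m → Fin n → Set
  Incident e u = source e ≡ u ⊎ target e ≡ u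

  incident? : ∀ e u → Dec (Incident e u)
  incident? e u = source e ≟ u ⊎-dec target e ≟ u

  Connected : Set
  Connected = ∀ u v → Star Adjacent u v

module WeightedGraphs (R : CompleteOrderedField) where

  open CompleteOrderedField R public
  open import Algebra.Properties.Semiring.Sum semiring public using (sum)
  open import Algebra.Properties.Semiring.Exp semiring public using (_^_)
  open import Algebra.Properties.Semiring.Mult semiring
    using () renaming (_×_ to _×ᴿ_)

  Matrix : ℕ → Set
  Matrix n = Fin n → Fin n → Carrier

  apply : ∀ {n} → Matrix n → Vector Carrier n → Vector Carrier n
  apply A f i = sum (λ j → A i j * f j)

  IsEigenvector : ∀ {n} → Matrix n → Carrier → Vector Carrier n → Set
  IsEigenvector A μ f = ¬ (∀ i → f i ≈ 0#) × (∀ i → apply A f i ≈ μ * f i)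

  IsEigenvalue : ∀ {n} → Matrix n → Carrier → Set
  IsEigenvalue A μ = ∃[ f ] IsEigenvector A μ f

  -- The eigenspace is a line.  For the symmetric matrices considered here this
  -- is the same as μ being a simple root of the characteristic polynomial.
  IsSimpleEigenvalue : ∀ {n} → Matrix n → Carrier → Set
  IsSimpleEigenvalue A μ =
    ∃[ f ] (IsEigenvector A μ f ×
            (∀ g → IsEigenvector A μ g → ∃[ a ] (∀ i → g i ≈ a * f i)))

  ConvergesTo : (ℕ → Carrier) → Carrier → Set
  ConvergesTo s l =
    ∀ ε → 0# < ε → ∃[ N ] (∀ k → N ℕ.≤ k → ∣ s k - l ∣ < ε)

  powerSeriesPartialSum : (ℕ → Carrier) → Carrier → ℕ → Carrier
  powerSeriesPartialSum a t k = sum {k} (λ i → a (toℕ i) * t ^ toℕ i)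

  HasDerivativeAt : (Carrier → Carrier) → Carrier → Carrier → Set
  HasDerivativeAt φ a d =
    ∀ ε → 0# < ε → ∃[ δ ] (0# < δ ×
      (∀ h → ∣ h ∣ < δ → ∣ (φ (a + h) - φ a) - d * h ∣ ≤ ε * ∣ h ∣))

  -- An analytic eigenvalue branch through μ, near t = 0, of the family A(t).
  -- Only the values of the function on |t| < radius matter.
  record AnalyticBranch {n} (A : Carrier → Matrix n) (μ : Carrier) : Set where
    field
      value        : Carrier → Carrier
      value-cong   : value Preserves _≈_ ⟶ _≈_
      value-0      : value 0# ≈ μ
      radius       : Carrier
      radius>0     : 0# < radius
      isEigenvalue : ∀ t → ∣ t ∣ < radius → IsEigenvalue (A t) (value t)
      coefficient  : ℕ → Carrier
      analytic     : ∀ t → ∣ t ∣ < radius →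
                     ConvergesTo (powerSeriesPartialSum coefficient t) (value t)

  module _ {n m : ℕ} (G : SimpleGraph n m) where

    open SimpleGraph G

    InEdgePolytope : Vector Carrier m → Set
    InEdgePolytope x = (∀ j → 0# ≤ x j) × sum x ≈ m ×ᴿ 1#

    laplacian : Vector Carrier m → Matrix n
    laplacian x u v with u ≟ v | any? (λ k → joins? k u v)
    ... | yes _ | _           = sum (λ k → if does (incident? k u) then x k else 0#)
    ... | no _  | yes (k , _) = - x k
    ... | no _  | no _        = 0#

    -- μ′(0) = 0 for every direction y tangent to the edge polytope.  A simple
    -- eigenvalue has exactly one germ of an analytic branch in each direction,
    -- so quantifying over all branches is the same as referring to "the" one.
    IsCritical : Vector Carrier m → Carrier → Set
    IsCritical x μ =
      ∀ y → sum y ≈ 0# →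
      (b : AnalyticBranch (λ t → laplacian (λ j → x j + t * y j)) μ) →
      HasDerivativeAt (AnalyticBranch.value b) 0# 0#

{-# OPTIONS --safe #-}
-- Writing the Laplacian as ∑ₑ xₑ bₑ bₑᵀ gives ⟨Bf, f⟩ = ∑ₑ yₑ (f(u) − f(v))², which
-- vanishes for all y with ∑ y = 0 exactly when (f(u) − f(v))² is the same for every
-- edge.  It remains to see that this number governs μ′(0).
--
-- If ⟨Bf, f⟩ = 0, an analytic branch is Lipschitz at 0, so the reduced resolvent
-- of L at μ bounds the component orthogonal to f of its eigenvectors by O(t); pairing
-- the eigenvalue equation with f then gives μ(t) = μ + O(t²).
--
-- Conversely criticality says something only if branches exist.  For B small enough
-- one is obtained by solving for the coefficients of the eigenvector in powers
-- of t with the reduced resolvent, and its linear coefficient is ⟨Bf, f⟩ / ⟨f, f⟩.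
module Submission where

open import Defs
open import Axiom.ExcludedMiddle using (ExcludedMiddle)
open import Data.Nat.Base using (ℕ)
open import Data.Product.Base using (∃-syntax)
open import Data.Vec.Functional using (Vector)
open import Function.Bundles using (_⇔_)
open import Level using (0ℓ)

open import Algebra.Bundles using (CommutativeRing)
import Algebra.Properties.Ring
import Algebra.Properties.Semiring.Mult.TCOptimised
import Algebra.Solver.Ring
import Algebra.Solver.Ring.AlmostCommutativeRing as ACR
open import Data.Bool.Base using (if_then_else_)
open import Data.Fin.Base using (Fin; zero; suc; toℕ; punchIn; punchOut)
open import Data.Fin.Properties using (_≟_; any?; punchIn-punchOut)
open import Data.Integer.Base as ℤ using (ℤ; +_; -[1+_])
import Data.Integer.Properties as ℤ
open import Data.Maybe.Base using (Maybe; just; nothing)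
open import Data.Nat.Base as ℕ using (zero; suc; z≤n; s≤s)
import Data.Nat.Properties as ℕ
open import Data.Product.Base using (_×_; _,_; ∃; proj₁; proj₂)
open import Data.Sum.Base using (_⊎_; inj₁; inj₂)
open import Data.Vec.Functional using (_∷_)
open import Function.Base using (_∘_)
open import Function.Bundles using (mk⇔)
open import Relation.Binary.Bundles using (Poset)
import Relation.Binary.PropositionalEquality as ≡
open ≡ using (_≡_)
import Relation.Binary.Reasoning.PartialOrder
import Relation.Binary.Reasoning.Setoid
open import Relation.Binary.Structures using (IsTotalOrder)
open import Relation.Nullary using (¬_; Dec; yes; no; does; contradiction; _⊎-dec_)

-- An analytic branch carries no eigenvectors that depend on t in a controlled way, only some
-- eigenvector for each t separately. The quadratic estimate is therefore proved for an arbitrary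
-- eigenvector of an arbitrary eigenvalue ν with |ν - μ| ≤ C|t|; the Lipschitz bound serves to put
-- the branch in this range. Norms are ℓ¹ norms, which need no square roots.
--
-- Existence of branches comes down to one inequality. The partial sums of ∑ ‖gₖ‖ obey a quadratic
-- recursive estimate, so for small B they never exceed 2‖f‖. This controls the series at t = 1;
-- evaluating it only for |t| ≤ 1/2 leaves the room in which Cauchy products converge. Smallness
-- costs nothing, since replacing y by εy keeps ∑ y = 0 and multiplies ⟨Bf, f⟩ by ε > 0.
--
-- Excluded middle serves chiefly to find pivots in an elimination and to turn a series with some
-- disc of convergence into a function defined for every t.

-- The ring solver with integer coefficients, so that x − x cancels.
module IntegerCoefficients (C : CommutativeRing 0ℓ 0ℓ) where

  open CommutativeRing C
  open Algebra.Properties.Ring ring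
  open Algebra.Properties.Semiring.Mult.TCOptimised semiring renaming (_×_ to _·_)
  open Relation.Binary.Reasoning.Setoid setoid

  ⟦_⟧ℤ : ℤ → Carrier
  ⟦ + n ⟧ℤ      = n · 1#
  ⟦ -[1+ n ] ⟧ℤ = - (suc n · 1#)

  private
    cancel : ∀ a b c → (a + b) - (a + c) ≈ b - c
    cancel a b c = begin
      (a + b) + - (a + c)     ≈⟨ +-cong (+-comm a b) (⁻¹-anti-homo-∙ a c) ⟩
      (b + a) + (- c + - a)   ≈⟨ +-congˡ (+-comm _ _) ⟩
      (b + a) + (- a + - c)   ≈⟨ +-assoc _ _ _ ⟩
      b + (a + (- a + - c))   ≈⟨ +-congˡ (sym (+-assoc _ _ _)) ⟩
      b + ((a + - a) + - c)   ≈⟨ +-congˡ (+-congʳ (-‿inverseʳ a)) ⟩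
      b + (0# + - c)          ≈⟨ +-congˡ (+-identityˡ _) ⟩
      b - c                   ∎
      where open import Algebra.Properties.Group +-group using (⁻¹-anti-homo-∙)

    x-0 : ∀ x → x - 0# ≈ x
    x-0 x = trans (+-congˡ -0#≈0#) (+-identityʳ x)

  ⊖-homo : ∀ m n → ⟦ m ℤ.⊖ n ⟧ℤ ≈ m · 1# - n · 1#
  ⊖-homo m       zero    = sym (x-0 (m · 1#))
  ⊖-homo zero    (suc n) = sym (+-identityˡ _)
  ⊖-homo (suc m) (suc n) = begin
    ⟦ suc m ℤ.⊖ suc n ⟧ℤ         ≡⟨ ≡.cong ⟦_⟧ℤ (ℤ.[1+m]⊖[1+n]≡m⊖n m n) ⟩
    ⟦ m ℤ.⊖ n ⟧ℤ                 ≈⟨ ⊖-homo m n ⟩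
    m · 1# - n · 1#              ≈⟨ cancel 1# _ _ ⟨
    (1# + m · 1#) - (1# + n · 1#) ≈⟨ +-cong (1+× m 1#) (-‿cong (1+× n 1#)) ⟨
    suc m · 1# - suc n · 1#      ∎

  ℤ-+-homo : ∀ i j → ⟦ i ℤ.+ j ⟧ℤ ≈ ⟦ i ⟧ℤ + ⟦ j ⟧ℤ
  ℤ-+-homo (+ m)    (+ n)    = ×-homo-+ 1# m n
  ℤ-+-homo (+ m)    -[1+ n ] = ⊖-homo m (suc n)
  ℤ-+-homo -[1+ m ] (+ n)    = trans (⊖-homo n (suc m)) (+-comm _ _)
  ℤ-+-homo -[1+ m ] -[1+ n ] = begin
    - (suc (suc (m ℕ.+ n)) · 1#)           ≡⟨ ≡.cong (λ k → - (suc k · 1#)) (ℕ.+-suc m n) ⟨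
    - ((suc m ℕ.+ suc n) · 1#)             ≈⟨ -‿cong (×-homo-+ 1# (suc m) (suc n)) ⟩
    - (suc m · 1# + suc n · 1#)            ≈⟨ -‿+-comm _ _ ⟨
    - (suc m · 1#) + - (suc n · 1#)        ∎

  ℤ-neg-homo : ∀ i → ⟦ ℤ.- i ⟧ℤ ≈ - ⟦ i ⟧ℤ
  ℤ-neg-homo (+ zero)  = sym -0#≈0#
  ℤ-neg-homo (+ suc n) = refl
  ℤ-neg-homo -[1+ n ]  = sym (-‿involutive _)

  private
    +*+ : ∀ m n → ⟦ + m ℤ.* + n ⟧ℤ ≈ m · 1# * n · 1#
    +*+ m n = begin
      ⟦ + m ℤ.* + n ⟧ℤ   ≡⟨ ≡.cong ⟦_⟧ℤ (ℤ.pos-* m n) ⟨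
      (m ℕ.* n) · 1#     ≈⟨ ×1-homo-* m n ⟩
      m · 1# * n · 1#    ∎

  ℤ-*-homo : ∀ i j → ⟦ i ℤ.* j ⟧ℤ ≈ ⟦ i ⟧ℤ * ⟦ j ⟧ℤ
  ℤ-*-homo (+ m)    (+ n)    = +*+ m n
  ℤ-*-homo (+ m)    -[1+ n ] = begin
    ⟦ + m ℤ.* -[1+ n ] ⟧ℤ           ≡⟨ ≡.cong ⟦_⟧ℤ (ℤ.neg-distribʳ-* (+ m) (+ suc n)) ⟨
    ⟦ ℤ.- (+ m ℤ.* + suc n) ⟧ℤ      ≈⟨ ℤ-neg-homo (+ m ℤ.* + suc n) ⟩
    - ⟦ + m ℤ.* + suc n ⟧ℤ          ≈⟨ -‿cong (+*+ m (suc n)) ⟩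
    - (m · 1# * suc n · 1#)         ≈⟨ -‿distribʳ-* _ _ ⟩
    m · 1# * - (suc n · 1#)         ∎
  ℤ-*-homo -[1+ m ] (+ n)    = begin
    ⟦ -[1+ m ] ℤ.* + n ⟧ℤ           ≡⟨ ≡.cong ⟦_⟧ℤ (ℤ.neg-distribˡ-* (+ suc m) (+ n)) ⟨
    ⟦ ℤ.- (+ suc m ℤ.* + n) ⟧ℤ      ≈⟨ ℤ-neg-homo (+ suc m ℤ.* + n) ⟩
    - ⟦ + suc m ℤ.* + n ⟧ℤ          ≈⟨ -‿cong (+*+ (suc m) n) ⟩
    - (suc m · 1# * n · 1#)         ≈⟨ -‿distribˡ-* _ _ ⟩
    - (suc m · 1#) * n · 1#         ∎
  ℤ-*-homo -[1+ m ] -[1+ n ] = begin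
    ⟦ + suc m ℤ.* + suc n ⟧ℤ        ≈⟨ +*+ (suc m) (suc n) ⟩
    suc m · 1# * suc n · 1#         ≈⟨ -‿involutive _ ⟨
    - (- (suc m · 1# * suc n · 1#)) ≈⟨ -‿cong (-‿distribʳ-* _ _) ⟩
    - (suc m · 1# * - (suc n · 1#)) ≈⟨ -‿distribˡ-* _ _ ⟩
    - (suc m · 1#) * - (suc n · 1#) ∎

  almostCommutativeRing : ACR.AlmostCommutativeRing 0ℓ 0ℓ
  almostCommutativeRing = ACR.fromCommutativeRing C

  morphism : ℤ.+-*-rawRing ACR.-Raw-AlmostCommutative⟶ almostCommutativeRing
  morphism = record
    { ⟦_⟧    = ⟦_⟧ℤ
    ; +-homo = ℤ-+-homo
    ; *-homo = ℤ-*-homo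
    ; -‿homo = ℤ-neg-homo
    ; 0-homo = refl
    ; 1-homo = refl
    }

  _coeff≟_ : ∀ i j → Maybe (⟦ i ⟧ℤ ≈ ⟦ j ⟧ℤ)
  i coeff≟ j with i ℤ.≟ j
  ... | yes ≡.refl = just refl
  ... | no  _      = nothing

  open Algebra.Solver.Ring ℤ.+-*-rawRing almostCommutativeRing morphism _coeff≟_ public
    using (solve; con; _:=_; _:+_; _:*_; _:-_; :-_)

module WithExcludedMiddle (em : ExcludedMiddle 0ℓ) (R : CompleteOrderedField) where

  open WeightedGraphs R
  open CommutativeRing commutativeRing
    hiding (Carrier; _≈_; _+_; _*_; -_; 0#; 1#; isCommutativeRing; semiring; _-_; zero)
  open IsTotalOrder isTotalOrder
    using (antisym; isPartialOrder)
    renaming (refl to ≤-refl; trans to ≤-trans; reflexive to ≤-reflexive)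
  open Algebra.Properties.Ring ring using (-0#≈0#; -‿involutive; -‿distribˡ-*; -‿distribʳ-*)
  open IntegerCoefficients commutativeRing using (solve; con; _:=_; _:+_; _:*_; _:-_; :-_)
  open import Algebra.Properties.Semiring.Sum semiring
    using (sum-cong-≋; ∑-distrib-+; ∑-comm; *-distribˡ-sum; *-distribʳ-sum; sum-replicate-zero)
  open import Algebra.Properties.Semiring.Exp semiring using (^-congˡ)
  open import Algebra.Properties.CommutativeSemiring.Exp commutativeSemiring using (^-distrib-*)

  -- Inequalities and inverses in an ordered field

  poset : Poset 0ℓ 0ℓ 0ℓ
  poset = record { isPartialOrder = isPartialOrder }

  module ≤-Reasoning = Relation.Binary.Reasoning.PartialOrder poset
  open ≤-Reasoning

  -- Inequalities are proved by exhibiting the difference of the two sides as a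
  -- combination of nonnegative terms.

  0≤-diff : ∀ {x y} → x ≤ y → 0# ≤ y - x
  0≤-diff {x} {y} x≤y = begin
    0#      ≈⟨ -‿inverseʳ x ⟨
    x - x   ≤⟨ +-monoˡ-≤ (- x) x≤y ⟩
    y - x   ∎

  by-diff : ∀ {x y z} → 0# ≤ z → y - x ≈ z → x ≤ y
  by-diff {x} {y} {z} 0≤z eq = begin
    x             ≈⟨ +-identityˡ x ⟨
    0# + x        ≤⟨ +-monoˡ-≤ x 0≤z ⟩
    z + x         ≈⟨ +-congʳ eq ⟨
    (y - x) + x   ≈⟨ solve 2 (λ y x → (y :- x) :+ x := y) refl y x ⟩
    y             ∎

  +-mono-≤ : ∀ {a b c d} → a ≤ b → c ≤ d → a + c ≤ b + d
  +-mono-≤ {a} {b} {c} {d} p q = begin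
    a + c  ≤⟨ +-monoˡ-≤ c p ⟩
    b + c  ≈⟨ +-comm b c ⟩
    c + b  ≤⟨ +-monoˡ-≤ b q ⟩
    d + b  ≈⟨ +-comm d b ⟩
    b + d  ∎

  +-nonNeg : ∀ {x y} → 0# ≤ x → 0# ≤ y → 0# ≤ x + y
  +-nonNeg {x} {y} p q = begin
    0#       ≈⟨ +-identityˡ 0# ⟨
    0# + 0#  ≤⟨ +-mono-≤ p q ⟩
    x + y    ∎

  *-monoˡ-≤ : ∀ {a b c} → 0# ≤ c → a ≤ b → c * a ≤ c * b
  *-monoˡ-≤ {a} {b} {c} 0≤c a≤b = by-diff (*-nonNeg 0≤c (0≤-diff a≤b))
    (solve 3 (λ a b c → c :* b :- c :* a := c :* (b :- a)) refl a b c)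

  *-monoʳ-≤ : ∀ {a b c} → 0# ≤ c → a ≤ b → a * c ≤ b * c
  *-monoʳ-≤ {a} {b} {c} 0≤c a≤b = begin
    a * c ≈⟨ *-comm a c ⟩
    c * a ≤⟨ *-monoˡ-≤ 0≤c a≤b ⟩
    c * b ≈⟨ *-comm c b ⟩
    b * c ∎

  *-mono-≤ : ∀ {a b c d} → 0# ≤ b → 0# ≤ c → a ≤ b → c ≤ d → a * c ≤ b * d
  *-mono-≤ 0≤b 0≤c a≤b c≤d = ≤-trans (*-monoʳ-≤ 0≤c a≤b) (*-monoˡ-≤ 0≤b c≤d)

  neg-anti-≤ : ∀ {x y} → x ≤ y → - y ≤ - x
  neg-anti-≤ {x} {y} p = by-diff (0≤-diff p) (solve 2 (λ x y → :- x :- :- y := y :- x) refl x y)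

  neg-nonNeg : ∀ {x} → x ≤ 0# → 0# ≤ - x
  neg-nonNeg p = ≤-trans (≤-reflexive (sym -0#≈0#)) (neg-anti-≤ p)

  x≤x+y : ∀ {x y} → 0# ≤ y → x ≤ x + y
  x≤x+y {x} {y} p = by-diff p (solve 2 (λ x y → (x :+ y) :- x := y) refl x y)

  y≤x+y : ∀ {x y} → 0# ≤ x → y ≤ x + y
  y≤x+y {x} {y} p = by-diff p (solve 2 (λ x y → (x :+ y) :- y := x) refl x y)

  square-nonNeg : ∀ x → 0# ≤ x * x
  square-nonNeg x with total 0# x
  ... | inj₁ p = *-nonNeg p p
  ... | inj₂ p = ≤-trans (*-nonNeg (neg-nonNeg p) (neg-nonNeg p))
                   (≤-reflexive (solve 1 (λ x → :- x :* :- x := x :* x) refl x))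

  0≤1 : 0# ≤ 1#
  0≤1 = ≤-trans (square-nonNeg 1#) (≤-reflexive (*-identityˡ 1#))

  <⇒≤ : ∀ {x y} → x < y → x ≤ y
  <⇒≤ = proj₁

  <⇒≱ : ∀ {x y} → x < y → ¬ (y ≤ x)
  <⇒≱ (x≤y , x≉y) y≤x = x≉y (antisym x≤y y≤x)

  ≰⇒> : ∀ {x y} → ¬ (x ≤ y) → y < x
  ≰⇒> {x} {y} ¬p with total x y
  ... | inj₁ p = contradiction p ¬p
  ... | inj₂ q = q , λ y≈x → ¬p (≤-reflexive (sym y≈x))

  ≮⇒≥ : ∀ {x y} → ¬ (x < y) → y ≤ x
  ≮⇒≥ {x} {y} ¬p with em {y ≤ x}
  ... | yes p = p
  ... | no ¬q = contradiction (≰⇒> ¬q) ¬p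

  <-≤-trans : ∀ {x y z} → x < y → y ≤ z → x < z
  <-≤-trans p q = ≰⇒> λ r → <⇒≱ p (≤-trans q r)

  ≤-<-trans : ∀ {x y z} → x ≤ y → y < z → x < z
  ≤-<-trans p q = ≰⇒> λ r → <⇒≱ q (≤-trans r p)

  0<1 : 0# < 1#
  0<1 = 0≤1 , 0≉1

  pos⇒≉0 : ∀ {x} → 0# < x → ¬ (x ≈ 0#)
  pos⇒≉0 p eq = proj₂ p (sym eq)

  *-cancelˡ-0 : ∀ {x y} → ¬ (x ≈ 0#) → x * y ≈ 0# → y ≈ 0#
  *-cancelˡ-0 {x} {y} x≉0 xy≈0 with inverse x x≉0
  ... | i , xi≈1 = begin-equality
    y            ≈⟨ *-identityˡ y ⟨
    1# * y       ≈⟨ *-congʳ xi≈1 ⟨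
    (x * i) * y  ≈⟨ solve 3 (λ x i y → (x :* i) :* y := i :* (x :* y)) refl x i y ⟩
    i * (x * y)  ≈⟨ *-congˡ xy≈0 ⟩
    i * 0#       ≈⟨ zeroʳ i ⟩
    0#           ∎

  *-pos : ∀ {x y} → 0# < x → 0# < y → 0# < x * y
  *-pos p q = *-nonNeg (<⇒≤ p) (<⇒≤ q) ,
    λ eq → pos⇒≉0 q (*-cancelˡ-0 (pos⇒≉0 p) (sym eq))

  +-pos : ∀ {x y} → 0# < x → 0# ≤ y → 0# < x + y
  +-pos p q = <-≤-trans p (x≤x+y q)

  abstract
    inverse-pos : ∀ {x} → 0# < x → ∃[ y ] (x * y ≈ 1# × 0# < y)
    inverse-pos {x} 0<x with inverse x (pos⇒≉0 0<x)
    ... | i , xi≈1 = i , xi≈1 , ≰⇒> λ i≤0 → <⇒≱ 0<1 (begin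
      1#           ≈⟨ xi≈1 ⟨
      x * i        ≤⟨ *-monoˡ-≤ (<⇒≤ 0<x) i≤0 ⟩
      x * 0#       ≈⟨ zeroʳ x ⟩
      0#           ∎)

  *-cancelˡ-≤ : ∀ {x y c} → 0# < c → c * x ≤ c * y → x ≤ y
  *-cancelˡ-≤ {x} {y} {c} 0<c p with inverse-pos 0<c
  ... | i , ci≈1 , 0<i = begin
    x            ≈⟨ unscale x ⟨
    i * (c * x)  ≤⟨ *-monoˡ-≤ (<⇒≤ 0<i) p ⟩
    i * (c * y)  ≈⟨ unscale y ⟩
    y            ∎
    where
    unscale : ∀ z → i * (c * z) ≈ z
    unscale z = begin-equality
      i * (c * z)  ≈⟨ solve 3 (λ i c z → i :* (c :* z) := (c :* i) :* z) refl i c z ⟩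
      (c * i) * z  ≈⟨ *-congʳ ci≈1 ⟩
      1# * z       ≈⟨ *-identityˡ z ⟩
      z            ∎

  abstract
    -- The choice is ε = x / (1 + C): the added 1 covers C = 0 and makes Cε fall short of x by
    -- exactly ε. All small radii below come from here; with C = 1 it just yields a positive number
    -- below x.
    small-multiple : ∀ {C x} → 0# ≤ C → 0# < x → ∃[ ε ] (0# < ε × C * ε < x)
    small-multiple {C} {x} 0≤C 0<x =
      let i , [1+C]i≈1 , 0<i = inverse-pos (+-pos 0<1 0≤C)
      in x * i , *-pos 0<x 0<i , below (*-pos 0<x 0<i) (split [1+C]i≈1)
      where
      split : ∀ {i} → (1# + C) * i ≈ 1# → x ≈ x * i + C * (x * i)
      split {i} [1+C]i≈1 = begin-equality
        x                     ≈⟨ *-identityʳ x ⟨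
        x * 1#                ≈⟨ *-congˡ [1+C]i≈1 ⟨
        x * ((1# + C) * i)    ≈⟨ solve 3 (λ x C i → x :* ((con (+ 1) :+ C) :* i) := x :* i :+ C :* (x :* i)) refl x C i ⟩
        x * i + C * (x * i)   ∎
      below : ∀ {ε} → 0# < ε → x ≈ ε + C * ε → C * ε < x
      below {ε} 0<ε x≈ = ≰⇒> λ x≤Cε → <⇒≱ 0<ε (by-diff (0≤-diff x≤Cε) (begin-equality
        0# - ε               ≈⟨ solve 2 (λ e c → con (+ 0) :- e := c :- (e :+ c)) refl ε (C * ε) ⟩
        C * ε - (ε + C * ε)  ≈⟨ +-congˡ (-‿cong x≈) ⟨
        C * ε - x            ∎))

  ≤-multiples⇒≤0 : ∀ {C x} → 0# ≤ C → (∀ ε → 0# < ε → x ≤ C * ε) → x ≤ 0#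
  ≤-multiples⇒≤0 {C} {x} 0≤C h = ≮⇒≥ λ 0<x →
    let ε , 0<ε , Cε<x = small-multiple 0≤C 0<x in <⇒≱ Cε<x (h ε 0<ε)

  abstract
    min : ∀ {a b} → 0# < a → 0# < b → ∃[ c ] (0# < c × c ≤ a × c ≤ b)
    min {a} {b} 0<a 0<b with total a b
    ... | inj₁ p = a , 0<a , ≤-refl , p
    ... | inj₂ p = b , 0<b , p , ≤-refl

  -- Absolute values

  abs-cases : ∀ x → (0# ≤ x × ∣ x ∣ ≡ x) ⊎ (x ≤ 0# × ∣ x ∣ ≡ - x)
  abs-cases x with total 0# x
  ... | inj₁ p = inj₁ (p , ≡.refl)
  ... | inj₂ p = inj₂ (p , ≡.refl)

  abs-nonNeg : ∀ x → 0# ≤ ∣ x ∣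
  abs-nonNeg x with abs-cases x
  ... | inj₁ (p , eq) = ≤-trans p (≤-reflexive (reflexive (≡.sym eq)))
  ... | inj₂ (p , eq) = ≤-trans (neg-nonNeg p) (≤-reflexive (reflexive (≡.sym eq)))

  x≤∣x∣ : ∀ x → x ≤ ∣ x ∣
  x≤∣x∣ x with abs-cases x
  ... | inj₁ (p , eq) = ≤-reflexive (reflexive (≡.sym eq))
  ... | inj₂ (p , eq) = ≤-trans p (abs-nonNeg x)

  -x≤∣x∣ : ∀ x → - x ≤ ∣ x ∣
  -x≤∣x∣ x with abs-cases x
  ... | inj₁ (p , eq) = ≤-trans (≤-trans (neg-anti-≤ p) (≤-reflexive -0#≈0#)) (abs-nonNeg x)
  ... | inj₂ (p , eq) = ≤-reflexive (reflexive (≡.sym eq))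

  abs-lub : ∀ {x b} → x ≤ b → - x ≤ b → ∣ x ∣ ≤ b
  abs-lub {x} p q with abs-cases x
  ... | inj₁ (_ , eq) = ≤-trans (≤-reflexive (reflexive eq)) p
  ... | inj₂ (_ , eq) = ≤-trans (≤-reflexive (reflexive eq)) q

  -- `∣_∣` branches on `total 0# x`, which is not assumed to respect `_≈_`. Congruence therefore
  -- comes from the order: |x| is the least common bound of x and -x.
  abs-cong-≤ : ∀ {x y} → x ≈ y → ∣ x ∣ ≤ ∣ y ∣
  abs-cong-≤ {x} {y} eq = abs-lub (≤-trans (≤-reflexive eq) (x≤∣x∣ y))
    (≤-trans (≤-reflexive (-‿cong eq)) (-x≤∣x∣ y))

  abs-cong : ∀ {x y} → x ≈ y → ∣ x ∣ ≈ ∣ y ∣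
  abs-cong eq = antisym (abs-cong-≤ eq) (abs-cong-≤ (sym eq))

  abs-of-nonNeg : ∀ {x} → 0# ≤ x → ∣ x ∣ ≈ x
  abs-of-nonNeg {x} p = antisym
    (abs-lub ≤-refl (≤-trans (neg-anti-≤ p) (≤-trans (≤-reflexive -0#≈0#) p))) (x≤∣x∣ x)

  ∣0∣≈0 : ∣ 0# ∣ ≈ 0#
  ∣0∣≈0 = abs-of-nonNeg ≤-refl

  abs-neg : ∀ x → ∣ - x ∣ ≈ ∣ x ∣
  abs-neg x = antisym (half x) (≤-trans (abs-cong-≤ (sym (-‿involutive x))) (half (- x)))
    where
    half : ∀ x → ∣ - x ∣ ≤ ∣ x ∣
    half x = abs-lub (-x≤∣x∣ x) (≤-trans (≤-reflexive (-‿involutive x)) (x≤∣x∣ x))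

  abs-triangle : ∀ x y → ∣ x + y ∣ ≤ ∣ x ∣ + ∣ y ∣
  abs-triangle x y = abs-lub (+-mono-≤ (x≤∣x∣ x) (x≤∣x∣ y)) (begin
    - (x + y)      ≈⟨ solve 2 (λ x y → :- (x :+ y) := :- x :+ :- y) refl x y ⟩
    - x + - y      ≤⟨ +-mono-≤ (-x≤∣x∣ x) (-x≤∣x∣ y) ⟩
    ∣ x ∣ + ∣ y ∣  ∎)

  abs-triangle-sub : ∀ x y → ∣ x - y ∣ ≤ ∣ x ∣ + ∣ y ∣
  abs-triangle-sub x y = ≤-trans (abs-triangle x (- y)) (≤-reflexive (+-congˡ (abs-neg y)))

  abs-sub-comm : ∀ x y → ∣ x - y ∣ ≈ ∣ y - x ∣
  abs-sub-comm x y = trans (sym (abs-neg (x - y)))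
    (abs-cong (solve 2 (λ x y → :- (x :- y) := y :- x) refl x y))

  abs-* : ∀ x y → ∣ x * y ∣ ≈ ∣ x ∣ * ∣ y ∣
  abs-* x y with abs-cases x | abs-cases y
  ... | inj₁ (p , ∣x∣≡) | inj₁ (q , ∣y∣≡) = trans (abs-of-nonNeg (*-nonNeg p q))
    (sym (*-cong (reflexive ∣x∣≡) (reflexive ∣y∣≡)))
  ... | inj₁ (p , ∣x∣≡) | inj₂ (q , ∣y∣≡) = begin-equality
    ∣ x * y ∣      ≈⟨ abs-neg _ ⟨
    ∣ - (x * y) ∣  ≈⟨ abs-cong (-‿distribʳ-* x y) ⟩
    ∣ x * - y ∣    ≈⟨ abs-of-nonNeg (*-nonNeg p (neg-nonNeg q)) ⟩
    x * - y        ≈⟨ *-cong (reflexive ∣x∣≡) (reflexive ∣y∣≡) ⟨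
    ∣ x ∣ * ∣ y ∣  ∎
  ... | inj₂ (p , ∣x∣≡) | inj₁ (q , ∣y∣≡) = begin-equality
    ∣ x * y ∣      ≈⟨ abs-neg _ ⟨
    ∣ - (x * y) ∣  ≈⟨ abs-cong (-‿distribˡ-* x y) ⟩
    ∣ - x * y ∣    ≈⟨ abs-of-nonNeg (*-nonNeg (neg-nonNeg p) q) ⟩
    - x * y        ≈⟨ *-cong (reflexive ∣x∣≡) (reflexive ∣y∣≡) ⟨
    ∣ x ∣ * ∣ y ∣  ∎
  ... | inj₂ (p , ∣x∣≡) | inj₂ (q , ∣y∣≡) = begin-equality
    ∣ x * y ∣      ≈⟨ abs-cong (solve 2 (λ x y → x :* y := :- x :* :- y) refl x y) ⟩
    ∣ - x * - y ∣  ≈⟨ abs-of-nonNeg (*-nonNeg (neg-nonNeg p) (neg-nonNeg q)) ⟩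
    - x * - y      ≈⟨ *-cong (reflexive ∣x∣≡) (reflexive ∣y∣≡) ⟨
    ∣ x ∣ * ∣ y ∣  ∎

  ∣x∣≤0⇒x≈0 : ∀ {x} → ∣ x ∣ ≤ 0# → x ≈ 0#
  ∣x∣≤0⇒x≈0 {x} p = antisym (≤-trans (x≤∣x∣ x) p)
    (≤-trans (≤-reflexive (solve 1 (λ z → con (+ 0) := :- z :+ z) refl x))
      (≤-trans (+-monoˡ-≤ x (≤-trans (-x≤∣x∣ x) p)) (≤-reflexive (+-identityˡ x))))

  abs-square : ∀ x → ∣ x ∣ * ∣ x ∣ ≈ x * x
  abs-square x = trans (sym (abs-* x x)) (abs-of-nonNeg (square-nonNeg x))

  -- If y < x, then x(x - y) is positive, yet it is at most x(x - y) + y(x - y) = x² - y² = 0.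
  square-injective : ∀ {x y} → 0# ≤ x → 0# ≤ y → x * x ≈ y * y → x ≈ y
  square-injective {x} {y} p q eq = antisym (half p q eq) (half q p (sym eq))
    where
    half : ∀ {x y} → 0# ≤ x → 0# ≤ y → x * x ≈ y * y → x ≤ y
    half {x} {y} p q eq = ≮⇒≥ λ y<x → proj₂ (*-pos (≤-<-trans q y<x) (0<x-y y<x)) (begin-equality
      0#             ≈⟨ sym (*-pos-0 y<x) ⟩
      x * (x - y)    ∎)
      where
      0<x-y : y < x → 0# < x - y
      0<x-y y<x = 0≤-diff (<⇒≤ y<x) , λ e → proj₂ y<x (begin-equality
        y            ≈⟨ +-identityˡ y ⟨
        0# + y       ≈⟨ +-congʳ e ⟩
        (x - y) + y  ≈⟨ solve 2 (λ x y → (x :- y) :+ y := x) refl x y ⟩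
        x            ∎)
      *-pos-0 : y < x → x * (x - y) ≈ 0#
      *-pos-0 y<x = antisym (begin
        x * (x - y)                    ≤⟨ x≤x+y (*-nonNeg q (0≤-diff (<⇒≤ y<x))) ⟩
        x * (x - y) + y * (x - y)      ≈⟨ solve 2 (λ x y → x :* (x :- y) :+ y :* (x :- y) := x :* x :- y :* y) refl x y ⟩
        x * x - y * y                  ≈⟨ +-congʳ eq ⟩
        y * y - y * y                  ≈⟨ -‿inverseʳ _ ⟩
        0#                             ∎) (*-nonNeg p (0≤-diff (<⇒≤ y<x)))

  abs-pos : ∀ {x} → ¬ (x ≈ 0#) → 0# < ∣ x ∣
  abs-pos {x} x≉0 = ≰⇒> λ p → x≉0 (∣x∣≤0⇒x≈0 p)

  -- Inequalities between finite sums

  sum-mono-≤ : ∀ {n} {f g : Vector Carrier n} → (∀ i → f i ≤ g i) → sum f ≤ sum g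
  sum-mono-≤ {zero}  h = ≤-refl
  sum-mono-≤ {suc n} h = +-mono-≤ (h zero) (sum-mono-≤ (h ∘ suc))

  sum-0 : ∀ {n} {f : Vector Carrier n} → (∀ i → f i ≈ 0#) → sum f ≈ 0#
  sum-0 {n} h = trans (sum-cong-≋ h) (sum-replicate-zero n)

  sum-nonNeg : ∀ {n} {f : Vector Carrier n} → (∀ i → 0# ≤ f i) → 0# ≤ sum f
  sum-nonNeg {n} h = ≤-trans (≤-reflexive (sym (sum-replicate-zero n))) (sum-mono-≤ h)

  term≤sum : ∀ {n} {f : Vector Carrier n} → (∀ i → 0# ≤ f i) → ∀ i → f i ≤ sum f
  term≤sum h zero    = x≤x+y (sum-nonNeg (h ∘ suc))
  term≤sum h (suc i) = ≤-trans (term≤sum (h ∘ suc) i) (y≤x+y (h zero))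

  abs-sum : ∀ {n} (f : Vector Carrier n) → ∣ sum f ∣ ≤ sum (λ i → ∣ f i ∣)
  abs-sum {zero}  f = ≤-reflexive ∣0∣≈0
  abs-sum {suc n} f = ≤-trans (abs-triangle _ _) (+-mono-≤ ≤-refl (abs-sum (f ∘ suc)))

  -- Limits and power series

  Sequence : Set
  Sequence = ℕ → Carrier

  Eventually : (ℕ → Set) → Set
  Eventually P = ∃[ N ] (∀ k → N ℕ.≤ k → P k)

  always : ∀ {P : ℕ → Set} → (∀ k → P k) → Eventually P
  always h = 0 , λ k _ → h k

  map₂ : ∀ {P Q S : ℕ → Set} → (∀ k → P k → Q k → S k) →
         Eventually P → Eventually Q → Eventually S
  map₂ h (M , p) (N , q) = M ℕ.⊔ N , λ k M⊔N≤k →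
    h k (p k (ℕ.m⊔n≤o⇒m≤o M N M⊔N≤k)) (q k (ℕ.m⊔n≤o⇒n≤o M N M⊔N≤k))

  map₁ : ∀ {P Q : ℕ → Set} → (∀ k → P k → Q k) → Eventually P → Eventually Q
  map₁ h (N , p) = N , λ k N≤k → h k (p k N≤k)

  exists : ∀ {P : ℕ → Set} → Eventually P → ∃ P
  exists (N , p) = N , p N ℕ.≤-refl

  -- Lets an estimate lose a constant factor and strictness; `small-multiple` absorbs both.
  converges-≤ : ∀ {s l C} → 0# ≤ C →
                (∀ ε → 0# < ε → Eventually (λ k → ∣ s k - l ∣ ≤ C * ε)) → ConvergesTo s l
  converges-≤ 0≤C h ε 0<ε =
    let ε′ , 0<ε′ , Cε′<ε = small-multiple 0≤C 0<ε
    in map₁ (λ k p → ≤-<-trans p Cε′<ε) (h ε′ 0<ε′)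

  lim-cong : ∀ {s s′ l l′} → (∀ k → s k ≈ s′ k) → l ≈ l′ → ConvergesTo s l → ConvergesTo s′ l′
  lim-cong eqs eql h ε 0<ε = map₁
    (λ k p → ≤-<-trans (abs-cong-≤ (+-cong (sym (eqs k)) (-‿cong (sym eql)))) p) (h ε 0<ε)

  lim-const : ∀ c → ConvergesTo (λ _ → c) c
  lim-const c ε 0<ε = always λ k →
    ≤-<-trans (≤-reflexive (trans (abs-cong (-‿inverseʳ c)) ∣0∣≈0)) 0<ε

  lim-+ : ∀ {s s′ l l′} → ConvergesTo s l → ConvergesTo s′ l′ →
          ConvergesTo (λ k → s k + s′ k) (l + l′)
  lim-+ {s} {s′} {l} {l′} h h′ = converges-≤ (+-nonNeg 0≤1 0≤1) λ ε 0<ε →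
    map₂ (λ k p p′ → begin
      ∣ (s k + s′ k) - (l + l′) ∣    ≈⟨ abs-cong (solve 4 (λ a b c d → (a :+ b) :- (c :+ d) := (a :- c) :+ (b :- d)) refl (s k) (s′ k) l l′) ⟩
      ∣ (s k - l) + (s′ k - l′) ∣    ≤⟨ abs-triangle _ _ ⟩
      ∣ s k - l ∣ + ∣ s′ k - l′ ∣    ≤⟨ +-mono-≤ (<⇒≤ p) (<⇒≤ p′) ⟩
      ε + ε                          ≈⟨ solve 1 (λ e → e :+ e := (con (+ 1) :+ con (+ 1)) :* e) refl ε ⟩
      (1# + 1#) * ε                  ∎) (h ε 0<ε) (h′ ε 0<ε)

  lim-* : ∀ {s s′ l l′} → ConvergesTo s l → ConvergesTo s′ l′ →
          ConvergesTo (λ k → s k * s′ k) (l * l′)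
  lim-* {s} {s′} {l} {l′} h h′ =
    converges-≤ {C = (1# + ∣ l ∣) + ∣ l′ ∣} (+-nonNeg (+-nonNeg 0≤1 (abs-nonNeg l)) (abs-nonNeg l′)) λ ε 0<ε →
    map₂ (λ k p (p′ , q) → begin
      ∣ s k * s′ k - l * l′ ∣
        ≈⟨ abs-cong (solve 4 (λ a b l m → a :* b :- l :* m := ((b :- m) :* (a :- l) :+ l :* (b :- m)) :+ m :* (a :- l)) refl (s k) (s′ k) l l′) ⟩
      ∣ ((s′ k - l′) * (s k - l) + l * (s′ k - l′)) + l′ * (s k - l) ∣
        ≤⟨ ≤-trans (abs-triangle _ _) (+-mono-≤ (abs-triangle _ _) ≤-refl) ⟩
      (∣ (s′ k - l′) * (s k - l) ∣ + ∣ l * (s′ k - l′) ∣) + ∣ l′ * (s k - l) ∣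
        ≈⟨ +-cong (+-cong (abs-* _ _) (abs-* _ _)) (abs-* _ _) ⟩
      (∣ s′ k - l′ ∣ * ∣ s k - l ∣ + ∣ l ∣ * ∣ s′ k - l′ ∣) + ∣ l′ ∣ * ∣ s k - l ∣
        ≤⟨ +-mono-≤ (+-mono-≤ (*-mono-≤ 0≤1 (abs-nonNeg _) (<⇒≤ q) (<⇒≤ p)) (*-monoˡ-≤ (abs-nonNeg l) (<⇒≤ p′)))
                    (*-monoˡ-≤ (abs-nonNeg l′) (<⇒≤ p)) ⟩
      (1# * ε + ∣ l ∣ * ε) + ∣ l′ ∣ * ε
        ≈⟨ solve 3 (λ e a b → (con (+ 1) :* e :+ a :* e) :+ b :* e := ((con (+ 1) :+ a) :+ b) :* e) refl ε ∣ l ∣ ∣ l′ ∣ ⟩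
      ((1# + ∣ l ∣) + ∣ l′ ∣) * ε ∎)
      -- The second sequence is used with tolerance 1 as well as ε, so that the product of the two
      -- errors stays linear in ε.
      (h ε 0<ε) (map₂ (λ _ → _,_) (h′ ε 0<ε) (h′ 1# 0<1))

  lim-scale : ∀ {s l} c → ConvergesTo s l → ConvergesTo (λ k → c * s k) (c * l)
  lim-scale c = lim-* (lim-const c)

  lim-neg : ∀ {s l} → ConvergesTo s l → ConvergesTo (λ k → - s k) (- l)
  lim-neg h ε 0<ε = map₁ (λ k p → ≤-<-trans (abs-cong-≤ (-‿+-comm′ _ _)) (≤-<-trans (≤-reflexive (abs-neg _)) p)) (h ε 0<ε)
    where
    -‿+-comm′ : ∀ x y → - x - - y ≈ - (x - y)
    -‿+-comm′ = solve 2 (λ x y → :- x :- :- y := :- (x :- y)) refl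

  lim-sum : ∀ {n} {s : Fin n → Sequence} {l : Vector Carrier n} →
            (∀ i → ConvergesTo (s i) (l i)) → ConvergesTo (λ k → sum (λ i → s i k)) (sum l)
  lim-sum {zero}  h = lim-const 0#
  lim-sum {suc n} h = lim-+ (h zero) (lim-sum (h ∘ suc))

  lim-suc : ∀ {s l} → ConvergesTo s l → ConvergesTo (s ∘ suc) l
  lim-suc h ε 0<ε = let N , p = h ε 0<ε in N , λ k N≤k → p (suc k) (ℕ.m≤n⇒m≤1+n N≤k)

  lim-bound : ∀ {s l c b} → ConvergesTo s l → (∀ k → ∣ s k - c ∣ ≤ b) → ∣ l - c ∣ ≤ b
  lim-bound {s} {l} {c} {b} h bnd = by-diff (neg-nonNeg (≤-multiples⇒≤0 0≤1 λ ε 0<ε →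
      let k , p = exists (h ε 0<ε) in by-diff {z = b + ε - ∣ l - c ∣} (0≤-diff (begin
        ∣ l - c ∣                      ≈⟨ abs-cong (solve 3 (λ s l c → l :- c := (s :- c) :- (s :- l)) refl (s k) l c) ⟩
        ∣ (s k - c) - (s k - l) ∣      ≤⟨ abs-triangle-sub _ _ ⟩
        ∣ s k - c ∣ + ∣ s k - l ∣      ≤⟨ +-mono-≤ (bnd k) (<⇒≤ p) ⟩
        b + ε                          ∎))
        (solve 3 (λ e b x → con (+ 1) :* e :- (x :- b) := b :+ e :- x) refl ε b ∣ l - c ∣)))
    (solve 2 (λ b x → b :- x := :- (x :- b)) refl b ∣ l - c ∣)

  lim-unique : ∀ {s l l′} → ConvergesTo s l → ConvergesTo s l′ → l ≈ l′
  lim-unique {s} {l} {l′} h h′ = begin-equality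
    l              ≈⟨ solve 2 (λ l m → l := (l :- m) :+ m) refl l l′ ⟩
    (l - l′) + l′  ≈⟨ +-congʳ l-l′≈0 ⟩
    0# + l′        ≈⟨ +-identityˡ l′ ⟩
    l′             ∎
    where
    0-limit : ConvergesTo (λ _ → 0#) (l - l′)
    0-limit = lim-cong (λ k → -‿inverseʳ (s k)) refl (lim-+ h (lim-neg h′))
    l-l′≈0 : l - l′ ≈ 0#
    l-l′≈0 = ∣x∣≤0⇒x≈0 (≤-trans (abs-cong-≤ (solve 1 (λ x → x := x :- con (+ 0)) refl (l - l′)))
      (lim-bound 0-limit λ k → ≤-reflexive (trans (abs-cong (-‿inverseʳ 0#)) ∣0∣≈0)))

  monotone : ∀ {s : Sequence} → (∀ k → s k ≤ s (suc k)) → ∀ {j k} → j ℕ.≤ k → s j ≤ s k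
  monotone {s} step j≤k = go (ℕ.≤⇒≤′ j≤k)
    where
    go : ∀ {j k} → j ℕ.≤′ k → s j ≤ s k
    go (ℕ.≤′-reflexive ≡.refl) = ≤-refl
    go (ℕ.≤′-step p)           = ≤-trans (go p) (step _)

  abstract
    -- The only appeal to `supremum`: every limit whose existence has to be established below is
    -- traced back to this one.
    monotone-converges : ∀ {s b} → (∀ k → s k ≤ s (suc k)) → (∀ k → s k ≤ b) → ∃[ l ] ConvergesTo s l
    monotone-converges {s} {b} step bnd =
      let l , upper , least = supremum Values (s 0 , 0 , refl) (b , λ x (k , x≈) → ≤-trans (≤-reflexive x≈) (bnd k))
      in l , converges upper least
      where
      Values : Carrier → Set
      Values x = ∃[ k ] x ≈ s k
      converges : ∀ {l} → UpperBound Values l → (∀ b → UpperBound Values b → l ≤ b) → ConvergesTo s l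
      converges {l} upper least ε 0<ε with em {∃[ k ] l < s k + ε}
      ... | no ¬∃ = contradiction
        (by-diff (0≤-diff (least (l - ε) λ x (k , x≈) → begin
            x           ≈⟨ x≈ ⟩
            s k         ≤⟨ by-diff (0≤-diff (≮⇒≥ λ p → ¬∃ (k , p)))
                            (solve 3 (λ l e s → l :- e :- s := l :- (s :+ e)) refl l ε (s k)) ⟩
            l - ε       ∎))
          (solve 2 (λ l e → con (+ 0) :- e := (l :- e) :- l) refl l ε))
        (<⇒≱ 0<ε)
      ... | yes (k , l<) = k , λ j k≤j → ≤-<-trans (≤-reflexive (trans (abs-sub-comm (s j) l)
          (abs-of-nonNeg (0≤-diff (upper (s j) (j , refl))))))
        (≰⇒> λ ε≤ → <⇒≱ l< (by-diff (+-nonNeg (0≤-diff ε≤) (0≤-diff (monotone {s} step k≤j)))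
          (solve 4 (λ l sk sj e → l :- (sk :+ e) := (l :- sj :- e) :+ (sj :- sk)) refl l (s k) (s j) ε)))

  -- With this indexing `powerSeriesPartialSum a t` unfolds to `psum` of the sequence of terms, and
  -- splitting off the first term is definitional. Splitting off the last one is `psum-last`.
  psum : Sequence → Sequence
  psum a k = sum {k} (λ i → a (toℕ i))

  psum-last : ∀ a k → psum a (suc k) ≈ psum a k + a k
  psum-last a zero    = +-comm _ _
  psum-last a (suc k) = trans (+-congˡ (psum-last (a ∘ suc) k)) (sym (+-assoc _ _ _))

  psum-cong : ∀ {a b} → (∀ i → a i ≈ b i) → ∀ k → psum a k ≈ psum b k
  psum-cong h k = sum-cong-≋ {k} (λ i → h (toℕ i))

  psum-+ : ∀ a b k → psum (λ i → a i + b i) k ≈ psum a k + psum b k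
  psum-+ a b k = ∑-distrib-+ {k} (a ∘ toℕ) (b ∘ toℕ)

  psum-scale : ∀ c a k → psum (λ i → c * a i) k ≈ c * psum a k
  psum-scale c a k = sym (*-distribˡ-sum {k} c (a ∘ toℕ))

  psum-mono-≤ : ∀ {a b} → (∀ i → a i ≤ b i) → ∀ k → psum a k ≤ psum b k
  psum-mono-≤ h k = sum-mono-≤ {k} (λ i → h (toℕ i))

  psum-nonNeg : ∀ {a} → (∀ i → 0# ≤ a i) → ∀ k → 0# ≤ psum a k
  psum-nonNeg h k = sum-nonNeg {k} (λ i → h (toℕ i))

  abs-psum : ∀ a k → ∣ psum a k ∣ ≤ psum (λ i → ∣ a i ∣) k
  abs-psum a k = abs-sum {k} (a ∘ toℕ)

  psum-step : ∀ {a} → (∀ i → 0# ≤ a i) → ∀ k → psum a k ≤ psum a (suc k)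
  psum-step {a} h k = ≤-trans (x≤x+y (h k)) (≤-reflexive (sym (psum-last a k)))

  -- A real series is the difference of the nonnegative series ∑ (∣aᵢ∣ + aᵢ) and ∑ ∣aᵢ∣.
  abstract
    absolutely-convergent : ∀ {a C} → (∀ k → psum (λ i → ∣ a i ∣) k ≤ C) →
                            ∃[ l ] ConvergesTo (psum a) l
    absolutely-convergent {a} {C} bnd =
      let l₁ , h₁ = monotone-converges {psum b} (psum-step {b} 0≤b) bnd-b
          l₂ , h₂ = monotone-converges {psum ∣a∣} (psum-step {∣a∣} (λ i → abs-nonNeg (a i))) bnd
      in l₁ - l₂ , lim-cong difference refl (lim-+ h₁ (lim-neg h₂))
      where
      ∣a∣ b : Sequence
      ∣a∣ i = ∣ a i ∣
      b i = ∣ a i ∣ + a i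
      0≤b : ∀ i → 0# ≤ b i
      0≤b i = by-diff (0≤-diff (-x≤∣x∣ (a i))) (solve 2 (λ x a → (x :+ a) :- con (+ 0) := x :- :- a) refl ∣ a i ∣ (a i))
      bnd-b : ∀ k → psum b k ≤ C + C
      bnd-b k = begin
        psum b k                           ≤⟨ psum-mono-≤ {b} {λ i → ∣a∣ i + ∣a∣ i} (λ i → +-mono-≤ ≤-refl (x≤∣x∣ (a i))) k ⟩
        psum (λ i → ∣a∣ i + ∣a∣ i) k       ≈⟨ psum-+ ∣a∣ ∣a∣ k ⟩
        psum ∣a∣ k + psum ∣a∣ k            ≤⟨ +-mono-≤ (bnd k) (bnd k) ⟩
        C + C                              ∎
      difference : ∀ k → psum b k + - psum ∣a∣ k ≈ psum a k
      difference k = begin-equality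
        psum b k - psum ∣a∣ k                 ≈⟨ +-congʳ (psum-+ ∣a∣ a k) ⟩
        (psum ∣a∣ k + psum a k) - psum ∣a∣ k  ≈⟨ solve 2 (λ x a → (x :+ a) :- x := a) refl (psum ∣a∣ k) (psum a k) ⟩
        psum a k                              ∎

  terms-vanish : ∀ {a l} → ConvergesTo (psum a) l → ConvergesTo a 0#
  terms-vanish {a} {l} h = lim-cong
    (λ k → begin-equality
      psum a (suc k) - psum a k      ≈⟨ +-congʳ (psum-last a k) ⟩
      (psum a k + a k) - psum a k    ≈⟨ solve 2 (λ x y → (x :+ y) :- x := y) refl (psum a k) (a k) ⟩
      a k                            ∎)
    (-‿inverseʳ l) (lim-+ (lim-suc h) (lim-neg h))

  abstract
    -- The finitely many exceptional terms are bounded by the sum of their absolute values, which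
    -- spares taking a maximum.
    eventually-bounded⇒bounded : ∀ {a : Sequence} {C} → 0# ≤ C → Eventually (λ k → ∣ a k ∣ ≤ C) →
                                 ∃[ D ] (0# ≤ D × (∀ k → ∣ a k ∣ ≤ D))
    eventually-bounded⇒bounded {a} {C} 0≤C (N , p) = C + psum ∣a∣ N , +-nonNeg 0≤C (0≤psum N) , bound
      where
      ∣a∣ : Sequence
      ∣a∣ i = ∣ a i ∣
      0≤psum : ∀ k → 0# ≤ psum ∣a∣ k
      0≤psum = psum-nonNeg {∣a∣} (λ i → abs-nonNeg (a i))
      bound : ∀ k → ∣ a k ∣ ≤ C + psum ∣a∣ N
      bound k with ℕ.<-≤-connex k N
      ... | inj₂ N≤k = ≤-trans (p k N≤k) (x≤x+y (0≤psum N))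
      ... | inj₁ k<N = begin
        ∣ a k ∣                ≤⟨ y≤x+y (0≤psum k) ⟩
        psum ∣a∣ k + ∣ a k ∣   ≈⟨ psum-last ∣a∣ k ⟨
        psum ∣a∣ (suc k)       ≤⟨ monotone {psum ∣a∣} (psum-step {∣a∣} (λ i → abs-nonNeg (a i))) k<N ⟩
        psum ∣a∣ N             ≤⟨ y≤x+y 0≤C ⟩
        C + psum ∣a∣ N         ∎

    null⇒bounded : ∀ {a : Sequence} → ConvergesTo a 0# → ∃[ D ] (0# ≤ D × (∀ k → ∣ a k ∣ ≤ D))
    null⇒bounded {a} h = eventually-bounded⇒bounded {a} 0≤1 (map₁ (λ k p →
      ≤-trans (abs-cong-≤ (solve 1 (λ x → x := x :- con (+ 0)) refl (a k))) (<⇒≤ p)) (h 1# 0<1))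

  -- Geometric series and the first-order Taylor estimate

  ^-nonNeg : ∀ {q} → 0# ≤ q → ∀ k → 0# ≤ q ^ k
  ^-nonNeg 0≤q zero    = 0≤1
  ^-nonNeg 0≤q (suc k) = *-nonNeg 0≤q (^-nonNeg 0≤q k)

  ^-≤1 : ∀ {q} → 0# ≤ q → q ≤ 1# → ∀ k → q ^ k ≤ 1#
  ^-≤1 0≤q q≤1 zero    = ≤-refl
  ^-≤1 0≤q q≤1 (suc k) = ≤-trans (*-mono-≤ 0≤1 (^-nonNeg 0≤q k) q≤1 (^-≤1 0≤q q≤1 k)) (≤-reflexive (*-identityˡ 1#))

  abs-^ : ∀ t k → ∣ t ^ k ∣ ≈ ∣ t ∣ ^ k
  abs-^ t zero    = abs-of-nonNeg 0≤1
  abs-^ t (suc k) = trans (abs-* t (t ^ k)) (*-congˡ (abs-^ t k))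

  -- For q ≤ 1/2 the bound 2 reproduces itself under S ↦ 1 + qS, so no closed form with a division
  -- by 1 - q is needed.
  geometric-≤2 : ∀ {q} → 0# ≤ q → q + q ≤ 1# → ∀ k → psum (q ^_) k ≤ 1# + 1#
  geometric-≤2 {q} 0≤q 2q≤1 zero    = +-nonNeg 0≤1 0≤1
  geometric-≤2 {q} 0≤q 2q≤1 (suc k) = +-mono-≤ ≤-refl (begin
    psum (λ i → q * q ^ i) k   ≈⟨ psum-scale q (q ^_) k ⟩
    q * psum (q ^_) k          ≤⟨ *-monoˡ-≤ 0≤q (geometric-≤2 0≤q 2q≤1 k) ⟩
    q * (1# + 1#)              ≈⟨ solve 1 (λ q → q :* (con (+ 1) :+ con (+ 1)) := q :+ q) refl q ⟩
    q + q                      ≤⟨ 2q≤1 ⟩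
    1#                         ∎)

  -- The powers are the terms of a convergent series. Completeness thus replaces an explicit
  -- Archimedean argument.
  ^-vanishes : ∀ {q} → 0# ≤ q → q + q ≤ 1# → ConvergesTo (q ^_) 0#
  ^-vanishes {q} 0≤q 2q≤1 = terms-vanish (proj₂ (monotone-converges {psum (q ^_)} (psum-step {q ^_} (^-nonNeg 0≤q)) (geometric-≤2 0≤q 2q≤1)))

  -- Abel's comparison with a geometric series: p is 1 / t₀, and t is written as t₀ · (t p).
  power-series-bound : ∀ {a : Sequence} {D t₀ p t} → 0# ≤ p → t₀ * p ≈ 1# → (∀ k → ∣ a k * t₀ ^ k ∣ ≤ D) →
                       ∀ k → ∣ a k * t ^ k ∣ ≤ D * (∣ t ∣ * p) ^ k
  power-series-bound {a} {D} {t₀} {p} {t} 0≤p t₀p≈1 bnd k = begin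
    ∣ a k * t ^ k ∣                          ≈⟨ abs-cong (*-congˡ (^-congˡ k t≈)) ⟩
    ∣ a k * (t₀ * (t * p)) ^ k ∣             ≈⟨ abs-cong (*-congˡ (^-distrib-* t₀ (t * p) k)) ⟩
    ∣ a k * (t₀ ^ k * (t * p) ^ k) ∣         ≈⟨ abs-cong (*-assoc _ _ _) ⟨
    ∣ (a k * t₀ ^ k) * (t * p) ^ k ∣         ≈⟨ abs-* _ _ ⟩
    ∣ a k * t₀ ^ k ∣ * ∣ (t * p) ^ k ∣       ≤⟨ *-monoʳ-≤ (abs-nonNeg _) (bnd k) ⟩
    D * ∣ (t * p) ^ k ∣                      ≈⟨ *-congˡ (abs-^ (t * p) k) ⟩
    D * ∣ t * p ∣ ^ k                        ≈⟨ *-congˡ (^-congˡ k (trans (abs-* t p) (*-congˡ (abs-of-nonNeg 0≤p)))) ⟩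
    D * (∣ t ∣ * p) ^ k                      ∎
    where
    t≈ : t ≈ t₀ * (t * p)
    t≈ = begin-equality
      t             ≈⟨ *-identityʳ t ⟨
      t * 1#        ≈⟨ *-congˡ t₀p≈1 ⟨
      t * (t₀ * p)  ≈⟨ solve 3 (λ t u p → t :* (u :* p) := u :* (t :* p)) refl t t₀ p ⟩
      t₀ * (t * p)  ∎

  -- With q = |t| / t₀ ≤ 1/2, the terms from index 2 on are at most D q² qⁱ, whose sum is at most 2
  -- D q². This is where the constant 2 D / t₀² comes from. Shifting the partial sums twice exposes
  -- the two leading terms.
  power-series-remainder : ∀ {a : Sequence} {D t₀ p t l} → 0# ≤ D → 0# ≤ p → t₀ * p ≈ 1# →
    (∀ k → ∣ a k * t₀ ^ k ∣ ≤ D) → ∣ t ∣ * p + ∣ t ∣ * p ≤ 1# →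
    ConvergesTo (powerSeriesPartialSum a t) l →
    ∣ l - (a 0 + a 1 * t) ∣ ≤ ((D * (1# + 1#)) * (p * p)) * (∣ t ∣ * ∣ t ∣)
  power-series-remainder {a} {D} {t₀} {p} {t} {l} 0≤D 0≤p t₀p≈1 bnd 2q≤1 conv = lim-bound (lim-suc (lim-suc conv)) λ k → begin
      ∣ (a 0 * 1# + (a 1 * (t * 1#) + psum rest k)) - (a 0 + a 1 * t) ∣
        ≈⟨ abs-cong (solve 4 (λ a b t r → (a :* con (+ 1) :+ (b :* (t :* con (+ 1)) :+ r)) :- (a :+ b :* t) := r) refl (a 0) (a 1) t (psum rest k)) ⟩
      ∣ psum rest k ∣
        ≤⟨ abs-psum rest k ⟩
      psum (λ i → ∣ rest i ∣) k
        ≤⟨ psum-mono-≤ {λ i → ∣ rest i ∣} {λ i → (D * (q * q)) * q ^ i} term k ⟩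
      psum (λ i → (D * (q * q)) * q ^ i) k
        ≈⟨ psum-scale (D * (q * q)) (q ^_) k ⟩
      (D * (q * q)) * psum (q ^_) k
        ≤⟨ *-monoˡ-≤ (*-nonNeg 0≤D (*-nonNeg 0≤q 0≤q)) (geometric-≤2 0≤q 2q≤1 k) ⟩
      (D * (q * q)) * (1# + 1#)
        ≈⟨ solve 3 (λ d t p → (d :* ((t :* p) :* (t :* p))) :* (con (+ 1) :+ con (+ 1)) := ((d :* (con (+ 1) :+ con (+ 1))) :* (p :* p)) :* (t :* t)) refl D ∣ t ∣ p ⟩
      ((D * (1# + 1#)) * (p * p)) * (∣ t ∣ * ∣ t ∣) ∎
    where
    q : Carrier
    q = ∣ t ∣ * p
    rest : Sequence
    rest i = a (2 ℕ.+ i) * t ^ (2 ℕ.+ i)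
    0≤q : 0# ≤ q
    0≤q = *-nonNeg (abs-nonNeg t) 0≤p
    term : ∀ i → ∣ rest i ∣ ≤ (D * (q * q)) * q ^ i
    term i = ≤-trans (power-series-bound {a} 0≤p t₀p≈1 bnd (2 ℕ.+ i))
      (≤-reflexive (solve 3 (λ d q x → d :* (q :* (q :* x)) := (d :* (q :* q)) :* x) refl D q (q ^ i)))

  abstract
    -- Convergence at one point t₀ > 0 of the disc already bounds the terms aₖ t₀ᵏ, because they
    -- tend to 0. The radius δ₁ < t₀ / 2 provides the ratio 1/2 for the geometric comparison, and δ
    -- ≤ r keeps the series convergent at t.
    power-series-taylor : ∀ {a : Sequence} {v : Carrier → Carrier} {r} → 0# < r →
      (∀ t → ∣ t ∣ < r → ConvergesTo (powerSeriesPartialSum a t) (v t)) →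
      ∃[ C ] ∃[ δ ] (0# ≤ C × 0# < δ × δ ≤ r ×
        (∀ t → ∣ t ∣ < δ → ∣ v t - (a 0 + a 1 * t) ∣ ≤ C * (∣ t ∣ * ∣ t ∣)))
    power-series-taylor {a} {v} {r} 0<r conv =
      let t₀ , 0<t₀ , t₀<r = small-multiple 0≤1 0<r
          D , 0≤D , bnd = null⇒bounded (terms-vanish {λ i → a i * t₀ ^ i} (conv t₀
            (≤-<-trans (≤-reflexive (trans (abs-of-nonNeg (<⇒≤ 0<t₀)) (sym (*-identityˡ t₀)))) t₀<r)))
          p , t₀p≈1 , 0<p = inverse-pos 0<t₀
          δ₁ , 0<δ₁ , 2pδ₁<1 = small-multiple (+-nonNeg (<⇒≤ 0<p) (<⇒≤ 0<p)) 0<1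
          δ , 0<δ , δ≤δ₁ , δ≤r = min 0<δ₁ 0<r
      in (D * (1# + 1#)) * (p * p) , δ
       , *-nonNeg (*-nonNeg 0≤D (+-nonNeg 0≤1 0≤1)) (*-nonNeg (<⇒≤ 0<p) (<⇒≤ 0<p)) , 0<δ , δ≤r
       , λ t ∣t∣<δ → power-series-remainder {a} {t₀ = t₀} 0≤D (<⇒≤ 0<p) t₀p≈1 bnd
           (≤-trans (small (<⇒≤ 0<p) (≤-trans (<⇒≤ ∣t∣<δ) δ≤δ₁)) (<⇒≤ 2pδ₁<1))
           (conv t (<-≤-trans ∣t∣<δ δ≤r))
      where
      small : ∀ {s p δ} → 0# ≤ p → s ≤ δ → s * p + s * p ≤ (p + p) * δ
      small {s} {p} {δ} 0≤p s≤δ = begin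
        s * p + s * p    ≈⟨ solve 2 (λ t p → t :* p :+ t :* p := (p :+ p) :* t) refl s p ⟩
        (p + p) * s      ≤⟨ *-monoˡ-≤ (+-nonNeg 0≤p 0≤p) s≤δ ⟩
        (p + p) * δ      ∎

  -- Linear algebra

  infix 4 _≋_
  _≋_ : ∀ {n} → Vector Carrier n → Vector Carrier n → Set
  v ≋ w = ∀ i → v i ≈ w i

  dot : ∀ {n} → Vector Carrier n → Vector Carrier n → Carrier
  dot v w = sum (λ i → v i * w i)

  -- The ℓ¹ norm. Together with the sum of all absolute entries as `operator-bound` it keeps every
  -- estimate within the field operations; sharpness is irrelevant, since only orders of magnitude
  -- in t and ε matter.
  norm : ∀ {n} → Vector Carrier n → Carrier
  norm v = sum (λ i → ∣ v i ∣)

  δ : ∀ {n} → Fin n → Fin n → Carrier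
  δ i j = if does (i ≟ j) then 1# else 0#

  δ-suc : ∀ {n} (i j : Fin n) → δ (suc i) (suc j) ≡ δ i j
  δ-suc i j with i ≟ j
  ... | yes _ = ≡.refl
  ... | no _  = ≡.refl

  δ-refl : ∀ {n} (i : Fin n) → δ i i ≈ 1#
  δ-refl i with i ≟ i
  ... | yes _ = refl
  ... | no ¬p = contradiction ≡.refl ¬p

  δ-≢ : ∀ {n} {i j : Fin n} → ¬ (i ≡ j) → δ i j ≈ 0#
  δ-≢ {i = i} {j} i≢j with i ≟ j
  ... | yes p = contradiction p i≢j
  ... | no _  = refl

  sum-δ : ∀ {n} (i : Fin n) (v : Vector Carrier n) → sum (λ j → δ i j * v j) ≈ v i
  sum-δ zero    v = trans (+-cong (*-identityˡ _) (sum-0 {f = λ j → 0# * v (suc j)} λ j → zeroˡ (v (suc j)))) (+-identityʳ (v zero))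
  sum-δ (suc i) v = begin-equality
    0# * v zero + sum (λ j → δ (suc i) (suc j) * v (suc j))  ≈⟨ +-cong (zeroˡ _) (sum-cong-≋ λ j → *-congʳ (reflexive (δ-suc i j))) ⟩
    0# + sum (λ j → δ i j * v (suc j))                       ≈⟨ +-identityˡ _ ⟩
    sum (λ j → δ i j * v (suc j))                            ≈⟨ sum-δ i (v ∘ suc) ⟩
    v (suc i)                                                ∎

  sum-scale : ∀ {n} c (v : Vector Carrier n) → sum (λ i → c * v i) ≈ c * sum v
  sum-scale c v = sym (*-distribˡ-sum c v)

  dot-congˡ : ∀ {n} {v v′ w : Vector Carrier n} → v ≋ v′ → dot v w ≈ dot v′ w
  dot-congˡ h = sum-cong-≋ λ i → *-congʳ (h i)

  dot-comm : ∀ {n} (v w : Vector Carrier n) → dot v w ≈ dot w v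
  dot-comm v w = sum-cong-≋ λ i → *-comm (v i) (w i)

  dot-+ : ∀ {n} (u v w : Vector Carrier n) → dot (λ i → u i + v i) w ≈ dot u w + dot v w
  dot-+ u v w = trans (sum-cong-≋ λ i → distribʳ (w i) (u i) (v i)) (∑-distrib-+ (λ i → u i * w i) (λ i → v i * w i))

  dot-scale : ∀ {n} c (v w : Vector Carrier n) → dot (λ i → c * v i) w ≈ c * dot v w
  dot-scale c v w = trans (sum-cong-≋ λ i → *-assoc c (v i) (w i)) (sum-scale c (λ i → v i * w i))

  apply-cong : ∀ {n} (A : Matrix n) {v w} → v ≋ w → apply A v ≋ apply A w
  apply-cong A h i = sum-cong-≋ λ j → *-congˡ (h j)

  apply-+ : ∀ {n} (A : Matrix n) v w → apply A (λ i → v i + w i) ≋ λ i → apply A v i + apply A w i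
  apply-+ A v w i = trans (sum-cong-≋ λ j → distribˡ (A i j) (v j) (w j)) (∑-distrib-+ (λ j → A i j * v j) (λ j → A i j * w j))

  apply-scale : ∀ {n} (A : Matrix n) c v → apply A (λ i → c * v i) ≋ λ i → c * apply A v i
  apply-scale A c v i = trans
    (sum-cong-≋ λ j → solve 3 (λ a c v → a :* (c :* v) := c :* (a :* v)) refl (A i j) c (v j))
    (sum-scale c (λ j → A i j * v j))

  Symmetric : ∀ {n} → Matrix n → Set
  Symmetric A = ∀ i j → A i j ≈ A j i

  dot-apply : ∀ {n} {A : Matrix n} → Symmetric A → ∀ v w → dot (apply A v) w ≈ dot v (apply A w)
  dot-apply {n} {A} A-sym v w = begin-equality
    sum (λ i → sum (λ j → A i j * v j) * w i)    ≈⟨ sum-cong-≋ (λ i → *-distribʳ-sum (w i) (λ j → A i j * v j)) ⟩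
    sum (λ i → sum (λ j → A i j * v j * w i))    ≈⟨ ∑-comm (λ i j → A i j * v j * w i) ⟩
    sum (λ j → sum (λ i → A i j * v j * w i))    ≈⟨ sum-cong-≋ (λ j → sum-cong-≋ λ i → trans (*-congʳ (*-congʳ (A-sym i j)))
                                                      (solve 3 (λ a v w → a :* v :* w := v :* (a :* w)) refl (A j i) (v j) (w i))) ⟩
    sum (λ j → sum (λ i → v j * (A j i * w i)))  ≈⟨ sum-cong-≋ (λ j → sum-scale (v j) (λ i → A j i * w i)) ⟩
    sum (λ j → v j * sum (λ i → A j i * w i))    ∎

  norm-nonNeg : ∀ {n} (v : Vector Carrier n) → 0# ≤ norm v
  norm-nonNeg v = sum-nonNeg λ i → abs-nonNeg (v i)

  norm-cong : ∀ {n} {v w : Vector Carrier n} → v ≋ w → norm v ≈ norm w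
  norm-cong h = sum-cong-≋ λ i → abs-cong (h i)

  norm-triangle : ∀ {n} (v w : Vector Carrier n) → norm (λ i → v i + w i) ≤ norm v + norm w
  norm-triangle v w = ≤-trans (sum-mono-≤ λ i → abs-triangle (v i) (w i))
    (≤-reflexive (∑-distrib-+ (λ i → ∣ v i ∣) (λ i → ∣ w i ∣)))

  norm-scale : ∀ {n} c (v : Vector Carrier n) → norm (λ i → c * v i) ≈ ∣ c ∣ * norm v
  norm-scale c v = trans (sum-cong-≋ λ i → abs-* c (v i)) (sum-scale ∣ c ∣ (λ i → ∣ v i ∣))

  component≤norm : ∀ {n} (v : Vector Carrier n) i → ∣ v i ∣ ≤ norm v
  component≤norm v = term≤sum λ i → abs-nonNeg (v i)

  abs-dot : ∀ {n} (v w : Vector Carrier n) → ∣ dot v w ∣ ≤ norm v * norm w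
  abs-dot v w = begin
    ∣ dot v w ∣                      ≤⟨ abs-sum (λ i → v i * w i) ⟩
    sum (λ i → ∣ v i * w i ∣)        ≤⟨ sum-mono-≤ (λ i → ≤-trans (≤-reflexive (abs-* (v i) (w i))) (*-monoʳ-≤ (abs-nonNeg (w i)) (component≤norm v i))) ⟩
    sum (λ i → norm v * ∣ w i ∣)     ≈⟨ sum-scale (norm v) (λ i → ∣ w i ∣) ⟩
    norm v * norm w                  ∎

  operator-bound : ∀ {n} → Matrix n → Carrier
  operator-bound A = sum (λ i → norm (A i))

  operator-bound-nonNeg : ∀ {n} (A : Matrix n) → 0# ≤ operator-bound A
  operator-bound-nonNeg A = sum-nonNeg λ i → norm-nonNeg (A i)

  norm-apply : ∀ {n} (A : Matrix n) v → norm (apply A v) ≤ operator-bound A * norm v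
  norm-apply A v = ≤-trans (sum-mono-≤ λ i → abs-dot (A i) v)
    (≤-reflexive (sym (*-distribʳ-sum (norm v) (λ i → norm (A i)))))

  norm-pos : ∀ {n} {v : Vector Carrier n} → ¬ (∀ i → v i ≈ 0#) → 0# < norm v
  norm-pos {v = v} v≉0 = ≰⇒> λ p → v≉0 λ i → ∣x∣≤0⇒x≈0 (≤-trans (component≤norm v i) p)

  dot-self-pos : ∀ {n} {v : Vector Carrier n} → ¬ (∀ i → v i ≈ 0#) → 0# < dot v v
  dot-self-pos {v = v} v≉0 = ≰⇒> λ p → v≉0 λ i → ∣x∣≤0⇒x≈0 (≮⇒≥ λ 0<∣vᵢ∣ →
    <⇒≱ (*-pos 0<∣vᵢ∣ 0<∣vᵢ∣) (≤-trans (≤-reflexive (abs-square (v i)))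
      (≤-trans (term≤sum {f = λ i → v i * v i} (λ i → square-nonNeg (v i)) i) p)))

  -- Linear systems

  abstract
    -- Elimination in the first column. If that column is zero, the first unit vector is a solution;
    -- otherwise a pivot row p removes the first unknown from the other rows, which leaves one
    -- equation and one unknown fewer. This dimension count stands in for bases and determinants.
    homogeneous-solution : ∀ n (A : Fin n → Fin (suc n) → Carrier) →
      ∃ λ (v : Vector Carrier (suc n)) → ¬ (∀ j → v j ≈ 0#) × (∀ i → sum (λ j → A i j * v j) ≈ 0#)
    homogeneous-solution zero    A = (λ _ → 1#) , (λ h → 0≉1 (sym (h zero))) , λ ()
    homogeneous-solution (suc n) A with em {∃[ p ] ¬ (A p zero ≈ 0#)}
    ... | no ∄ = 1# ∷ (λ _ → 0#) , (λ h → 0≉1 (sym (h zero))) , λ i →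
      trans (+-cong (trans (*-identityʳ (A i zero)) (first-column i)) (sum-0 {f = λ j → A i (suc j) * 0#} λ j → zeroʳ (A i (suc j)))) (+-identityˡ 0#)
      where
      first-column : ∀ i → A i zero ≈ 0#
      first-column i with em {A i zero ≈ 0#}
      ... | yes p = p
      ... | no ¬p = contradiction (i , ¬p) ∄
    ... | yes (p , a≉0) =
      let c , ac≈1 = inverse (A p zero) a≉0
          v , v≉0 , sol = homogeneous-solution n (eliminated c)
      in extend c v , (λ h → v≉0 (h ∘ suc)) , solves c ac≈1 v sol
      where
      row : ∀ {n} → (Fin n → Carrier) → (Fin n → Carrier) → Carrier
      row a v = sum (λ j → a j * v j)
      eliminated : Carrier → Fin n → Fin (suc n) → Carrier
      eliminated c i j = A (punchIn p i) (suc j) + - (A (punchIn p i) zero * c) * A p (suc j)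
      extend : Carrier → (Fin (suc n) → Carrier) → Fin (suc (suc n)) → Carrier
      -- The first unknown is recovered from the pivot row, c being the inverse of the pivot.
      extend c v = - (c * row (λ j → A p (suc j)) v) ∷ v
      combine : ∀ {n} (a b v : Fin n → Carrier) d → row (λ j → a j + d * b j) v ≈ row a v + d * row b v
      combine a b v d = trans (dot-+ a (λ j → d * b j) v) (+-congˡ (dot-scale d b v))
      solves : ∀ c → A p zero * c ≈ 1# → ∀ v → (∀ i → row (eliminated c i) v ≈ 0#) →
               ∀ i → row (A i) (extend c v) ≈ 0#
      solves c ac≈1 v sol i with p ≟ i
      ... | yes ≡.refl = begin-equality
        A p zero * - (c * S) + S      ≈⟨ solve 3 (λ a c s → a :* :- (c :* s) :+ s := :- (a :* c) :* s :+ s) refl (A p zero) c S ⟩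
        - (A p zero * c) * S + S      ≈⟨ +-congʳ (*-congʳ (-‿cong ac≈1)) ⟩
        - 1# * S + S                  ≈⟨ solve 1 (λ s → :- con (+ 1) :* s :+ s := con (+ 0)) refl S ⟩
        0#                            ∎
        where
        S : Carrier
        S = row (λ j → A p (suc j)) v
      ... | no p≢i = ≡.subst (λ i → row (A i) (extend c v) ≈ 0#) (punchIn-punchOut p≢i) (begin-equality
        A i′ zero * - (c * S) + row (λ j → A i′ (suc j)) v
          ≈⟨ solve 4 (λ a c s t → a :* :- (c :* s) :+ t := t :+ :- (a :* c) :* s) refl (A i′ zero) c S (row (λ j → A i′ (suc j)) v) ⟩
        row (λ j → A i′ (suc j)) v + - (A i′ zero * c) * S
          ≈⟨ combine (λ j → A i′ (suc j)) (λ j → A p (suc j)) v (- (A i′ zero * c)) ⟨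
        row (eliminated c (punchOut p≢i)) v
          ≈⟨ sol (punchOut p≢i) ⟩
        0# ∎)
        where
        S : Carrier
        S = row (λ j → A p (suc j)) v
        i′ : Fin (suc n)
        i′ = punchIn p (punchOut p≢i)

  Injective : ∀ {n} → Matrix n → Set
  Injective A = ∀ v → (∀ i → apply A v i ≈ 0#) → ∀ i → v i ≈ 0#

  abstract
    -- A nontrivial relation between the columns of A and eₖ must involve eₖ.
    solve-basis : ∀ {n} (A : Matrix n) → Injective A → ∀ k →
                  ∃ λ (v : Vector Carrier n) → ∀ i → apply A v i ≈ δ i k
    solve-basis {n} A inj k =
      let v , v≉0 , sol = homogeneous-solution n (λ i → (- δ i k) ∷ A i)
          c , v₀c≈1 = inverse (v zero) (v₀≉0 v v≉0 sol)
      in (λ j → c * v (suc j)) , solves v sol c v₀c≈1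
      where
      split : ∀ (v : Vector Carrier (suc n)) → (∀ i → - δ i k * v zero + apply A (v ∘ suc) i ≈ 0#) →
              ∀ i → apply A (v ∘ suc) i ≈ δ i k * v zero
      split v sol i = begin-equality
        a                          ≈⟨ solve 3 (λ a d v → a := (:- d :* v :+ a) :+ d :* v) refl a (δ i k) (v zero) ⟩
        (- δ i k * v zero + a) + δ i k * v zero  ≈⟨ +-congʳ (sol i) ⟩
        0# + δ i k * v zero        ≈⟨ +-identityˡ _ ⟩
        δ i k * v zero             ∎
        where
        a : Carrier
        a = apply A (v ∘ suc) i
      v₀≉0 : ∀ (v : Vector Carrier (suc n)) → ¬ (∀ j → v j ≈ 0#) → (∀ i → - δ i k * v zero + apply A (v ∘ suc) i ≈ 0#) → ¬ (v zero ≈ 0#)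
      v₀≉0 v v≉0 sol v₀≈0 = v≉0 λ
        { zero    → v₀≈0
        ; (suc j) → inj (v ∘ suc) (λ i → trans (split v sol i) (trans (*-congˡ v₀≈0) (zeroʳ _))) j }
      solves : ∀ (v : Vector Carrier (suc n)) → (∀ i → - δ i k * v zero + apply A (v ∘ suc) i ≈ 0#) → ∀ c → v zero * c ≈ 1# →
               ∀ i → apply A (λ j → c * v (suc j)) i ≈ δ i k
      solves v sol c v₀c≈1 i = begin-equality
        apply A (λ j → c * v (suc j)) i  ≈⟨ apply-scale A c (v ∘ suc) i ⟩
        c * apply A (v ∘ suc) i          ≈⟨ *-congˡ (split v sol i) ⟩
        c * (δ i k * v zero)             ≈⟨ solve 3 (λ c d v → c :* (d :* v) := d :* (v :* c)) refl c (δ i k) (v zero) ⟩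
        δ i k * (v zero * c)             ≈⟨ *-congˡ v₀c≈1 ⟩
        δ i k * 1#                       ≈⟨ *-identityʳ _ ⟩
        δ i k                            ∎

    -- Column k of `S` is the solution for eₖ; linearity does the rest.
    right-inverse : ∀ {n} (A : Matrix n) → Injective A → ∃[ S ] (∀ r → apply A (apply S r) ≋ r)
    right-inverse {n} A inj = S , λ r i → begin-equality
      sum (λ j → A i j * sum (λ k → S j k * r k))    ≈⟨ sum-cong-≋ (λ j → *-distribˡ-sum (A i j) (λ k → S j k * r k)) ⟩
      sum (λ j → sum (λ k → A i j * (S j k * r k)))  ≈⟨ ∑-comm (λ j k → A i j * (S j k * r k)) ⟩
      sum (λ k → sum (λ j → A i j * (S j k * r k)))  ≈⟨ sum-cong-≋ (λ k → trans (sum-cong-≋ λ j → sym (*-assoc (A i j) (S j k) (r k)))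
                                                          (sym (*-distribʳ-sum (r k) (λ j → A i j * S j k)))) ⟩
      sum (λ k → apply A (λ j → S j k) i * r k)      ≈⟨ sum-cong-≋ (λ k → *-congʳ (proj₂ (solve-basis A inj k) i)) ⟩
      sum (λ k → δ i k * r k)                        ≈⟨ sum-δ i r ⟩
      r i                                            ∎
      where
      S : Matrix n
      S j k = proj₁ (solve-basis A inj k) j

  -- The reduced resolvent at a simple eigenvalue

  record SimpleEigenpair {n} (L : Matrix n) (μ : Carrier) (f : Vector Carrier n) : Set where
    field
      symmetric  : Symmetric L
      nonzero    : ¬ (∀ i → f i ≈ 0#)
      eigen      : ∀ i → apply L f i ≈ μ * f i
      eigenspace : ∀ g → (∀ i → apply L g i ≈ μ * g i) → ∃[ a ] (∀ i → g i ≈ a * f i)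

  -- Only the action on the complement of f is prescribed. There `inverseʳ` solves the recursion for
  -- the coefficients of the perturbed eigenvector, and `inverseˡ` recovers a vector from its
  -- residual, which gives norm bounds.
  record ReducedResolvent {n} (L : Matrix n) (μ : Carrier) (f : Vector Carrier n) : Set where
    field
      matrix     : Matrix n
      orthogonal : ∀ r → dot r f ≈ 0# → dot (apply matrix r) f ≈ 0#
      inverseʳ   : ∀ r → dot r f ≈ 0# → ∀ i → apply L (apply matrix r) i - μ * apply matrix r i ≈ r i
      inverseˡ   : ∀ h → dot h f ≈ 0# → ∀ i → apply matrix (λ i → apply L h i - μ * h i) i ≈ h i

  -- The resolvent is the inverse of L − μ + f fᵀ, which is invertible since μ is
  -- simple and L symmetric.
  module _ {n} {L : Matrix n} {μ : Carrier} {f : Vector Carrier n} (E : SimpleEigenpair L μ f) where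
    open SimpleEigenpair E

    residual : Vector Carrier n → Vector Carrier n
    residual v i = apply L v i - μ * v i

    private
      N : Carrier
      N = dot f f

      N≉0 : ¬ (N ≈ 0#)
      N≉0 = pos⇒≉0 (dot-self-pos nonzero)

      bordered : Matrix n
      bordered i j = (L i j + - μ * δ i j) + f i * f j

      apply-bordered : ∀ v i → apply bordered v i ≈ residual v i + f i * dot f v
      apply-bordered v i = begin-equality
        dot (bordered i) v                                        ≈⟨ dot-+ (λ j → L i j + - μ * δ i j) (λ j → f i * f j) v ⟩
        dot (λ j → L i j + - μ * δ i j) v + dot (λ j → f i * f j) v ≈⟨ +-cong (dot-+ (L i) (λ j → - μ * δ i j) v) (dot-scale (f i) f v) ⟩
        (apply L v i + dot (λ j → - μ * δ i j) v) + f i * dot f v ≈⟨ +-congʳ (+-congˡ (trans (dot-scale (- μ) (δ i) v) (*-congˡ (sum-δ i v)))) ⟩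
        (apply L v i + - μ * v i) + f i * dot f v                 ≈⟨ +-congʳ (+-congˡ (-‿distribˡ-* μ (v i))) ⟨
        residual v i + f i * dot f v                              ∎

    -- By symmetry ⟨(L - μ)v, f⟩ = ⟨v, (L - μ)f⟩, and L - μ annihilates f. Orthogonality to f is
    -- thus the solvability condition for L - μ.
    dot-residual : ∀ v → dot (residual v) f ≈ 0#
    dot-residual v = begin-equality
      dot (residual v) f                           ≈⟨ dot-congˡ (λ i → +-congˡ (-‿distribˡ-* μ (v i))) ⟩
      dot (λ i → apply L v i + - μ * v i) f        ≈⟨ dot-+ (apply L v) (λ i → - μ * v i) f ⟩
      dot (apply L v) f + dot (λ i → - μ * v i) f  ≈⟨ +-cong (dot-apply symmetric v f) (dot-scale (- μ) v f) ⟩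
      dot v (apply L f) + - μ * dot v f            ≈⟨ +-congʳ (trans (dot-comm v (apply L f)) (trans (dot-congˡ eigen) (dot-scale μ f v))) ⟩
      μ * dot f v + - μ * dot v f                  ≈⟨ +-congʳ (*-congˡ (dot-comm f v)) ⟩
      μ * dot v f + - μ * dot v f                  ≈⟨ solve 2 (λ m d → m :* d :+ :- m :* d := con (+ 0)) refl μ (dot v f) ⟩
      0#                                           ∎

    private
      dot-bordered : ∀ v → dot (apply bordered v) f ≈ dot f v * N
      dot-bordered v = begin-equality
        dot (apply bordered v) f                          ≈⟨ dot-congˡ (apply-bordered v) ⟩
        dot (λ i → residual v i + f i * dot f v) f        ≈⟨ dot-+ (residual v) (λ i → f i * dot f v) f ⟩
        dot (residual v) f + dot (λ i → f i * dot f v) f  ≈⟨ +-cong (dot-residual v) (dot-congˡ λ i → *-comm (f i) (dot f v)) ⟩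
        0# + dot (λ i → dot f v * f i) f                  ≈⟨ +-identityˡ _ ⟩
        dot (λ i → dot f v * f i) f                       ≈⟨ dot-scale (dot f v) f f ⟩
        dot f v * N                                       ∎

      -- Pairing with f sees only the rank-one part f fᵀ, because the range of L - μ is orthogonal
      -- to f. Hence a right-hand side orthogonal to f forces a solution orthogonal to f.
      orthogonal-of : ∀ v r → apply bordered v ≋ r → dot r f ≈ 0# → dot f v ≈ 0#
      orthogonal-of v r eq r⊥f = *-cancelˡ-0 N≉0 (begin-equality
        N * dot f v               ≈⟨ *-comm N (dot f v) ⟩
        dot f v * N               ≈⟨ dot-bordered v ⟨
        dot (apply bordered v) f  ≈⟨ dot-congˡ eq ⟩
        dot r f                   ≈⟨ r⊥f ⟩
        0#                        ∎)

      bordered-⊥ : ∀ v → dot f v ≈ 0# → apply bordered v ≋ residual v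
      bordered-⊥ v v⊥f i = begin-equality
        apply bordered v i            ≈⟨ apply-bordered v i ⟩
        residual v i + f i * dot f v  ≈⟨ +-congˡ (trans (*-congˡ v⊥f) (zeroʳ (f i))) ⟩
        residual v i + 0#             ≈⟨ +-identityʳ _ ⟩
        residual v i                  ∎

      -- A kernel vector is orthogonal to f, so the rank-one part drops out and the vector lies in
      -- the eigenspace. It is then a multiple of f orthogonal to f.
      bordered-injective : Injective bordered
      bordered-injective v eq = multiple-0 (eigenspace v λ i → begin-equality
          apply L v i                        ≈⟨ solve 2 (λ x y → x := (x :- y) :+ y) refl (apply L v i) (μ * v i) ⟩
          residual v i + μ * v i             ≈⟨ +-congʳ (trans (sym (bordered-⊥ v v⊥f i)) (eq i)) ⟩
          0# + μ * v i                       ≈⟨ +-identityˡ _ ⟩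
          μ * v i                            ∎)
        where
        v⊥f : dot f v ≈ 0#
        v⊥f = orthogonal-of v (λ _ → 0#) eq (sum-0 {f = λ i → 0# * f i} λ i → zeroˡ (f i))
        multiple-0 : ∃[ a ] (∀ i → v i ≈ a * f i) → ∀ i → v i ≈ 0#
        multiple-0 (a , v≈af) i = trans (v≈af i) (trans (*-congʳ (*-cancelˡ-0 N≉0 (begin-equality
          N * a                      ≈⟨ *-comm N a ⟩
          a * N                      ≈⟨ dot-scale a f f ⟨
          dot (λ i → a * f i) f      ≈⟨ dot-congˡ v≈af ⟨
          dot v f                    ≈⟨ dot-comm v f ⟩
          dot f v                    ≈⟨ v⊥f ⟩
          0#                         ∎))) (zeroˡ (f i)))

    abstract
      reducedResolvent : ReducedResolvent L μ f
      reducedResolvent = resolvent (right-inverse bordered bordered-injective)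
        where
        resolvent : ∃[ S ] (∀ r → apply bordered (apply S r) ≋ r) → ReducedResolvent L μ f
        resolvent (S , bS) = record
          { matrix     = S
          ; orthogonal = λ r r⊥f → trans (dot-comm (apply S r) f) (⊥ r r⊥f)
          ; inverseʳ   = λ r r⊥f i → trans (sym (bordered-⊥ (apply S r) (⊥ r r⊥f) i)) (bS r i)
          -- So far S is only a right inverse. But S(L - μ)h and h have the same image under
          -- `bordered`, so injectivity identifies them.
          ; inverseˡ   = λ h h⊥f i → begin-equality
              apply S (residual h) i                  ≈⟨ solve 2 (λ x y → x := (x :+ :- con (+ 1) :* y) :+ y) refl (apply S (residual h) i) (h i) ⟩
              (apply S (residual h) i + - 1# * h i) + h i  ≈⟨ +-congʳ (bordered-injective (λ i → apply S (residual h) i + - 1# * h i) (difference h h⊥f) i) ⟩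
              0# + h i                                ≈⟨ +-identityˡ (h i) ⟩
              h i                                     ∎
          }
          where
          ⊥ : ∀ r → dot r f ≈ 0# → dot f (apply S r) ≈ 0#
          ⊥ r r⊥f = orthogonal-of (apply S r) r (bS r) r⊥f
          difference : ∀ h → dot h f ≈ 0# → ∀ i → apply bordered (λ i → apply S (residual h) i + - 1# * h i) i ≈ 0#
          difference h h⊥f i = begin-equality
            apply bordered (λ i → apply S (residual h) i + - 1# * h i) i
              ≈⟨ apply-+ bordered (apply S (residual h)) (λ i → - 1# * h i) i ⟩
            apply bordered (apply S (residual h)) i + apply bordered (λ i → - 1# * h i) i
              ≈⟨ +-cong (bS (residual h) i) (trans (apply-scale bordered (- 1#) h i) (*-congˡ (bordered-⊥ h (trans (dot-comm f h) h⊥f) i))) ⟩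
            residual h i + - 1# * residual h i
              ≈⟨ solve 1 (λ x → x :+ :- con (+ 1) :* x := con (+ 0)) refl (residual h i) ⟩
            0# ∎

  -- Cauchy products

  conv : Sequence → Sequence → Sequence
  conv a b zero    = a 0 * b 0
  conv a b (suc k) = a 0 * b (suc k) + conv (a ∘ suc) b k

  -- Agreement up to index k is all that course-of-values recursion can offer.
  conv-cong : ∀ {a a′ b b′ : Sequence} k → (∀ i → i ℕ.≤ k → a i ≈ a′ i) → (∀ i → i ℕ.≤ k → b i ≈ b′ i) →
              conv a b k ≈ conv a′ b′ k
  conv-cong zero    ha hb = *-cong (ha 0 z≤n) (hb 0 z≤n)
  conv-cong {a} {a′} {b} {b′} (suc k) ha hb = +-cong (*-cong (ha 0 z≤n) (hb (suc k) ℕ.≤-refl))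
    (conv-cong {a ∘ suc} {a′ ∘ suc} {b} {b′} k (λ i i≤k → ha (suc i) (s≤s i≤k)) (λ i i≤k → hb i (ℕ.m≤n⇒m≤1+n i≤k)))

  -- Meant for b j = ⟨gⱼ, f⟩, where only g₀ = f contributes.
  conv-head : ∀ (a b : Sequence) k → (∀ j → suc j ℕ.≤ k → b (suc j) ≈ 0#) → conv a b k ≈ a k * b 0
  conv-head a b zero    h = refl
  conv-head a b (suc k) h = begin-equality
    a 0 * b (suc k) + conv (a ∘ suc) b k
      ≈⟨ +-cong (trans (*-congˡ (h k ℕ.≤-refl)) (zeroʳ (a 0))) (conv-head (a ∘ suc) b k λ j p → h j (ℕ.m≤n⇒m≤1+n p)) ⟩
    0# + a (suc k) * b 0
      ≈⟨ +-identityˡ (a (suc k) * b 0) ⟩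
    a (suc k) * b 0 ∎

  conv-mono-≤ : ∀ {a a′ b b′ : Sequence} → (∀ i → 0# ≤ a′ i) → (∀ i → 0# ≤ b i) →
                (∀ i → a i ≤ a′ i) → (∀ i → b i ≤ b′ i) → ∀ k → conv a b k ≤ conv a′ b′ k
  conv-mono-≤ 0≤a′ 0≤b ha hb zero    = *-mono-≤ (0≤a′ 0) (0≤b 0) (ha 0) (hb 0)
  conv-mono-≤ {a} {a′} {b} {b′} 0≤a′ 0≤b ha hb (suc k) = +-mono-≤ (*-mono-≤ (0≤a′ 0) (0≤b (suc k)) (ha 0) (hb (suc k)))
    (conv-mono-≤ {a ∘ suc} {a′ ∘ suc} {b} {b′} (0≤a′ ∘ suc) 0≤b (ha ∘ suc) hb k)

  conv-scaleˡ : ∀ c (a b : Sequence) k → conv (λ i → c * a i) b k ≈ c * conv a b k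
  conv-scaleˡ c a b zero    = *-assoc c (a 0) (b 0)
  conv-scaleˡ c a b (suc k) = begin-equality
    c * a 0 * b (suc k) + conv (λ i → c * a (suc i)) b k  ≈⟨ +-cong (*-assoc c (a 0) (b (suc k))) (conv-scaleˡ c (a ∘ suc) b k) ⟩
    c * (a 0 * b (suc k)) + c * conv (a ∘ suc) b k        ≈⟨ distribˡ c (a 0 * b (suc k)) (conv (a ∘ suc) b k) ⟨
    c * (a 0 * b (suc k) + conv (a ∘ suc) b k)            ∎

  infixl 8 _scaledBy_
  _scaledBy_ : Sequence → Carrier → Sequence
  (a scaledBy t) i = a i * t ^ i

  scaledBy-tail : ∀ a t i → (a scaledBy t) (suc i) ≈ t * ((a ∘ suc) scaledBy t) i
  scaledBy-tail a t i = solve 3 (λ a t x → a :* (t :* x) := t :* (a :* x)) refl (a (suc i)) t (t ^ i)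

  conv-tail-scaledBy : ∀ (a b : Sequence) t k →
    conv ((a scaledBy t) ∘ suc) b k ≈ t * conv ((a ∘ suc) scaledBy t) b k
  conv-tail-scaledBy a b t k = trans
    (conv-cong {(a scaledBy t) ∘ suc} {λ i → t * ((a ∘ suc) scaledBy t) i} {b} {b} k (λ i _ → scaledBy-tail a t i) (λ _ _ → refl))
    (conv-scaleˡ t ((a ∘ suc) scaledBy t) b k)

  conv-scaledBy : ∀ (a b : Sequence) t k → conv (a scaledBy t) (b scaledBy t) k ≈ conv a b k * t ^ k
  conv-scaledBy a b t zero    = solve 2 (λ a b → (a :* con (+ 1)) :* (b :* con (+ 1)) := (a :* b) :* con (+ 1)) refl (a 0) (b 0)
  conv-scaledBy a b t (suc k) = begin-equality
    (a 0 * 1#) * (b (suc k) * (t * t ^ k)) + conv ((a scaledBy t) ∘ suc) (b scaledBy t) k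
      ≈⟨ +-congˡ (conv-tail-scaledBy a (b scaledBy t) t k) ⟩
    (a 0 * 1#) * (b (suc k) * (t * t ^ k)) + t * conv ((a ∘ suc) scaledBy t) (b scaledBy t) k
      ≈⟨ +-congˡ (*-congˡ (conv-scaledBy (a ∘ suc) b t k)) ⟩
    (a 0 * 1#) * (b (suc k) * (t * t ^ k)) + t * (conv (a ∘ suc) b k * t ^ k)
      ≈⟨ solve 5 (λ a b t x c → (a :* con (+ 1)) :* (b :* (t :* x)) :+ t :* (c :* x) := (a :* b :+ c) :* (t :* x)) refl
           (a 0) (b (suc k)) t (t ^ k) (conv (a ∘ suc) b k) ⟩
    (a 0 * b (suc k) + conv (a ∘ suc) b k) * (t * t ^ k) ∎

  psum-conv-suc : ∀ (a b : Sequence) k →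
    psum (conv a b) (suc k) ≈ a 0 * psum b (suc k) + psum (conv (a ∘ suc) b) k
  psum-conv-suc a b k = begin-equality
    a 0 * b 0 + psum (λ i → a 0 * b (suc i) + conv (a ∘ suc) b i) k
      ≈⟨ +-congˡ (psum-+ (λ i → a 0 * b (suc i)) (conv (a ∘ suc) b) k) ⟩
    a 0 * b 0 + (psum (λ i → a 0 * b (suc i)) k + psum (conv (a ∘ suc) b) k)
      ≈⟨ +-congˡ (+-congʳ (psum-scale (a 0) (b ∘ suc) k)) ⟩
    a 0 * b 0 + (a 0 * psum (b ∘ suc) k + psum (conv (a ∘ suc) b) k)
      ≈⟨ solve 4 (λ a b s c → a :* b :+ (a :* s :+ c) := a :* (b :+ s) :+ c) refl (a 0) (b 0) (psum (b ∘ suc) k) (psum (conv (a ∘ suc) b) k) ⟩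
    a 0 * psum b (suc k) + psum (conv (a ∘ suc) b) k ∎

  -- Of the pairs i, j < k in the product, the truncated Cauchy product keeps only those with i + j
  -- < k, and every omitted term is nonnegative.
  psum-conv-≤ : ∀ (a b : Sequence) → (∀ i → 0# ≤ a i) → (∀ i → 0# ≤ b i) →
                ∀ k → psum (conv a b) k ≤ psum a k * psum b k
  psum-conv-≤ a b 0≤a 0≤b zero    = ≤-reflexive (sym (zeroˡ 0#))
  psum-conv-≤ a b 0≤a 0≤b (suc k) = begin
    psum (conv a b) (suc k)                                  ≈⟨ psum-conv-suc a b k ⟩
    a 0 * psum b (suc k) + psum (conv (a ∘ suc) b) k         ≤⟨ +-mono-≤ ≤-refl (psum-conv-≤ (a ∘ suc) b (0≤a ∘ suc) 0≤b k) ⟩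
    a 0 * psum b (suc k) + psum (a ∘ suc) k * psum b k       ≤⟨ +-mono-≤ ≤-refl (*-monoˡ-≤ (psum-nonNeg {a ∘ suc} (0≤a ∘ suc) k) (psum-step {b} 0≤b k)) ⟩
    a 0 * psum b (suc k) + psum (a ∘ suc) k * psum b (suc k) ≈⟨ distribʳ (psum b (suc k)) (a 0) (psum (a ∘ suc) k) ⟨
    psum a (suc k) * psum b (suc k)                          ∎

  absolute : Sequence → Sequence
  absolute a i = ∣ a i ∣

  abs-scaledBy : ∀ a {t} → ∣ t ∣ ≤ 1# → ∀ i → ∣ (a scaledBy t) i ∣ ≤ ∣ a i ∣
  abs-scaledBy a {t} ∣t∣≤1 i = begin
    ∣ a i * t ^ i ∣        ≈⟨ trans (abs-* (a i) (t ^ i)) (*-congˡ (abs-^ t i)) ⟩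
    ∣ a i ∣ * ∣ t ∣ ^ i    ≤⟨ *-monoˡ-≤ (abs-nonNeg (a i)) (^-≤1 (abs-nonNeg t) ∣t∣≤1 i) ⟩
    ∣ a i ∣ * 1#           ≈⟨ *-identityʳ ∣ a i ∣ ⟩
    ∣ a i ∣                ∎

  abs-psum-scaledBy : ∀ a {t} → ∣ t ∣ ≤ 1# → ∀ k → psum (absolute (a scaledBy t)) k ≤ psum (absolute a) k
  abs-psum-scaledBy a {t} ∣t∣≤1 = psum-mono-≤ {absolute (a scaledBy t)} {absolute a} (abs-scaledBy a ∣t∣≤1)

  -- The products aᵢbⱼtⁱ⁺ʲ with i, j < k missing from the truncated Cauchy product have i + j ≥ k.
  cauchy-product-error : ∀ (a b : Sequence) {t} → ∣ t ∣ ≤ 1# → ∀ k →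
    ∣ psum (a scaledBy t) k * psum (b scaledBy t) k - psum (conv (a scaledBy t) (b scaledBy t)) k ∣
      ≤ ∣ t ∣ ^ k * (psum (absolute a) k * psum (absolute b) k)
  cauchy-product-error a b {t} ∣t∣≤1 zero = ≤-reflexive (begin-equality
    ∣ 0# * 0# - 0# ∣     ≈⟨ abs-cong (solve 0 (con (+ 0) :* con (+ 0) :- con (+ 0) := con (+ 0)) refl) ⟩
    ∣ 0# ∣               ≈⟨ ∣0∣≈0 ⟩
    0#                   ≈⟨ solve 0 (con (+ 0) := con (+ 1) :* (con (+ 0) :* con (+ 0))) refl ⟩
    1# * (0# * 0#)       ∎)
  cauchy-product-error a b {t} ∣t∣≤1 (suc k) = begin
    ∣ psum as (suc k) * psum bs (suc k) - psum (conv as bs) (suc k) ∣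
      -- Splitting off a₀ cancels the row i = 0 and brings out a factor t. What remains is the error
      -- for the shifted sequence together with the products containing the last term bₖ tᵏ.
      ≈⟨ abs-cong error-suc ⟩
    ∣ t * (T * bs k + (T * psum bs k - Q)) ∣
      ≈⟨ abs-* t (T * bs k + (T * psum bs k - Q)) ⟩
    ∣ t ∣ * ∣ T * bs k + (T * psum bs k - Q) ∣
      ≤⟨ *-monoˡ-≤ (abs-nonNeg t) (≤-trans (abs-triangle (T * bs k) (T * psum bs k - Q))
           (+-mono-≤ last-term (cauchy-product-error (a ∘ suc) b ∣t∣≤1 k))) ⟩
    ∣ t ∣ * (A * (∣ b k ∣ * ∣ t ∣ ^ k) + ∣ t ∣ ^ k * (A * psum (absolute b) k))
      ≈⟨ solve 5 (λ t A b x B → t :* (A :* (b :* x) :+ x :* (A :* B)) := (t :* x) :* (A :* (B :+ b))) refl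
           (∣ t ∣) A (∣ b k ∣) (∣ t ∣ ^ k) (psum (absolute b) k) ⟩
    (∣ t ∣ * ∣ t ∣ ^ k) * (A * (psum (absolute b) k + ∣ b k ∣))
      ≈⟨ *-congˡ (*-congˡ (psum-last (absolute b) k)) ⟨
    (∣ t ∣ * ∣ t ∣ ^ k) * (A * psum (absolute b) (suc k))
      ≤⟨ *-monoˡ-≤ (^-nonNeg (abs-nonNeg t) (suc k)) (*-monoʳ-≤ (psum-nonNeg {absolute b} (λ i → abs-nonNeg (b i)) (suc k)) (y≤x+y (abs-nonNeg (a 0)))) ⟩
    (∣ t ∣ * ∣ t ∣ ^ k) * (psum (absolute a) (suc k) * psum (absolute b) (suc k)) ∎
    where
    as bs ta : Sequence
    as = a scaledBy t
    bs = b scaledBy t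
    ta = (a ∘ suc) scaledBy t
    T Q A : Carrier
    T = psum ta k
    Q = psum (conv ta bs) k
    A = psum (absolute (a ∘ suc)) k
    tail-psum : psum (as ∘ suc) k ≈ t * T
    tail-psum = trans (psum-cong {as ∘ suc} {λ i → t * ta i} (scaledBy-tail a t) k) (psum-scale t ta k)
    tail-conv : psum (conv (as ∘ suc) bs) k ≈ t * Q
    tail-conv = trans (psum-cong {conv (as ∘ suc) bs} {λ i → t * conv ta bs i} (conv-tail-scaledBy a bs t) k)
      (psum-scale t (conv ta bs) k)
    error-suc : psum as (suc k) * psum bs (suc k) - psum (conv as bs) (suc k) ≈ t * (T * bs k + (T * psum bs k - Q))
    error-suc = begin-equality
      (as 0 + psum (as ∘ suc) k) * psum bs (suc k) - psum (conv as bs) (suc k)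
        ≈⟨ +-cong (*-congʳ (+-congˡ tail-psum)) (-‿cong (trans (psum-conv-suc as bs k) (+-congˡ tail-conv))) ⟩
      (as 0 + t * T) * psum bs (suc k) - (as 0 * psum bs (suc k) + t * Q)
        ≈⟨ solve 5 (λ a t T B Q → (a :+ t :* T) :* B :- (a :* B :+ t :* Q) := t :* (T :* B :- Q)) refl (as 0) t T (psum bs (suc k)) Q ⟩
      t * (T * psum bs (suc k) - Q)
        ≈⟨ *-congˡ (+-congʳ (*-congˡ (psum-last bs k))) ⟩
      t * (T * (psum bs k + bs k) - Q)
        ≈⟨ solve 5 (λ t T B b Q → t :* (T :* (B :+ b) :- Q) := t :* (T :* b :+ (T :* B :- Q))) refl t T (psum bs k) (bs k) Q ⟩
      t * (T * bs k + (T * psum bs k - Q)) ∎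
    last-term : ∣ T * bs k ∣ ≤ A * (∣ b k ∣ * ∣ t ∣ ^ k)
    last-term = begin
      ∣ T * bs k ∣                      ≈⟨ abs-* T (bs k) ⟩
      ∣ T ∣ * ∣ b k * t ^ k ∣           ≤⟨ *-monoʳ-≤ (abs-nonNeg (b k * t ^ k)) (≤-trans (abs-psum ta k) (abs-psum-scaledBy (a ∘ suc) ∣t∣≤1 k)) ⟩
      A * ∣ b k * t ^ k ∣               ≈⟨ *-congˡ (trans (abs-* (b k) (t ^ k)) (*-congˡ (abs-^ t k))) ⟩
      A * (∣ b k ∣ * ∣ t ∣ ^ k)         ∎

  -- C and D bound the coefficients, that is, the series at t = 1, while the product is taken at |t|
  -- ≤ 1/2. The error is then at most |t|ᵏ C D, which tends to 0.
  cauchy-product : ∀ (a b : Sequence) {t l m C D} → ∣ t ∣ + ∣ t ∣ ≤ 1# →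
    (∀ k → psum (absolute a) k ≤ C) → (∀ k → psum (absolute b) k ≤ D) →
    ConvergesTo (psum (a scaledBy t)) l → ConvergesTo (psum (b scaledBy t)) m →
    ConvergesTo (psum (conv (a scaledBy t) (b scaledBy t))) (l * m)
  cauchy-product a b {t} {l} {m} {C} {D} 2∣t∣≤1 bnd-a bnd-b conv-a conv-b =
    lim-cong (λ k → solve 2 (λ p q → p :+ :- (p :- q) := q) refl (P k) (Q k))
      (solve 1 (λ x → x :+ :- con (+ 0) := x) refl (l * m))
      (lim-+ (lim-* conv-a conv-b) (lim-neg error-vanishes))
    where
    P Q : Sequence
    P k = psum (a scaledBy t) k * psum (b scaledBy t) k
    Q = psum (conv (a scaledBy t) (b scaledBy t))
    ∣t∣≤1 : ∣ t ∣ ≤ 1#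
    ∣t∣≤1 = ≤-trans (x≤x+y (abs-nonNeg t)) 2∣t∣≤1
    -- The empty partial sum, which is 0, already satisfies the bound.
    0≤C : 0# ≤ C
    0≤C = bnd-a 0
    0≤D : 0# ≤ D
    0≤D = bnd-b 0
    error-vanishes : ConvergesTo (λ k → P k - Q k) 0#
    error-vanishes = converges-≤ (*-nonNeg 0≤C 0≤D) λ ε 0<ε → map₁ (λ k p → begin
      ∣ (P k - Q k) - 0# ∣              ≈⟨ abs-cong (solve 1 (λ x → x :- con (+ 0) := x) refl (P k - Q k)) ⟩
      ∣ P k - Q k ∣                     ≤⟨ cauchy-product-error a b ∣t∣≤1 k ⟩
      ∣ t ∣ ^ k * (psum (absolute a) k * psum (absolute b) k)
        ≤⟨ *-mono-≤ (<⇒≤ 0<ε) (*-nonNeg (psum-nonNeg {absolute a} (λ i → abs-nonNeg (a i)) k) (psum-nonNeg {absolute b} (λ i → abs-nonNeg (b i)) k))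
             (≤-trans (x≤∣x∣ (∣ t ∣ ^ k)) (≤-trans (abs-cong-≤ (solve 1 (λ x → x := x :- con (+ 0)) refl (∣ t ∣ ^ k))) (<⇒≤ p)))
             (*-mono-≤ 0≤C (psum-nonNeg {absolute b} (λ i → abs-nonNeg (b i)) k) (bnd-a k) (bnd-b k)) ⟩
      ε * (C * D)                       ≈⟨ *-comm ε (C * D) ⟩
      C * D * ε                         ∎) (^-vanishes (abs-nonNeg t) 2∣t∣≤1 ε 0<ε)

  norm-conv : ∀ {n} (a : Sequence) (g : ℕ → Vector Carrier n) k →
    norm (λ i → conv a (λ j → g j i) k) ≤ conv (absolute a) (norm ∘ g) k
  norm-conv a g zero    = ≤-reflexive (norm-scale (a 0) (g 0))
  norm-conv a g (suc k) = ≤-trans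
    (norm-triangle (λ i → a 0 * g (suc k) i) (λ i → conv (a ∘ suc) (λ j → g j i) k))
    (+-mono-≤ (≤-reflexive (norm-scale (a 0) (g (suc k)))) (norm-conv (a ∘ suc) g k))

  dot-conv : ∀ {n} (a : Sequence) (g : ℕ → Vector Carrier n) w k →
    dot (λ i → conv a (λ j → g j i) k) w ≈ conv a (λ j → dot (g j) w) k
  dot-conv a g w zero    = dot-scale (a 0) (g 0) w
  dot-conv a g w (suc k) = trans
    (dot-+ (λ i → a 0 * g (suc k) i) (λ i → conv (a ∘ suc) (λ j → g j i) k) w)
    (+-cong (dot-scale (a 0) (g (suc k)) w) (dot-conv (a ∘ suc) g w k))

  dot-psum : ∀ {n} (w : Vector Carrier n) (g : ℕ → Vector Carrier n) (c : Sequence) K →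
    dot w (λ j → psum (λ k → g k j * c k) K) ≈ psum (λ k → dot w (g k) * c k) K
  dot-psum w g c K = begin-equality
    sum (λ j → w j * sum (λ k → g (toℕ {K} k) j * c (toℕ k)))
      ≈⟨ sum-cong-≋ (λ j → *-distribˡ-sum (w j) (λ k → g (toℕ {K} k) j * c (toℕ k))) ⟩
    sum (λ j → sum (λ k → w j * (g (toℕ {K} k) j * c (toℕ k))))
      ≈⟨ ∑-comm (λ j k → w j * (g (toℕ {K} k) j * c (toℕ k))) ⟩
    sum (λ k → sum (λ j → w j * (g (toℕ {K} k) j * c (toℕ k))))
      ≈⟨ sum-cong-≋ (λ k → trans (sum-cong-≋ λ j → sym (*-assoc (w j) (g (toℕ k) j) (c (toℕ k))))
           (sym (*-distribʳ-sum (c (toℕ k)) (λ j → w j * g (toℕ {K} k) j)))) ⟩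
    sum (λ k → dot w (g (toℕ {K} k)) * c (toℕ k)) ∎

  lim-apply : ∀ {n} (A : Matrix n) {s : ℕ → Vector Carrier n} {l : Vector Carrier n} →
    (∀ j → ConvergesTo (λ k → s k j) (l j)) → ∀ i → ConvergesTo (λ k → apply A (s k) i) (apply A l i)
  lim-apply A h i = lim-sum λ j → lim-scale (A i j) (h j)

  lim-unsuc : ∀ {s : Sequence} {l} → ConvergesTo (s ∘ suc) l → ConvergesTo s l
  lim-unsuc {s} {l} h ε 0<ε = let N , p = h ε 0<ε in suc N , λ { (suc k) (s≤s N≤k) → p k N≤k }

  -- Perturbed eigenvectors

  infixl 6 _+[_]_
  _+[_]_ : ∀ {n} → Matrix n → Carrier → Matrix n → Matrix n
  (L +[ t ] B) i j = L i j + t * B i j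

  apply-perturbed : ∀ {n} (L B : Matrix n) t v i → apply (L +[ t ] B) v i ≈ apply L v i + t * apply B v i
  apply-perturbed L B t v i = trans (dot-+ (L i) (λ j → t * B i j) v) (+-congˡ (dot-scale t (B i) v))

  -- Split a perturbed eigenvector g = p N⁻¹ f + h with h ⟂ f.  The resolvent gives
  -- h = O(t) g, and pairing the eigenvalue equation with f gives
  -- (ν − μ) p = t ⟨Bf, h⟩.
  module PerturbedEigenvector
    {n} {L B : Matrix n} {μ : Carrier} {f : Vector Carrier n}
    (E : SimpleEigenpair L μ f) (S : ReducedResolvent L μ f) (B-sym : Symmetric B)
    (stationary : dot (apply B f) f ≈ 0#)
    {N⁻¹ : Carrier} (NN⁻¹≈1 : dot f f * N⁻¹ ≈ 1#) (0≤N⁻¹ : 0# ≤ N⁻¹)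
    {t ν : Carrier} {g : Vector Carrier n}
    (eq : ∀ i → apply (L +[ t ] B) g i ≈ ν * g i)
    where

    open SimpleEigenpair E
    module S = ReducedResolvent S

    p a G : Carrier
    p = dot g f
    a = p * N⁻¹
    G = norm g

    h : Vector Carrier n
    h i = g i + - a * f i

    h⊥f : dot h f ≈ 0#
    h⊥f = begin-equality
      dot h f                             ≈⟨ dot-+ g (λ i → - a * f i) f ⟩
      p + dot (λ i → - a * f i) f         ≈⟨ +-congˡ (dot-scale (- a) f f) ⟩
      p + - (p * N⁻¹) * dot f f           ≈⟨ solve 3 (λ p c d → p :+ :- (p :* c) :* d := p :- p :* (d :* c)) refl p N⁻¹ (dot f f) ⟩
      p - p * (dot f f * N⁻¹)             ≈⟨ +-congˡ (-‿cong (trans (*-congˡ NN⁻¹≈1) (*-identityʳ p))) ⟩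
      p - p                               ≈⟨ -‿inverseʳ p ⟩
      0#                                  ∎

    equation : ∀ i → apply L g i + t * apply B g i ≈ ν * g i
    equation i = trans (sym (apply-perturbed L B t g i)) (eq i)

    residual-h : ∀ i → residual E h i ≈ (ν - μ) * g i + - t * apply B g i
    residual-h i = begin-equality
      apply L h i - μ * h i
        ≈⟨ +-congʳ (trans (apply-+ L g (λ i → - a * f i) i) (+-congˡ (trans (apply-scale L (- a) f i) (*-congˡ (eigen i))))) ⟩
      (apply L g i + - a * (μ * f i)) - μ * (g i + - a * f i)
        ≈⟨ solve 7 (λ Lg a m f g t b → (Lg :+ :- a :* (m :* f)) :- m :* (g :+ :- a :* f) := ((Lg :+ t :* b) :- m :* g) :+ :- t :* b) refl
             (apply L g i) a μ (f i) (g i) t (apply B g i) ⟩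
      ((apply L g i + t * apply B g i) - μ * g i) + - t * apply B g i
        ≈⟨ +-congʳ (+-congʳ (equation i)) ⟩
      (ν * g i - μ * g i) + - t * apply B g i
        ≈⟨ +-congʳ (solve 3 (λ n m g → n :* g :- m :* g := (n :- m) :* g) refl ν μ (g i)) ⟩
      (ν - μ) * g i + - t * apply B g i ∎

    -- Since h is orthogonal to f, the resolvent recovers it from its residual (ν - μ)g - tBg, where
    -- both terms carry a factor |t|.
    norm-h : ∀ {C} → ∣ ν - μ ∣ ≤ C * ∣ t ∣ →
             norm h ≤ (operator-bound S.matrix * (C + operator-bound B)) * ∣ t ∣ * G
    norm-h {C} ν-bound = begin
      norm h
        ≈⟨ norm-cong (S.inverseˡ h h⊥f) ⟨
      norm (apply S.matrix (residual E h))
        ≤⟨ norm-apply S.matrix (residual E h) ⟩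
      σ * norm (residual E h)
        ≈⟨ *-congˡ (norm-cong residual-h) ⟩
      σ * norm (λ i → (ν - μ) * g i + - t * apply B g i)
        ≤⟨ *-monoˡ-≤ 0≤σ (norm-triangle (λ i → (ν - μ) * g i) (λ i → - t * apply B g i)) ⟩
      σ * (norm (λ i → (ν - μ) * g i) + norm (λ i → - t * apply B g i))
        ≈⟨ *-congˡ (+-cong (norm-scale (ν - μ) g) (trans (norm-scale (- t) (apply B g)) (*-congʳ (abs-neg t)))) ⟩
      σ * (∣ ν - μ ∣ * G + ∣ t ∣ * norm (apply B g))
        ≤⟨ *-monoˡ-≤ 0≤σ (+-mono-≤ (*-monoʳ-≤ (norm-nonNeg g) ν-bound) (*-monoˡ-≤ (abs-nonNeg t) (norm-apply B g))) ⟩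
      σ * (C * ∣ t ∣ * G + ∣ t ∣ * (β * G))
        ≈⟨ solve 5 (λ s c t G b → s :* (c :* t :* G :+ t :* (b :* G)) := (s :* (c :+ b)) :* t :* G) refl σ C (∣ t ∣) G β ⟩
      (σ * (C + β)) * ∣ t ∣ * G ∎
      where
      σ β : Carrier
      σ = operator-bound S.matrix
      β = operator-bound B
      0≤σ : 0# ≤ σ
      0≤σ = operator-bound-nonNeg S.matrix

    norm-g : G ≤ ∣ p ∣ * (N⁻¹ * norm f) + norm h
    norm-g = begin
      norm g
        ≈⟨ norm-cong (λ i → solve 3 (λ g a f → g := a :* f :+ (g :+ :- a :* f)) refl (g i) a (f i)) ⟩
      norm (λ i → a * f i + h i)
        ≤⟨ norm-triangle (λ i → a * f i) h ⟩
      norm (λ i → a * f i) + norm h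
        ≈⟨ +-congʳ (trans (norm-scale a f) (trans (*-congʳ (trans (abs-* p N⁻¹) (*-congˡ (abs-of-nonNeg 0≤N⁻¹)))) (*-assoc (∣ p ∣) N⁻¹ (norm f)))) ⟩
      ∣ p ∣ * (N⁻¹ * norm f) + norm h ∎

    -- Here `stationary` enters: it deletes the f-component of g from ⟨g, Bf⟩. The remaining h is
    -- itself O(t), which makes the right-hand side quadratic in t.
    pairing : (ν - μ) * p ≈ t * dot h (apply B f)
    pairing = begin-equality
      (ν - μ) * p
        ≈⟨ solve 3 (λ n m p → (n :- m) :* p := n :* p :- m :* p) refl ν μ p ⟩
      ν * p - μ * p
        ≈⟨ +-congʳ (dot-scale ν g f) ⟨
      dot (λ i → ν * g i) f - μ * p
        ≈⟨ +-congʳ (dot-congˡ equation) ⟨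
      dot (λ i → apply L g i + t * apply B g i) f - μ * p
        ≈⟨ +-congʳ (trans (dot-+ (apply L g) (λ i → t * apply B g i) f) (+-cong dot-Lg (dot-scale t (apply B g) f))) ⟩
      (μ * p + t * dot (apply B g) f) - μ * p
        ≈⟨ solve 2 (λ x y → (x :+ y) :- x := y) refl (μ * p) (t * dot (apply B g) f) ⟩
      t * dot (apply B g) f
        ≈⟨ *-congˡ (trans (dot-apply B-sym g f) dot-gBf) ⟩
      t * dot h (apply B f) ∎
      where
      dot-Lg : dot (apply L g) f ≈ μ * p
      dot-Lg = begin-equality
        dot (apply L g) f        ≈⟨ dot-apply symmetric g f ⟩
        dot g (apply L f)        ≈⟨ dot-comm g (apply L f) ⟩
        dot (apply L f) g        ≈⟨ dot-congˡ eigen ⟩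
        dot (λ i → μ * f i) g    ≈⟨ dot-scale μ f g ⟩
        μ * dot f g              ≈⟨ *-congˡ (dot-comm f g) ⟩
        μ * p                    ∎
      dot-gBf : dot g (apply B f) ≈ dot h (apply B f)
      dot-gBf = sym (begin-equality
        dot h (apply B f)                                          ≈⟨ dot-+ g (λ i → - a * f i) (apply B f) ⟩
        dot g (apply B f) + dot (λ i → - a * f i) (apply B f)      ≈⟨ +-congˡ (dot-scale (- a) f (apply B f)) ⟩
        dot g (apply B f) + - a * dot f (apply B f)                ≈⟨ +-congˡ (*-congˡ (trans (dot-comm f (apply B f)) stationary)) ⟩
        dot g (apply B f) + - a * 0#                               ≈⟨ +-congˡ (zeroʳ (- a)) ⟩
        dot g (apply B f) + 0#                                     ≈⟨ +-identityʳ (dot g (apply B f)) ⟩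
        dot g (apply B f)                                          ∎)

    -- For small t the part h is at most half of g in norm, so ‖g‖ ≤ 2c|p| with c = ‖f‖ / ⟨f, f⟩.
    -- Hence p ≠ 0, and the pairing identity may be divided by |p|; the factor ‖g‖ in the bound on h
    -- becomes 2c|p| and cancels.
    quadratic : ∀ {D} → 0# ≤ D → D * ∣ t ∣ + D * ∣ t ∣ ≤ 1# → norm h ≤ D * ∣ t ∣ * G →
      ¬ (∀ i → g i ≈ 0#) →
      ∣ ν - μ ∣ ≤ (norm (apply B f) * D * (N⁻¹ * norm f + N⁻¹ * norm f)) * (∣ t ∣ * ∣ t ∣)
    quadratic {D} 0≤D 2Dt≤1 h≤ g≉0 = *-cancelˡ-≤ 0<∣p∣ (begin
      ∣ p ∣ * ∣ ν - μ ∣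
        ≈⟨ trans (*-comm (∣ p ∣) (∣ ν - μ ∣)) (sym (abs-* (ν - μ) p)) ⟩
      ∣ (ν - μ) * p ∣
        ≈⟨ trans (abs-cong pairing) (abs-* t (dot h (apply B f))) ⟩
      ∣ t ∣ * ∣ dot h (apply B f) ∣
        ≤⟨ *-monoˡ-≤ (abs-nonNeg t) (≤-trans (abs-dot h (apply B f)) (*-monoʳ-≤ (norm-nonNeg (apply B f)) h≤G)) ⟩
      ∣ t ∣ * ((D * ∣ t ∣ * (∣ p ∣ * (c + c))) * b)
        ≈⟨ solve 5 (λ t d p c b → t :* ((d :* t :* (p :* (c :+ c))) :* b) := p :* ((b :* d :* (c :+ c)) :* (t :* t))) refl (∣ t ∣) D (∣ p ∣) c b ⟩
      ∣ p ∣ * ((b * D * (c + c)) * (∣ t ∣ * ∣ t ∣)) ∎)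
      where
      b c : Carrier
      b = norm (apply B f)
      c = N⁻¹ * norm f
      0≤G : 0# ≤ G
      0≤G = norm-nonNeg g
      G≤ : G ≤ ∣ p ∣ * (c + c)
      -- Twice `norm-g`, twice ‖h‖ ≤ D|t|‖g‖, and ‖g‖ times 1 - 2D|t| ≥ 0 add up to 2c|p| - ‖g‖ ≥ 0.
      G≤ = by-diff (+-nonNeg (+-nonNeg (0≤-diff norm-g) (0≤-diff norm-g)) (+-nonNeg (+-nonNeg (0≤-diff h≤) (0≤-diff h≤)) (*-nonNeg 0≤G (0≤-diff 2Dt≤1))))
        (solve 5 (λ G p c H d → p :* (c :+ c) :- G :=
           (((p :* c :+ H) :- G) :+ ((p :* c :+ H) :- G)) :+ (((d :* G :- H) :+ (d :* G :- H)) :+ G :* (con (+ 1) :- (d :+ d)))) refl G (∣ p ∣) c (norm h) (D * ∣ t ∣))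
      h≤G : norm h ≤ D * ∣ t ∣ * (∣ p ∣ * (c + c))
      h≤G = ≤-trans h≤ (*-monoˡ-≤ (*-nonNeg 0≤D (abs-nonNeg t)) G≤)
      0<∣p∣ : 0# < ∣ p ∣
      0<∣p∣ = abs-pos λ p≈0 → <⇒≱ (norm-pos g≉0) (begin
        G                      ≤⟨ G≤ ⟩
        ∣ p ∣ * (c + c)        ≈⟨ *-congʳ (trans (abs-cong p≈0) ∣0∣≈0) ⟩
        0# * (c + c)           ≈⟨ zeroˡ (c + c) ⟩
        0#                     ∎)

  abstract
    -- The constants depend on C but not on t, ν or the eigenvector, so no regularity of
    -- eigenvectors in t is required. The radius η is chosen to make 2Dη < 1, with D here the
    -- constant in ‖h‖ ≤ D|t|‖g‖.
    perturbed-eigenvalue-quadratic :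
      ∀ {n} {L B : Matrix n} {μ : Carrier} {f : Vector Carrier n} →
      SimpleEigenpair L μ f → Symmetric B → dot (apply B f) f ≈ 0# →
      ∀ {C} → 0# ≤ C →
      ∃[ D ] ∃[ η ] (0# ≤ D × 0# < η ×
        (∀ t ν → ∣ t ∣ < η → ∣ ν - μ ∣ ≤ C * ∣ t ∣ → IsEigenvalue (L +[ t ] B) ν →
          ∣ ν - μ ∣ ≤ D * (∣ t ∣ * ∣ t ∣)))
    perturbed-eigenvalue-quadratic {n} {L} {B} {μ} {f} E B-sym stationary {C} 0≤C =
      let N⁻¹ , NN⁻¹≈1 , 0<N⁻¹ = inverse-pos (dot-self-pos (SimpleEigenpair.nonzero E))
          η , 0<η , 2Dη<1 = small-multiple (+-nonNeg 0≤D 0≤D) 0<1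
          0≤c = *-nonNeg (<⇒≤ 0<N⁻¹) (norm-nonNeg f)
      in norm (apply B f) * D * (N⁻¹ * norm f + N⁻¹ * norm f) , η
       , *-nonNeg (*-nonNeg (norm-nonNeg (apply B f)) 0≤D) (+-nonNeg 0≤c 0≤c) , 0<η
       , λ t ν ∣t∣<η ν-bound (g , g≉0 , eq) →
           let open PerturbedEigenvector E S B-sym stationary NN⁻¹≈1 (<⇒≤ 0<N⁻¹) {t} {ν} {g} eq
           in quadratic 0≤D (≤-trans (small (<⇒≤ ∣t∣<η)) (<⇒≤ 2Dη<1)) (norm-h ν-bound) g≉0
      where
      S : ReducedResolvent L μ f
      S = reducedResolvent E
      D : Carrier
      D = operator-bound (ReducedResolvent.matrix S) * (C + operator-bound B)
      0≤D : 0# ≤ D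
      0≤D = *-nonNeg (operator-bound-nonNeg (ReducedResolvent.matrix S)) (+-nonNeg 0≤C (operator-bound-nonNeg B))
      small : ∀ {s η} → s ≤ η → D * s + D * s ≤ (D + D) * η
      small {s} {η} s≤η = ≤-trans (≤-reflexive (sym (distribʳ s D D))) (*-monoˡ-≤ (+-nonNeg 0≤D 0≤D) s≤η)

  -- The Rellich expansion

  -- A convolution refers to all earlier values, so the recursion carries them along as a function.
  -- `history k` is meaningful up to index k and merely repeats its last value beyond.
  module CourseOfValues {A : Set} (start : A) (step : (ℕ → A) → ℕ → A) where

    history : ℕ → ℕ → A
    history zero    _ = start
    history (suc k) j with j ℕ.≤? k
    ... | yes _ = history k j
    ... | no _  = step (history k) k

    value-at : ℕ → A
    value-at k = history k k

    history-stable : ∀ {j k} → j ℕ.≤ k → history k j ≡ value-at j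
    history-stable j≤k = go (ℕ.≤⇒≤′ j≤k)
      where
      go : ∀ {j k} → j ℕ.≤′ k → history k j ≡ value-at j
      go (ℕ.≤′-reflexive ≡.refl) = ≡.refl
      go {j} {suc k} (ℕ.≤′-step j≤′k) with j ℕ.≤? k
      ... | yes _   = go j≤′k
      ... | no j≰k  = contradiction (ℕ.≤′⇒≤ j≤′k) j≰k

    value-at-suc : ∀ k → value-at (suc k) ≡ step (history k) k
    value-at-suc k with suc k ℕ.≤? k
    ... | yes 1+k≤k = contradiction 1+k≤k ℕ.1+n≰n
    ... | no _      = ≡.refl

  -- An `AnalyticBranch` has a value at every t, compatible with `_≈_`. Excluded middle selects the
  -- limit where the series converges and 0 elsewhere; uniqueness of limits makes the selection
  -- compatible.
  analyticBranch : ∀ {n} {A : Carrier → Matrix n} {μ r} (coefficient : Sequence) → 0# < r → coefficient 0 ≈ μ →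
    (∀ t → ∣ t ∣ < r → ∃[ l ] (ConvergesTo (powerSeriesPartialSum coefficient t) l × IsEigenvalue (A t) l)) →
    ∃ λ (b : AnalyticBranch A μ) → ∀ k → AnalyticBranch.coefficient b k ≡ coefficient k
  analyticBranch {A = A} {μ} {r} coefficient 0<r c₀≈μ branch = record
    { value        = value
    ; value-cong   = value-cong
    ; value-0      = trans (value-of series-0) c₀≈μ
    ; radius       = r
    ; radius>0     = 0<r
    ; isEigenvalue = λ t ∣t∣<r → let l , conv , g , g≉0 , eq = branch t ∣t∣<r
                                 in g , g≉0 , λ i → trans (eq i) (*-congʳ (sym (value-of conv)))
    ; coefficient  = coefficient
    ; analytic     = λ t ∣t∣<r → let l , conv , _ = branch t ∣t∣<r in lim-cong (λ _ → refl) (sym (value-of conv)) conv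
    } , λ _ → ≡.refl
    where
    Sum : Carrier → Set
    Sum t = ∃[ l ] ConvergesTo (powerSeriesPartialSum coefficient t) l
    choose : ∀ {t} → Dec (Sum t) → Carrier
    choose (yes (l , _)) = l
    choose (no _)        = 0#
    value : Carrier → Carrier
    value t = choose (em {Sum t})
    value-of : ∀ {t l} → ConvergesTo (powerSeriesPartialSum coefficient t) l → value t ≈ l
    value-of {t} {l} conv with em {Sum t}
    ... | yes (l′ , conv′) = lim-unique conv′ conv
    ... | no ∄             = contradiction (l , conv) ∄
    transport : ∀ {t t′ l} → t ≈ t′ → ConvergesTo (powerSeriesPartialSum coefficient t) l →
                ConvergesTo (powerSeriesPartialSum coefficient t′) l
    transport {t} {t′} t≈t′ = lim-cong
      (psum-cong {coefficient scaledBy t} {coefficient scaledBy t′} (λ i → *-congˡ (^-congˡ i t≈t′))) refl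
    value-cong : ∀ {t t′} → t ≈ t′ → value t ≈ value t′
    value-cong {t} {t′} t≈t′ with em {Sum t} | em {Sum t′}
    ... | yes (l , conv) | yes (l′ , conv′) = lim-unique (transport t≈t′ conv) conv′
    ... | yes (l , conv) | no ∄             = contradiction (l , transport t≈t′ conv) ∄
    ... | no ∄           | yes (l , conv)   = contradiction (l , transport (sym t≈t′) conv) ∄
    ... | no _           | no _             = refl
    series-0 : ConvergesTo (powerSeriesPartialSum coefficient 0#) (coefficient 0)
    series-0 = lim-unsuc (lim-cong (λ k → sym (partial k)) refl (lim-const (coefficient 0)))
      where
      rest : Sequence
      rest i = coefficient (suc i) * (0# * 0# ^ i)
      partial : ∀ k → powerSeriesPartialSum coefficient 0# (suc k) ≈ coefficient 0
      partial k = begin-equality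
        coefficient 0 * 1# + psum rest k
          ≈⟨ +-cong (*-identityʳ (coefficient 0)) (sum-0 {k} {λ i → rest (toℕ i)} λ i →
               trans (*-congˡ (zeroˡ (0# ^ toℕ i))) (zeroʳ (coefficient (suc (toℕ i))))) ⟩
        coefficient 0 + 0#
          ≈⟨ +-identityʳ (coefficient 0) ⟩
        coefficient 0 ∎

  -- The eigenvector ∑ gₖ tᵏ and eigenvalue μ + t ∑ φ(gₖ) tᵏ of L + tB, where
  -- φ(v) = ⟨v, Bf⟩ / ⟨f, f⟩.  Comparing coefficients of tᵏ⁺¹ gives
  -- (L − μ) gₖ₊₁ = ∑ᵢ φ(gᵢ) gₖ₋ᵢ − B gₖ.
  module Expansion
    {n} {L B : Matrix n} {μ : Carrier} {f : Vector Carrier n}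
    (E : SimpleEigenpair L μ f) (S : ReducedResolvent L μ f) (B-sym : Symmetric B)
    {N⁻¹ : Carrier} (NN⁻¹≈1 : dot f f * N⁻¹ ≈ 1#)
    where

    open SimpleEigenpair E
    module S = ReducedResolvent S

    φ : Vector Carrier n → Carrier
    φ v = dot v (apply B f) * N⁻¹

    rhs : (ℕ → Vector Carrier n) → ℕ → Vector Carrier n
    rhs h k i = conv (φ ∘ h) (λ j → h j i) k + - 1# * apply B (h k) i

    open CourseOfValues f (λ h k → apply S.matrix (rhs h k))

    g : ℕ → Vector Carrier n
    g = value-at

    φg : Sequence
    φg k = φ (g k)

    component : Fin n → Sequence
    component i k = g k i

    rhs-history : ∀ k i → rhs (history k) k i ≈ rhs g k i
    rhs-history k i = +-congʳ (conv-cong {φ ∘ history k} {φg} {λ j → history k j i} {component i} k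
      (λ j j≤k → reflexive (≡.cong φ (history-stable j≤k)))
      (λ j j≤k → reflexive (≡.cong (λ v → v i) (history-stable j≤k))))

    g-suc : ∀ k → g (suc k) ≋ apply S.matrix (rhs g k)
    g-suc k i = trans (reflexive (≡.cong (λ v → v i) (value-at-suc k))) (apply-cong S.matrix (rhs-history k) i)

    -- This condition dictates φ. Since g₁, ..., gₖ are orthogonal to f, pairing the convolution
    -- with f leaves φ(gₖ)⟨f, f⟩, which has to equal ⟨Bgₖ, f⟩ = ⟨gₖ, Bf⟩.
    rhs⊥f : ∀ k → (∀ j → suc j ℕ.≤ k → dot (g (suc j)) f ≈ 0#) → dot (rhs g k) f ≈ 0#
    rhs⊥f k g⊥f = begin-equality
      dot (rhs g k) f
        ≈⟨ dot-+ (λ i → conv φg (component i) k) (λ i → - 1# * apply B (g k) i) f ⟩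
      dot (λ i → conv φg (component i) k) f + dot (λ i → - 1# * apply B (g k) i) f
        ≈⟨ +-cong (dot-conv φg g f k) (dot-scale (- 1#) (apply B (g k)) f) ⟩
      conv φg (λ j → dot (g j) f) k + - 1# * dot (apply B (g k)) f
        ≈⟨ +-cong (conv-head φg (λ j → dot (g j) f) k g⊥f) (*-congˡ (dot-apply B-sym (g k) f)) ⟩
      (d * N⁻¹) * dot f f + - 1# * d
        ≈⟨ solve 3 (λ d c N → (d :* c) :* N :+ :- con (+ 1) :* d := d :* (N :* c) :- d) refl d N⁻¹ (dot f f) ⟩
      d * (dot f f * N⁻¹) - d
        ≈⟨ +-congʳ (trans (*-congˡ NN⁻¹≈1) (*-identityʳ d)) ⟩
      d - d
        ≈⟨ -‿inverseʳ d ⟩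
      0# ∎
      where
      d : Carrier
      d = dot (g k) (apply B f)

    -- Strong induction in bounded form: by `rhs⊥f`, the orthogonality of each coefficient rests on
    -- that of all earlier ones.
    g⊥f-up-to : ∀ k j → suc j ℕ.≤ k → dot (g (suc j)) f ≈ 0#
    g⊥f-up-to (suc k) j (s≤s j≤k) with ℕ.m≤n⇒m<n∨m≡n j≤k
    ... | inj₁ j<k    = g⊥f-up-to k j j<k
    ... | inj₂ ≡.refl = trans (dot-congˡ (g-suc j)) (S.orthogonal (rhs g j) (rhs⊥f j (g⊥f-up-to j)))

    g⊥f : ∀ k → dot (g (suc k)) f ≈ 0#
    g⊥f k = g⊥f-up-to (suc k) k ℕ.≤-refl

    residual-g : ∀ k i → residual E (g (suc k)) i ≈ rhs g k i
    residual-g k i = trans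
      (+-cong (apply-cong L (g-suc k) i) (-‿cong (*-congˡ (g-suc k i))))
      (S.inverseʳ (rhs g k) (rhs⊥f k λ j _ → g⊥f j) i)

    -- aₖ = ‖gₖ‖ satisfies aₖ₊₁ ≤ σ (κ ∑ᵢ aᵢ aₖ₋ᵢ + β aₖ), and
    -- for small B the bound ∑_{k<K} aₖ ≤ 2 a₀ is preserved from K to K + 1.
    module Bounds {κ β : Carrier} (0≤κ : 0# ≤ κ) (0≤β : 0# ≤ β)
      (φ-bound : ∀ v → ∣ φ v ∣ ≤ κ * norm v) (B-bound : ∀ v → norm (apply B v) ≤ β * norm v)
      (B-small : operator-bound S.matrix * (κ * ((norm f + norm f) * (norm f + norm f)) + β * (norm f + norm f)) ≤ norm f)
      where

      σ F 2F : Carrier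
      σ = operator-bound S.matrix
      F = norm f
      2F = F + F

      0≤σ : 0# ≤ σ
      0≤σ = operator-bound-nonNeg S.matrix

      a : Sequence
      a k = norm (g k)

      0≤a : ∀ k → 0# ≤ a k
      0≤a k = norm-nonNeg (g k)

      recursive-bound : ∀ k → a (suc k) ≤ σ * (κ * conv a a k + β * a k)
      recursive-bound k = begin
        norm (g (suc k))
          ≈⟨ norm-cong (g-suc k) ⟩
        norm (apply S.matrix (rhs g k))
          ≤⟨ norm-apply S.matrix (rhs g k) ⟩
        σ * norm (rhs g k)
          ≤⟨ *-monoˡ-≤ 0≤σ (norm-triangle (λ i → conv φg (component i) k) (λ i → - 1# * apply B (g k) i)) ⟩
        σ * (norm (λ i → conv φg (component i) k) + norm (λ i → - 1# * apply B (g k) i))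
          ≤⟨ *-monoˡ-≤ 0≤σ (+-mono-≤ conv-bound (≤-trans (≤-reflexive norm-neg) (B-bound (g k)))) ⟩
        σ * (κ * conv a a k + β * a k) ∎
        where
        conv-bound : norm (λ i → conv φg (component i) k) ≤ κ * conv a a k
        conv-bound = begin
          norm (λ i → conv φg (component i) k)   ≤⟨ norm-conv φg g k ⟩
          conv (absolute φg) a k                 ≤⟨ conv-mono-≤ {absolute φg} {λ i → κ * a i} {a} {a} (λ i → *-nonNeg 0≤κ (0≤a i)) 0≤a
                                                      (λ i → φ-bound (g i)) (λ i → ≤-refl) k ⟩
          conv (λ i → κ * a i) a k               ≈⟨ conv-scaleˡ κ a a k ⟩
          κ * conv a a k                         ∎
        norm-neg : norm (λ i → - 1# * apply B (g k) i) ≈ norm (apply B (g k))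
        norm-neg = trans (norm-scale (- 1#) (apply B (g k)))
          (trans (*-congʳ (trans (abs-neg 1#) (abs-of-nonNeg 0≤1))) (*-identityˡ (norm (apply B (g k)))))

      -- The leading term is `norm f`. In the rest, `psum-conv-≤` turns the convolution into the
      -- square of the same partial sum, so the induction hypothesis applies and `B-small` is
      -- exactly what closes the step. No estimate of the individual norms is required.
      sum-bound : ∀ K → psum a K ≤ 2F
      sum-bound zero    = +-nonNeg (norm-nonNeg f) (norm-nonNeg f)
      sum-bound (suc K) = +-mono-≤ ≤-refl (begin
        psum (a ∘ suc) K
          ≤⟨ psum-mono-≤ {a ∘ suc} {λ k → σ * (κ * conv a a k + β * a k)} recursive-bound K ⟩
        psum (λ k → σ * (κ * conv a a k + β * a k)) K
          ≈⟨ psum-scale σ (λ k → κ * conv a a k + β * a k) K ⟩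
        σ * psum (λ k → κ * conv a a k + β * a k) K
          ≈⟨ *-congˡ (trans (psum-+ (λ k → κ * conv a a k) (λ k → β * a k) K) (+-cong (psum-scale κ (conv a a) K) (psum-scale β a K))) ⟩
        σ * (κ * psum (conv a a) K + β * psum a K)
          ≤⟨ *-monoˡ-≤ 0≤σ (+-mono-≤
               (*-monoˡ-≤ 0≤κ (≤-trans (psum-conv-≤ a a 0≤a 0≤a K)
                 (*-mono-≤ (≤-trans (psum-nonNeg {a} 0≤a K) (sum-bound K)) (psum-nonNeg {a} 0≤a K) (sum-bound K) (sum-bound K))))
               (*-monoˡ-≤ 0≤β (sum-bound K))) ⟩
        σ * (κ * (2F * 2F) + β * 2F)
          ≤⟨ B-small ⟩
        F ∎)

      φg-sum-bound : ∀ K → psum (absolute φg) K ≤ κ * 2F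
      φg-sum-bound K = begin
        psum (absolute φg) K     ≤⟨ psum-mono-≤ {absolute φg} {λ k → κ * a k} (λ k → φ-bound (g k)) K ⟩
        psum (λ k → κ * a k) K   ≈⟨ psum-scale κ a K ⟩
        κ * psum a K             ≤⟨ *-monoˡ-≤ 0≤κ (sum-bound K) ⟩
        κ * 2F                   ∎

      component-sum-bound : ∀ i K → psum (absolute (component i)) K ≤ 2F
      component-sum-bound i K = ≤-trans
        (psum-mono-≤ {absolute (component i)} {a} (λ k → component≤norm (g k) i) K) (sum-bound K)

      module At (t : Carrier) (2∣t∣≤1 : ∣ t ∣ + ∣ t ∣ ≤ 1#) where

        ∣t∣≤1 : ∣ t ∣ ≤ 1#
        ∣t∣≤1 = ≤-trans (x≤x+y (abs-nonNeg t)) 2∣t∣≤1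

        sum-scaledBy : ∀ (s : Sequence) {C} → (∀ K → psum (absolute s) K ≤ C) → ∃[ l ] ConvergesTo (psum (s scaledBy t)) l
        sum-scaledBy s bnd = absolutely-convergent {s scaledBy t} λ K → ≤-trans (abs-psum-scaledBy s ∣t∣≤1 K) (bnd K)

        w : Carrier
        w = proj₁ (sum-scaledBy φg φg-sum-bound)

        w-limit : ConvergesTo (psum (φg scaledBy t)) w
        w-limit = proj₂ (sum-scaledBy φg φg-sum-bound)

        u : Vector Carrier n
        u i = proj₁ (sum-scaledBy (component i) (component-sum-bound i))

        U : ℕ → Vector Carrier n
        U K i = psum (component i scaledBy t) K

        u-limit : ∀ i → ConvergesTo (λ K → U K i) (u i)
        u-limit i = proj₂ (sum-scaledBy (component i) (component-sum-bound i))

        product : Fin n → Sequence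
        product i = conv (φg scaledBy t) (component i scaledBy t)

        product-limit : ∀ i → ConvergesTo (psum (product i)) (w * u i)
        product-limit i = cauchy-product φg (component i) 2∣t∣≤1 φg-sum-bound (component-sum-bound i) w-limit (u-limit i)

        residual-psum : ∀ K i → residual E (U K) i ≈ psum (λ k → residual E (g k) i * t ^ k) K
        residual-psum K i = begin-equality
          apply L (U K) i - μ * U K i
            ≈⟨ +-cong (dot-psum (L i) g (t ^_) K) (-‿distribˡ-* μ (U K i)) ⟩
          psum (λ k → apply L (g k) i * t ^ k) K + - μ * U K i
            ≈⟨ +-congˡ (psum-scale (- μ) (component i scaledBy t) K) ⟨
          psum (λ k → apply L (g k) i * t ^ k) K + psum (λ k → - μ * (g k i * t ^ k)) K
            ≈⟨ psum-+ (λ k → apply L (g k) i * t ^ k) (λ k → - μ * (g k i * t ^ k)) K ⟨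
          psum (λ k → apply L (g k) i * t ^ k + - μ * (g k i * t ^ k)) K
            ≈⟨ psum-cong {λ k → apply L (g k) i * t ^ k + - μ * (g k i * t ^ k)} {λ k → residual E (g k) i * t ^ k}
                 (λ k → solve 4 (λ l m g x → l :* x :+ :- m :* (g :* x) := (l :- m :* g) :* x) refl (apply L (g k) i) μ (g k i) (t ^ k)) K ⟩
          psum (λ k → residual E (g k) i * t ^ k) K ∎

        -- An exact identity between truncations one index apart: the term k = 0 vanishes because f
        -- is an eigenvector, and the recursion for gₖ₊₁ brings out a factor t. Passing to the limit
        -- then yields the eigenvalue equation.
        residual-U : ∀ K i → residual E (U (suc K)) i ≈ t * (psum (product i) K + - 1# * apply B (U K) i)
        residual-U K i = begin-equality
          residual E (U (suc K)) i
            ≈⟨ residual-psum (suc K) i ⟩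
          residual E f i * 1# + psum (λ k → residual E (g (suc k)) i * (t * t ^ k)) K
            ≈⟨ +-cong (trans (*-congʳ residual-f) (zeroˡ 1#))
                 (psum-cong {λ k → residual E (g (suc k)) i * (t * t ^ k)} {λ k → t * (product i k + - 1# * (apply B (g k) i * t ^ k))} term K) ⟩
          0# + psum (λ k → t * (product i k + - 1# * (apply B (g k) i * t ^ k))) K
            ≈⟨ trans (+-identityˡ (psum (λ k → t * (product i k + - 1# * (apply B (g k) i * t ^ k))) K))
                 (psum-scale t (λ k → product i k + - 1# * (apply B (g k) i * t ^ k)) K) ⟩
          t * psum (λ k → product i k + - 1# * (apply B (g k) i * t ^ k)) K
            ≈⟨ *-congˡ (trans (psum-+ (product i) (λ k → - 1# * (apply B (g k) i * t ^ k)) K)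
                 (+-congˡ (psum-scale (- 1#) (λ k → apply B (g k) i * t ^ k) K))) ⟩
          t * (psum (product i) K + - 1# * psum (λ k → apply B (g k) i * t ^ k) K)
            ≈⟨ *-congˡ (+-congˡ (*-congˡ (dot-psum (B i) g (t ^_) K))) ⟨
          t * (psum (product i) K + - 1# * apply B (U K) i) ∎
          where
          residual-f : residual E f i ≈ 0#
          residual-f = trans (+-congʳ (eigen i)) (-‿inverseʳ (μ * f i))
          term : ∀ k → residual E (g (suc k)) i * (t * t ^ k) ≈ t * (product i k + - 1# * (apply B (g k) i * t ^ k))
          term k = begin-equality
            residual E (g (suc k)) i * (t * t ^ k)
              ≈⟨ *-congʳ (residual-g k i) ⟩
            (conv φg (component i) k + - 1# * apply B (g k) i) * (t * t ^ k)
              ≈⟨ solve 4 (λ c b t x → (c :+ :- con (+ 1) :* b) :* (t :* x) := t :* (c :* x :+ :- con (+ 1) :* (b :* x))) refl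
                   (conv φg (component i) k) (apply B (g k) i) t (t ^ k) ⟩
            t * (conv φg (component i) k * t ^ k + - 1# * (apply B (g k) i * t ^ k))
              ≈⟨ *-congˡ (+-congʳ (conv-scaledBy φg (component i) t k)) ⟨
            t * (product i k + - 1# * (apply B (g k) i * t ^ k)) ∎

        residual-u : ∀ i → residual E u i ≈ t * (w * u i + - 1# * apply B u i)
        residual-u i = lim-unique
          (lim-suc (lim-+ (lim-apply L u-limit i) (lim-neg (lim-scale μ (u-limit i)))))
          (lim-cong (λ K → sym (residual-U K i)) refl
            (lim-scale t (lim-+ (product-limit i) (lim-scale (- 1#) (lim-apply B u-limit i)))))

        eigenvector : ∀ i → apply (L +[ t ] B) u i ≈ (μ + t * w) * u i
        eigenvector i = begin-equality
          apply (L +[ t ] B) u i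
            ≈⟨ apply-perturbed L B t u i ⟩
          apply L u i + t * apply B u i
            ≈⟨ solve 4 (λ l m u b → l :+ b := (l :- m :* u) :+ (m :* u :+ b)) refl (apply L u i) μ (u i) (t * apply B u i) ⟩
          residual E u i + (μ * u i + t * apply B u i)
            ≈⟨ +-congʳ (residual-u i) ⟩
          t * (w * u i + - 1# * apply B u i) + (μ * u i + t * apply B u i)
            ≈⟨ solve 5 (λ t w u b m → t :* (w :* u :+ :- con (+ 1) :* b) :+ (m :* u :+ t :* b) := (m :+ t :* w) :* u) refl t w (u i) (apply B u i) μ ⟩
          (μ + t * w) * u i ∎

        -- All corrections are orthogonal to f, so this pairing is constant along the nonempty
        -- partial sums and survives in the limit. It prevents the limit u from being zero.
        dot-U : ∀ K → dot (U (suc K)) f ≈ dot f f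
        dot-U K = begin-equality
          dot (U (suc K)) f
            ≈⟨ dot-comm (U (suc K)) f ⟩
          dot f (U (suc K))
            ≈⟨ dot-psum f g (t ^_) (suc K) ⟩
          dot f f * 1# + psum (λ k → dot f (g (suc k)) * (t * t ^ k)) K
            ≈⟨ +-cong (*-identityʳ (dot f f)) (sum-0 {K} {λ k → dot f (g (suc (toℕ k))) * (t * t ^ toℕ k)} λ k →
                 trans (*-congʳ (trans (dot-comm f (g (suc (toℕ k)))) (g⊥f (toℕ k)))) (zeroˡ (t * t ^ toℕ k))) ⟩
          dot f f + 0#
            ≈⟨ +-identityʳ (dot f f) ⟩
          dot f f ∎

        u≉0 : ¬ (∀ i → u i ≈ 0#)
        u≉0 u≈0 = pos⇒≉0 (dot-self-pos nonzero) (begin-equality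
          dot f f   ≈⟨ lim-unique (lim-const (dot f f)) (lim-cong dot-U refl (lim-suc dot-U-limit)) ⟩
          dot u f   ≈⟨ sum-0 {f = λ i → u i * f i} (λ i → trans (*-congʳ (u≈0 i)) (zeroˡ (f i))) ⟩
          0#        ∎)
          where
          dot-U-limit : ConvergesTo (λ K → dot (U K) f) (dot u f)
          dot-U-limit = lim-sum λ i → lim-* (u-limit i) (lim-const (f i))

      coefficient : Sequence
      coefficient zero    = μ
      coefficient (suc k) = φg k

      coefficient-series : ∀ t {w} → ConvergesTo (psum (φg scaledBy t)) w →
                           ConvergesTo (powerSeriesPartialSum coefficient t) (μ + t * w)
      coefficient-series t w-limit = lim-unsuc (lim-cong (λ K → sym (partial K)) refl
        (lim-+ (lim-const μ) (lim-scale t w-limit)))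
        where
        partial : ∀ K → powerSeriesPartialSum coefficient t (suc K) ≈ μ + t * psum (φg scaledBy t) K
        partial K = +-cong (*-identityʳ μ) (trans
          (psum-cong {λ k → φg k * (t * t ^ k)} {λ k → t * (φg scaledBy t) k}
            (λ k → solve 3 (λ p t x → p :* (t :* x) := t :* (p :* x)) refl (φg k) t (t ^ k)) K)
          (psum-scale t (φg scaledBy t) K))

      branch-near-0 : ∀ t → ∣ t ∣ + ∣ t ∣ ≤ 1# →
        ∃[ l ] (ConvergesTo (powerSeriesPartialSum coefficient t) l × IsEigenvalue (L +[ t ] B) l)
      branch-near-0 t 2∣t∣≤1 = μ + t * w , coefficient-series t w-limit , u , u≉0 , eigenvector
        where open At t 2∣t∣≤1

      branch : ∃ λ (b : AnalyticBranch (L +[_] B) μ) → AnalyticBranch.coefficient b 1 ≈ φ f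
      branch =
        let r , 0<r , 2r<1 = small-multiple (+-nonNeg 0≤1 0≤1) 0<1
            b , coefficient≡ = analyticBranch {A = L +[_] B} coefficient 0<r refl λ t ∣t∣<r →
              branch-near-0 t (≤-trans (double (<⇒≤ ∣t∣<r)) (<⇒≤ 2r<1))
        in b , reflexive (coefficient≡ 1)
        where
        double : ∀ {s r} → s ≤ r → s + s ≤ (1# + 1#) * r
        double {s} {r} s≤r = ≤-trans (+-mono-≤ s≤r s≤r) (≤-reflexive (solve 1 (λ r → r :+ r := (con (+ 1) :+ con (+ 1)) :* r) refl r))

  scale : ∀ {n} → Carrier → Matrix n → Matrix n
  scale ε B i j = ε * B i j

  abstract
    -- The bounds κ and β are linear in B, so for εB the requirement `B-small` reads Q κ · ε ≤ ‖f‖.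
    -- The conclusion is homogeneous in B, hence insensitive to the factor ε.
    branch-in-small-direction : ∀ {n} {L B : Matrix n} {μ : Carrier} {f : Vector Carrier n} →
      SimpleEigenpair L μ f → Symmetric B →
      ∃[ ε ] (0# < ε × ∃ λ (b : AnalyticBranch (L +[_] scale ε B) μ) →
        (AnalyticBranch.coefficient b 1 ≈ 0# → dot (apply B f) f ≈ 0#))
    branch-in-small-direction {n} {L} {B} {μ} {f} E B-sym =
      let N⁻¹ , NN⁻¹≈1 , 0<N⁻¹ = inverse-pos (dot-self-pos (SimpleEigenpair.nonzero E))
          -- Here κ = ‖Bf‖ / ⟨f, f⟩, from |⟨v, Bf⟩| ≤ ‖v‖ ‖Bf‖.
          0≤κ = *-nonNeg (norm-nonNeg (apply B f)) (<⇒≤ 0<N⁻¹)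
          ε , 0<ε , small = small-multiple (0≤Q 0≤κ) (norm-pos (SimpleEigenpair.nonzero E))
          open Expansion E S (scale-symmetric ε) NN⁻¹≈1
          open Bounds {ε * (norm (apply B f) * N⁻¹)} {ε * β} (*-nonNeg (<⇒≤ 0<ε) 0≤κ) (*-nonNeg (<⇒≤ 0<ε) (operator-bound-nonNeg B))
                 (φ-bound (<⇒≤ 0<ε) (<⇒≤ 0<N⁻¹)) (B-bound (<⇒≤ 0<ε)) (≤-trans (≤-reflexive (rearrange ε (norm (apply B f) * N⁻¹))) (<⇒≤ small))
          b , c₁≈ = branch
      in ε , 0<ε , b , λ c₁≈0 → stationary 0<ε 0<N⁻¹ (trans (sym c₁≈) c₁≈0)
      where
      S : ReducedResolvent L μ f
      S = reducedResolvent E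
      σ β 2F : Carrier
      σ = operator-bound (ReducedResolvent.matrix S)
      β = operator-bound B
      2F = norm f + norm f
      Q : Carrier → Carrier
      Q κ = σ * (κ * (2F * 2F) + β * 2F)
      0≤2F : 0# ≤ 2F
      0≤2F = +-nonNeg (norm-nonNeg f) (norm-nonNeg f)
      0≤Q : ∀ {κ} → 0# ≤ κ → 0# ≤ Q κ
      0≤Q 0≤κ = *-nonNeg (operator-bound-nonNeg (ReducedResolvent.matrix S))
        (+-nonNeg (*-nonNeg 0≤κ (*-nonNeg 0≤2F 0≤2F)) (*-nonNeg (operator-bound-nonNeg B) 0≤2F))
      rearrange : ∀ ε κ → σ * ((ε * κ) * (2F * 2F) + (ε * β) * 2F) ≈ Q κ * ε
      rearrange ε κ = solve 5 (λ s e k b F → s :* ((e :* k) :* (F :* F) :+ (e :* b) :* F) := s :* (k :* (F :* F) :+ b :* F) :* e) refl σ ε κ β 2F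
      scale-symmetric : ∀ ε → Symmetric (scale ε B)
      scale-symmetric ε i j = *-congˡ (B-sym i j)
      apply-scaled : ∀ ε v → apply (scale ε B) v ≋ λ i → ε * apply B v i
      apply-scaled ε v i = dot-scale ε (B i) v
      dot-scaled : ∀ ε v → dot v (apply (scale ε B) f) ≈ ε * dot (apply B f) v
      dot-scaled ε v = trans (dot-comm v (apply (scale ε B) f))
        (trans (dot-congˡ (apply-scaled ε f)) (dot-scale ε (apply B f) v))
      φ-bound : ∀ {ε N⁻¹} → 0# ≤ ε → 0# ≤ N⁻¹ → ∀ v →
        ∣ dot v (apply (scale ε B) f) * N⁻¹ ∣ ≤ ε * (norm (apply B f) * N⁻¹) * norm v
      φ-bound {ε} {N⁻¹} 0≤ε 0≤N⁻¹ v = begin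
        ∣ dot v (apply (scale ε B) f) * N⁻¹ ∣
          ≈⟨ abs-cong (trans (*-congʳ (dot-scaled ε v)) (solve 3 (λ e d c → (e :* d) :* c := (e :* c) :* d) refl ε (dot (apply B f) v) N⁻¹)) ⟩
        ∣ (ε * N⁻¹) * dot (apply B f) v ∣
          ≈⟨ trans (abs-* (ε * N⁻¹) (dot (apply B f) v)) (*-congʳ (abs-of-nonNeg (*-nonNeg 0≤ε 0≤N⁻¹))) ⟩
        (ε * N⁻¹) * ∣ dot (apply B f) v ∣
          ≤⟨ *-monoˡ-≤ (*-nonNeg 0≤ε 0≤N⁻¹) (abs-dot (apply B f) v) ⟩
        (ε * N⁻¹) * (norm (apply B f) * norm v)
          ≈⟨ solve 4 (λ e c b v → (e :* c) :* (b :* v) := e :* (b :* c) :* v) refl ε N⁻¹ (norm (apply B f)) (norm v) ⟩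
        ε * (norm (apply B f) * N⁻¹) * norm v ∎
      B-bound : ∀ {ε} → 0# ≤ ε → ∀ v → norm (apply (scale ε B) v) ≤ ε * β * norm v
      B-bound {ε} 0≤ε v = begin
        norm (apply (scale ε B) v)       ≈⟨ norm-cong (apply-scaled ε v) ⟩
        norm (λ i → ε * apply B v i)     ≈⟨ trans (norm-scale ε (apply B v)) (*-congʳ (abs-of-nonNeg 0≤ε)) ⟩
        ε * norm (apply B v)             ≤⟨ *-monoˡ-≤ 0≤ε (norm-apply B v) ⟩
        ε * (β * norm v)                 ≈⟨ *-assoc ε β (norm v) ⟨
        ε * β * norm v                   ∎
      stationary : ∀ {ε N⁻¹} → 0# < ε → 0# < N⁻¹ → dot f (apply (scale ε B) f) * N⁻¹ ≈ 0# → dot (apply B f) f ≈ 0#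
      stationary {ε} {N⁻¹} 0<ε 0<N⁻¹ eq = *-cancelˡ-0 (pos⇒≉0 0<ε) (trans (sym (dot-scaled ε f))
        (*-cancelˡ-0 (pos⇒≉0 0<N⁻¹) (trans (*-comm N⁻¹ (dot f (apply (scale ε B) f))) eq)))

  -- The derivative of a branch and its linear coefficient

  branch-cong : ∀ {n} {A A′ : Carrier → Matrix n} {μ} → (∀ t i j → A t i j ≈ A′ t i j) →
    (b : AnalyticBranch A μ) → ∃ λ (b′ : AnalyticBranch A′ μ) →
    AnalyticBranch.coefficient b′ 1 ≡ AnalyticBranch.coefficient b 1
  branch-cong A≈A′ b = record
    { value        = value
    ; value-cong   = value-cong
    ; value-0      = value-0
    ; radius       = radius
    ; radius>0     = radius>0
    ; isEigenvalue = λ t ∣t∣<r → let g , g≉0 , eq = isEigenvalue t ∣t∣<r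
                                 in g , g≉0 , λ i → trans (sum-cong-≋ λ j → *-congʳ (sym (A≈A′ t i j))) (eq i)
    ; coefficient  = coefficient
    ; analytic     = analytic
    } , ≡.refl
    where open AnalyticBranch b

  module _ {n} {A : Carrier → Matrix n} {μ : Carrier} (b : AnalyticBranch A μ) where
    open AnalyticBranch b

    private
      Taylor : Carrier → Carrier → Set
      Taylor C δ = ∀ t → ∣ t ∣ < δ → ∣ value t - (coefficient 0 + coefficient 1 * t) ∣ ≤ C * (∣ t ∣ * ∣ t ∣)

      coefficient-0 : ∀ {C δ} → 0# < δ → Taylor C δ → coefficient 0 ≈ μ
      coefficient-0 {C} 0<δ taylor = begin-equality
        a₀                                              ≈⟨ solve 3 (λ a b v → a := v :- (v :- (a :+ b :* con (+ 0)))) refl a₀ a₁ (value 0#) ⟩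
        value 0# - (value 0# - (a₀ + a₁ * 0#))          ≈⟨ +-congˡ (-‿cong (∣x∣≤0⇒x≈0 (≤-trans (taylor 0# (≤-<-trans (≤-reflexive ∣0∣≈0) 0<δ))
                                                             (≤-reflexive (trans (*-congˡ (trans (*-congʳ ∣0∣≈0) (zeroˡ (∣ 0# ∣)))) (zeroʳ C)))))) ⟩
        value 0# - 0#                                   ≈⟨ solve 1 (λ v → v :- con (+ 0) := v) refl (value 0#) ⟩
        value 0#                                        ≈⟨ value-0 ⟩
        μ                                               ∎
        where
        a₀ a₁ : Carrier
        a₀ = coefficient 0
        a₁ = coefficient 1

      lipschitz : ∀ {C δ} → 0# ≤ C → 0# < δ → Taylor C δ →
                  ∀ t → ∣ t ∣ < δ → ∣ value t - μ ∣ ≤ (∣ coefficient 1 ∣ + C * δ) * ∣ t ∣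
      lipschitz {C} {δ} 0≤C 0<δ taylor t ∣t∣<δ = begin
        ∣ value t - μ ∣
          ≈⟨ abs-cong (+-congˡ (-‿cong (sym (coefficient-0 0<δ taylor)))) ⟩
        ∣ value t - coefficient 0 ∣
          ≈⟨ abs-cong (solve 3 (λ v a bt → v :- a := bt :+ (v :- (a :+ bt))) refl (value t) (coefficient 0) (coefficient 1 * t)) ⟩
        ∣ coefficient 1 * t + (value t - (coefficient 0 + coefficient 1 * t)) ∣
          ≤⟨ ≤-trans (abs-triangle (coefficient 1 * t) (value t - (coefficient 0 + coefficient 1 * t)))
               (+-mono-≤ (≤-reflexive (abs-* (coefficient 1) t)) (taylor t ∣t∣<δ)) ⟩
        ∣ coefficient 1 ∣ * ∣ t ∣ + C * (∣ t ∣ * ∣ t ∣)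
          ≤⟨ +-mono-≤ ≤-refl (*-monoˡ-≤ 0≤C (*-monoʳ-≤ (abs-nonNeg t) (<⇒≤ ∣t∣<δ))) ⟩
        ∣ coefficient 1 ∣ * ∣ t ∣ + C * (δ * ∣ t ∣)
          ≈⟨ solve 4 (λ a t c d → a :* t :+ c :* (d :* t) := (a :+ c :* d) :* t) refl (∣ coefficient 1 ∣) (∣ t ∣) C δ ⟩
        (∣ coefficient 1 ∣ + C * δ) * ∣ t ∣ ∎

      increment : ∀ h → (value (0# + h) - value 0#) - 0# * h ≈ value h - μ
      increment h = begin-equality
        (value (0# + h) - value 0#) - 0# * h
          ≈⟨ +-cong (+-cong (value-cong (+-identityˡ h)) (-‿cong value-0)) (-‿cong (zeroˡ h)) ⟩
        (value h - μ) - 0#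
          ≈⟨ solve 1 (λ v → v :- con (+ 0) := v) refl (value h - μ) ⟩
        value h - μ ∎

      -- At a point 0 < h ≤ ε inside both radii, the Taylor estimate and the zero derivative give
      -- |a₁|h ≤ εh + Ch² ≤ (C + 1)εh. Dividing by h leaves a bound that ε makes arbitrarily small.
      coefficient-1-bound : ∀ {C δ} → 0# ≤ C → 0# < δ → Taylor C δ → HasDerivativeAt value 0# 0# →
                            ∀ ε → 0# < ε → ∣ coefficient 1 ∣ ≤ (C + 1#) * ε
      coefficient-1-bound {C} {δ} 0≤C 0<δ taylor derivative ε 0<ε =
        let η , 0<η , small = derivative ε 0<ε
            m , 0<m , m≤δ , m≤η = min 0<δ 0<η
            k , 0<k , k≤m , k≤ε = min 0<m 0<ε
            h , 0<h , h<k = small-multiple 0≤1 0<k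
            ∣h∣≈h = abs-of-nonNeg (<⇒≤ 0<h)
            ∣h∣<k = ≤-<-trans (≤-reflexive (trans ∣h∣≈h (sym (*-identityˡ h)))) h<k
        in estimate h (<-≤-trans 0<h (≤-reflexive (sym ∣h∣≈h))) (≤-trans (<⇒≤ ∣h∣<k) k≤ε)
             (taylor h (<-≤-trans ∣h∣<k (≤-trans k≤m m≤δ))) (small h (<-≤-trans ∣h∣<k (≤-trans k≤m m≤η)))
        where
        a₁ : Carrier
        a₁ = coefficient 1
        estimate : ∀ h → 0# < ∣ h ∣ → ∣ h ∣ ≤ ε → ∣ value h - (coefficient 0 + a₁ * h) ∣ ≤ C * (∣ h ∣ * ∣ h ∣) →
          ∣ (value (0# + h) - value 0#) - 0# * h ∣ ≤ ε * ∣ h ∣ → ∣ a₁ ∣ ≤ (C + 1#) * ε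
        estimate h 0<∣h∣ ∣h∣≤ε p q = *-cancelˡ-≤ 0<∣h∣ (begin
          ∣ h ∣ * ∣ a₁ ∣
            ≈⟨ trans (*-comm (∣ h ∣) (∣ a₁ ∣)) (sym (abs-* a₁ h)) ⟩
          ∣ a₁ * h ∣
            ≈⟨ abs-cong (solve 3 (λ v a bh → bh := (v :- a) :- (v :- (a :+ bh))) refl (value h) (coefficient 0) (a₁ * h)) ⟩
          ∣ (value h - coefficient 0) - (value h - (coefficient 0 + a₁ * h)) ∣
            ≤⟨ abs-triangle-sub (value h - coefficient 0) (value h - (coefficient 0 + a₁ * h)) ⟩
          ∣ value h - coefficient 0 ∣ + ∣ value h - (coefficient 0 + a₁ * h) ∣
            ≤⟨ +-mono-≤ (≤-trans (abs-cong-≤ (trans (+-congˡ (-‿cong (coefficient-0 0<δ taylor))) (sym (increment h)))) q) p ⟩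
          ε * ∣ h ∣ + C * (∣ h ∣ * ∣ h ∣)
            ≤⟨ +-mono-≤ ≤-refl (*-monoˡ-≤ 0≤C (*-monoʳ-≤ (abs-nonNeg h) ∣h∣≤ε)) ⟩
          ε * ∣ h ∣ + C * (ε * ∣ h ∣)
            ≈⟨ solve 3 (λ e h c → e :* h :+ c :* (e :* h) := h :* ((c :+ con (+ 1)) :* e)) refl ε (∣ h ∣) C ⟩
          ∣ h ∣ * ((C + 1#) * ε) ∎)

    abstract
      derivative-0⇒coefficient-0 : HasDerivativeAt value 0# 0# → coefficient 1 ≈ 0#
      derivative-0⇒coefficient-0 derivative =
        let C , δ , 0≤C , 0<δ , _ , taylor = power-series-taylor {coefficient} {value} radius>0 analytic
        in ∣x∣≤0⇒x≈0 (≤-multiples⇒≤0 (+-nonNeg 0≤C 0≤1) (coefficient-1-bound 0≤C 0<δ taylor derivative))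

      -- The hypothesis ranges over all C because the Lipschitz constant becomes known only from the
      -- Taylor estimate of the branch at hand. Afterwards D|h|² ≤ ε|h| holds as soon as D|h| ≤ ε.
      quadratic⇒derivative-0 : (∀ {C} → 0# ≤ C → ∃[ D ] ∃[ η ] (0# ≤ D × 0# < η ×
          (∀ t ν → ∣ t ∣ < η → ∣ ν - μ ∣ ≤ C * ∣ t ∣ → IsEigenvalue (A t) ν → ∣ ν - μ ∣ ≤ D * (∣ t ∣ * ∣ t ∣)))) →
        HasDerivativeAt value 0# 0#
      quadratic⇒derivative-0 quadratic ε 0<ε =
        let C , δ , 0≤C , 0<δ , δ≤r , taylor = power-series-taylor {coefficient} {value} radius>0 analytic
            D , η , 0≤D , 0<η , bound = quadratic (+-nonNeg (abs-nonNeg (coefficient 1)) (*-nonNeg 0≤C (<⇒≤ 0<δ)))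
            γ , 0<γ , Dγ<ε = small-multiple 0≤D 0<ε
            m , 0<m , m≤δ , m≤η = min 0<δ 0<η
            k , 0<k , k≤m , k≤γ = min 0<m 0<γ
        in k , 0<k , λ h ∣h∣<k →
          let ∣h∣<δ = <-≤-trans ∣h∣<k (≤-trans k≤m m≤δ)
          in estimate 0≤D (≤-trans (<⇒≤ ∣h∣<k) k≤γ) (<⇒≤ Dγ<ε)
               (bound h (value h) (<-≤-trans ∣h∣<k (≤-trans k≤m m≤η)) (lipschitz 0≤C 0<δ taylor h ∣h∣<δ)
                 (isEigenvalue h (<-≤-trans ∣h∣<δ δ≤r)))
        where
        estimate : ∀ {D γ h} → 0# ≤ D → ∣ h ∣ ≤ γ → D * γ ≤ ε → ∣ value h - μ ∣ ≤ D * (∣ h ∣ * ∣ h ∣) →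
          ∣ (value (0# + h) - value 0#) - 0# * h ∣ ≤ ε * ∣ h ∣
        estimate {D} {γ} {h} 0≤D ∣h∣≤γ Dγ≤ε p = begin
          ∣ (value (0# + h) - value 0#) - 0# * h ∣   ≈⟨ abs-cong (increment h) ⟩
          ∣ value h - μ ∣                            ≤⟨ p ⟩
          D * (∣ h ∣ * ∣ h ∣)                        ≈⟨ *-assoc D (∣ h ∣) (∣ h ∣) ⟨
          D * ∣ h ∣ * ∣ h ∣                          ≤⟨ *-monoʳ-≤ (abs-nonNeg h) (≤-trans (*-monoˡ-≤ 0≤D ∣h∣≤γ) Dγ≤ε) ⟩
          ε * ∣ h ∣                                  ∎

  -- The quadratic form of the Laplacian

  indicator : ∀ {P : Set} → Dec P → Carrier
  indicator d = if does d then 1# else 0#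

  module LaplacianForm {n m : ℕ} (G : SimpleGraph n m) where
    open SimpleGraph G

    -- The vector bₑ. Exchanging source and target changes its sign, which cancels in bₑ bₑᵀ.
    incidence : Fin m → Fin n → Carrier
    incidence e u = δ (source e) u - δ (target e) u

    gradient : Vector Carrier n → Fin m → Carrier
    gradient v e = v (source e) - v (target e)

    -- As `δ i j` unfolds to `indicator (i ≟ j)`, the entry can be computed by cases on arbitrary
    -- decisions. Both ends meeting at u would be a loop; otherwise the entry is 0, 1 or -1.
    incidence-square : ∀ e u → (if does (incident? e u) then 1# else 0#) ≈ incidence e u * incidence e u
    incidence-square e u = go (source e ≟ u) (target e ≟ u)
      where
      go : (s : Dec (source e ≡ u)) (t : Dec (target e ≡ u)) →
           indicator (s ⊎-dec t) ≈ (indicator s - indicator t) * (indicator s - indicator t)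
      go (yes s≡u) (yes t≡u) = contradiction (inj₁ (s≡u , t≡u)) (noLoops e u)
      go (yes _)   (no _)    = solve 0 (con (+ 1) := (con (+ 1) :- con (+ 0)) :* (con (+ 1) :- con (+ 0))) refl
      go (no _)    (yes _)   = solve 0 (con (+ 1) := (con (+ 0) :- con (+ 1)) :* (con (+ 0) :- con (+ 1))) refl
      go (no _)    (no _)    = solve 0 (con (+ 0) := (con (+ 0) :- con (+ 0)) :* (con (+ 0) :- con (+ 0))) refl

    incidence-product : ∀ {u v} → ¬ (u ≡ v) → ∀ e →
      (Joins e u v × incidence e u * incidence e v ≈ - 1#) ⊎
      (¬ Joins e u v × incidence e u * incidence e v ≈ 0#)
    incidence-product {u} {v} u≢v e = go (source e ≟ u) (target e ≟ u) (source e ≟ v) (target e ≟ v)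
      where
      go : (su : Dec (source e ≡ u)) (tu : Dec (target e ≡ u)) (sv : Dec (source e ≡ v)) (tv : Dec (target e ≡ v)) →
        (Joins e u v × (indicator su - indicator tu) * (indicator sv - indicator tv) ≈ - 1#) ⊎
        (¬ Joins e u v × (indicator su - indicator tu) * (indicator sv - indicator tv) ≈ 0#)
      go (yes su) _        (yes sv) _        = contradiction (≡.trans (≡.sym su) sv) u≢v
      go _        (yes tu) _        (yes tv) = contradiction (≡.trans (≡.sym tu) tv) u≢v
      go (yes su) (yes tu) _        _        = contradiction (inj₁ (su , tu)) (noLoops e u)
      go (yes su) (no _)   (no _)   (yes tv) = inj₁ (inj₁ (su , tv) ,
        solve 0 ((con (+ 1) :- con (+ 0)) :* (con (+ 0) :- con (+ 1)) := :- con (+ 1)) refl)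
      go (no _)   (yes tu) (yes sv) (no _)   = inj₁ (inj₂ (sv , tu) ,
        solve 0 ((con (+ 0) :- con (+ 1)) :* (con (+ 1) :- con (+ 0)) := :- con (+ 1)) refl)
      go su       tu       (no ¬sv) (no ¬tv) = inj₂ ((λ { (inj₁ (_ , tv)) → ¬tv tv ; (inj₂ (sv , _)) → ¬sv sv }) ,
        trans (*-congˡ (-‿inverseʳ 0#)) (zeroʳ (indicator su - indicator tu)))
      go (no ¬su) (no ¬tu) sv       tv       = inj₂ ((λ { (inj₁ (su , _)) → ¬su su ; (inj₂ (_ , tu)) → ¬tu tu }) ,
        trans (*-congʳ (-‿inverseʳ 0#)) (zeroˡ (indicator sv - indicator tv)))

    -- Simplicity of the graph enters here: without loops the squares on the diagonal are the
    -- incidence indicators, and without multiple edges only the edge found by `any?` contributes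
    -- off the diagonal.
    laplacian-decomposition : ∀ y u v → laplacian G y u v ≈ sum (λ e → y e * (incidence e u * incidence e v))
    laplacian-decomposition y u v with u ≟ v | any? (λ k → joins? k u v)
    ... | yes ≡.refl | _ = sum-cong-≋ λ e → trans (select (incident? e u) (y e)) (*-congˡ (incidence-square e u))
      where
      select : ∀ {P : Set} (d : Dec P) x → (if does d then x else 0#) ≈ x * indicator d
      select (yes _) x = sym (*-identityʳ x)
      select (no _)  x = sym (zeroʳ x)
    ... | no u≢v | yes (k , joins) = sym (begin-equality
      sum (λ e → y e * (incidence e u * incidence e v))  ≈⟨ sum-cong-≋ (λ e → trans (*-congˡ (entry e)) (*-comm (y e) (- δ k e))) ⟩
      sum (λ e → - δ k e * y e)                          ≈⟨ sum-cong-≋ (λ e → solve 2 (λ d y → :- d :* y := :- con (+ 1) :* (d :* y)) refl (δ k e) (y e)) ⟩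
      sum (λ e → - 1# * (δ k e * y e))                   ≈⟨ trans (sum-scale (- 1#) (λ e → δ k e * y e)) (*-congˡ (sum-δ k y)) ⟩
      - 1# * y k                                         ≈⟨ solve 1 (λ y → :- con (+ 1) :* y := :- y) refl (y k) ⟩
      - y k                                              ∎)
      where
      entry : ∀ e → incidence e u * incidence e v ≈ - δ k e
      entry e with incidence-product u≢v e
      ... | inj₁ (joins′ , eq) = trans eq (-‿cong (sym (trans (reflexive (≡.cong (δ k) (noMultipleEdges joins′ joins))) (δ-refl k))))
      ... | inj₂ (¬joins , eq) = trans eq (trans (sym -0#≈0#) (-‿cong (sym (δ-≢ λ k≡e → ¬joins (≡.subst (λ e → Joins e u v) k≡e joins)))))
    ... | no u≢v | no ∄ = sym (sum-0 λ e → trans (*-congˡ (zero-entry e)) (zeroʳ (y e)))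
      where
      zero-entry : ∀ e → incidence e u * incidence e v ≈ 0#
      zero-entry e with incidence-product u≢v e
      ... | inj₁ (joins , _) = contradiction (e , joins) ∄
      ... | inj₂ (_ , eq)    = eq

    laplacian-symmetric : ∀ y → Symmetric (laplacian G y)
    laplacian-symmetric y u v = trans (laplacian-decomposition y u v)
      (trans (sum-cong-≋ λ e → *-congˡ (*-comm (incidence e u) (incidence e v))) (sym (laplacian-decomposition y v u)))

    laplacian-linear : ∀ x y t u v → laplacian G (λ e → x e + t * y e) u v ≈ laplacian G x u v + t * laplacian G y u v
    laplacian-linear x y t u v = begin-equality
      laplacian G (λ e → x e + t * y e) u v
        ≈⟨ laplacian-decomposition (λ e → x e + t * y e) u v ⟩
      sum (λ e → (x e + t * y e) * b e)
        ≈⟨ sum-cong-≋ (λ e → solve 4 (λ x t y b → (x :+ t :* y) :* b := x :* b :+ t :* (y :* b)) refl (x e) t (y e) (b e)) ⟩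
      sum (λ e → x e * b e + t * (y e * b e))
        ≈⟨ trans (∑-distrib-+ (λ e → x e * b e) (λ e → t * (y e * b e))) (+-congˡ (sum-scale t (λ e → y e * b e))) ⟩
      sum (λ e → x e * b e) + t * sum (λ e → y e * b e)
        ≈⟨ +-cong (laplacian-decomposition x u v) (*-congˡ (laplacian-decomposition y u v)) ⟨
      laplacian G x u v + t * laplacian G y u v ∎
      where
      b : Fin m → Carrier
      b e = incidence e u * incidence e v

    laplacian-scale : ∀ ε y u v → laplacian G (λ e → ε * y e) u v ≈ ε * laplacian G y u v
    laplacian-scale ε y u v = begin-equality
      laplacian G (λ e → ε * y e) u v                ≈⟨ laplacian-decomposition (λ e → ε * y e) u v ⟩
      sum (λ e → ε * y e * b e)                      ≈⟨ sum-cong-≋ (λ e → *-assoc ε (y e) (b e)) ⟩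
      sum (λ e → ε * (y e * b e))                    ≈⟨ sum-scale ε (λ e → y e * b e) ⟩
      ε * sum (λ e → y e * b e)                      ≈⟨ *-congˡ (laplacian-decomposition y u v) ⟨
      ε * laplacian G y u v                          ∎
      where
      b : Fin m → Carrier
      b e = incidence e u * incidence e v

    dot-incidence : ∀ e v → dot (incidence e) v ≈ gradient v e
    dot-incidence e v = begin-equality
      dot (incidence e) v
        ≈⟨ dot-congˡ (λ i → solve 2 (λ s t → s :- t := s :+ :- con (+ 1) :* t) refl (δ (source e) i) (δ (target e) i)) ⟩
      dot (λ i → δ (source e) i + - 1# * δ (target e) i) v
        ≈⟨ trans (dot-+ (δ (source e)) (λ i → - 1# * δ (target e) i) v) (+-congˡ (dot-scale (- 1#) (δ (target e)) v)) ⟩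
      dot (δ (source e)) v + - 1# * dot (δ (target e)) v
        ≈⟨ +-cong (sum-δ (source e) v) (*-congˡ (sum-δ (target e) v)) ⟩
      v (source e) + - 1# * v (target e)
        ≈⟨ solve 2 (λ s t → s :+ :- con (+ 1) :* t := s :- t) refl (v (source e)) (v (target e)) ⟩
      gradient v e ∎

    apply-laplacian : ∀ y v u → apply (laplacian G y) v u ≈ sum (λ e → y e * gradient v e * incidence e u)
    apply-laplacian y v u = begin-equality
      sum (λ j → laplacian G y u j * v j)
        ≈⟨ sum-cong-≋ (λ j → trans (*-congʳ (laplacian-decomposition y u j)) (*-distribʳ-sum (v j) (λ e → y e * (incidence e u * incidence e j)))) ⟩
      sum (λ j → sum (λ e → y e * (incidence e u * incidence e j) * v j))
        ≈⟨ ∑-comm (λ j e → y e * (incidence e u * incidence e j) * v j) ⟩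
      sum (λ e → sum (λ j → y e * (incidence e u * incidence e j) * v j))
        ≈⟨ sum-cong-≋ (λ e → trans (sum-cong-≋ λ j → solve 4 (λ y a b v → y :* (a :* b) :* v := (y :* a) :* (b :* v)) refl (y e) (incidence e u) (incidence e j) (v j))
             (sum-scale (y e * incidence e u) (λ j → incidence e j * v j))) ⟩
      sum (λ e → y e * incidence e u * dot (incidence e) v)
        ≈⟨ sum-cong-≋ (λ e → trans (*-congˡ (dot-incidence e v)) (solve 3 (λ y a g → y :* a :* g := y :* g :* a) refl (y e) (incidence e u) (gradient v e))) ⟩
      sum (λ e → y e * gradient v e * incidence e u) ∎

    laplacian-form : ∀ y v → dot (apply (laplacian G y) v) v ≈ sum (λ e → y e * (gradient v e * gradient v e))
    laplacian-form y v = begin-equality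
      dot (apply (laplacian G y) v) v
        ≈⟨ sum-cong-≋ (λ u → trans (*-congʳ (apply-laplacian y v u)) (*-distribʳ-sum (v u) (λ e → y e * gradient v e * incidence e u))) ⟩
      sum (λ u → sum (λ e → y e * gradient v e * incidence e u * v u))
        ≈⟨ ∑-comm (λ u e → y e * gradient v e * incidence e u * v u) ⟩
      sum (λ e → sum (λ u → y e * gradient v e * incidence e u * v u))
        ≈⟨ sum-cong-≋ (λ e → trans (sum-cong-≋ λ u → *-assoc (y e * gradient v e) (incidence e u) (v u))
             (sum-scale (y e * gradient v e) (λ u → incidence e u * v u))) ⟩
      sum (λ e → y e * gradient v e * dot (incidence e) v)
        ≈⟨ sum-cong-≋ (λ e → trans (*-congˡ (dot-incidence e v)) (*-assoc (y e) (gradient v e) (gradient v e))) ⟩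
      sum (λ e → y e * (gradient v e * gradient v e)) ∎

    abs-gradient : ∀ f {e u v} → Joins e u v → ∣ f u - f v ∣ ≈ ∣ gradient f e ∣
    abs-gradient f     (inj₁ (≡.refl , ≡.refl)) = refl
    abs-gradient f {e} (inj₂ (≡.refl , ≡.refl)) = abs-sub-comm (f (target e)) (f (source e))

  -- Critical eigenvalues and edge differences of constant size

  constant : ∀ {m} (d : Fin m → Carrier) → (∀ e e′ → d e ≈ d e′) → ∃[ c ] (∀ e → d e ≈ c)
  -- Without edges there is no value of d to take, and 0 is supplied.
  constant {zero}  d _  = 0# , λ ()
  constant {suc m} d eq = d zero , λ e → eq e zero

  module Proposition {n m : ℕ} (G : SimpleGraph n m) {x : Vector Carrier m} {μ : Carrier}
    (simple : IsSimpleEigenvalue (laplacian G x) μ) {f : Vector Carrier n} (eigenvector : IsEigenvector (laplacian G x) μ f) where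

    open SimpleGraph G
    open LaplacianForm G

    eigenpair : SimpleEigenpair (laplacian G x) μ f
    eigenpair = record
      { symmetric  = laplacian-symmetric x
      ; nonzero    = proj₁ eigenvector
      ; eigen      = proj₂ eigenvector
      ; eigenspace = eigenspace
      }
      where
      f₀ : Vector Carrier n
      f₀ = proj₁ simple
      multiple : ∀ g → IsEigenvector (laplacian G x) μ g → ∃[ a ] (∀ i → g i ≈ a * f₀ i)
      multiple = proj₂ (proj₂ simple)
      -- The spanning vector f₀ provided by simplicity need not be f. Since f = b f₀ is nonzero, b
      -- is invertible, and f spans the same line.
      rescale : ∀ {g : Vector Carrier n} → ∃[ b ] (∀ i → f i ≈ b * f₀ i) → ∃[ a ] (∀ i → g i ≈ a * f₀ i) → ∃[ c ] (∀ i → g i ≈ c * f i)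
      rescale {g} (b , f≈) (a , g≈) = a * b⁻¹ , λ i → begin-equality
        g i                       ≈⟨ g≈ i ⟩
        a * f₀ i                  ≈⟨ *-congˡ (*-identityˡ (f₀ i)) ⟨
        a * (1# * f₀ i)           ≈⟨ *-congˡ (*-congʳ (proj₂ b-inverse)) ⟨
        a * (b * b⁻¹ * f₀ i)      ≈⟨ solve 4 (λ a b c f → a :* (b :* c :* f) := (a :* c) :* (b :* f)) refl a b b⁻¹ (f₀ i) ⟩
        a * b⁻¹ * (b * f₀ i)      ≈⟨ *-congˡ (f≈ i) ⟨
        a * b⁻¹ * f i             ∎
        where
        b-inverse : ∃[ c ] (b * c ≈ 1#)
        b-inverse = inverse b λ b≈0 → proj₁ eigenvector λ i → trans (f≈ i) (trans (*-congʳ b≈0) (zeroˡ (f₀ i)))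
        b⁻¹ : Carrier
        b⁻¹ = proj₁ b-inverse
      eigenspace : ∀ g → (∀ i → apply (laplacian G x) g i ≈ μ * g i) → ∃[ a ] (∀ i → g i ≈ a * f i)
      eigenspace g eq with em {∀ i → g i ≈ 0#}
      ... | yes g≈0 = 0# , λ i → trans (g≈0 i) (sym (zeroˡ (f i)))
      ... | no g≉0  = rescale {g} (multiple f eigenvector) (multiple g (g≉0 , eq))

    perturbed-laplacian : ∀ y t i j → laplacian G (λ e → x e + t * y e) i j ≈ (laplacian G x +[ t ] laplacian G y) i j
    perturbed-laplacian y = laplacian-linear x y

    constant⇒critical : ∀ {c} → (∀ u v → Adjacent u v → ∣ f u - f v ∣ ≈ c) → IsCritical G x μ
    constant⇒critical {c} ∣∇f∣≈c y sum-y≈0 b = quadratic⇒derivative-0 b λ 0≤C →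
      let D , η , 0≤D , 0<η , bound = perturbed-eigenvalue-quadratic eigenpair (laplacian-symmetric y) stationary 0≤C
      in D , η , 0≤D , 0<η , λ t ν ∣t∣<η ν-bound (g , g≉0 , eq) → bound t ν ∣t∣<η ν-bound
        (g , g≉0 , λ i → trans (sum-cong-≋ λ j → *-congʳ (sym (perturbed-laplacian y t i j))) (eq i))
      where
      square : ∀ e → gradient f e * gradient f e ≈ c * c
      square e = trans (sym (abs-square (gradient f e)))
        (*-cong (∣∇f∣≈c (source e) (target e) (e , inj₁ (≡.refl , ≡.refl))) (∣∇f∣≈c (source e) (target e) (e , inj₁ (≡.refl , ≡.refl))))
      stationary : dot (apply (laplacian G y) f) f ≈ 0#
      stationary = begin-equality
        dot (apply (laplacian G y) f) f                    ≈⟨ laplacian-form y f ⟩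
        sum (λ e → y e * (gradient f e * gradient f e))    ≈⟨ sum-cong-≋ (λ e → *-congˡ (square e)) ⟩
        sum (λ e → y e * (c * c))                          ≈⟨ *-distribʳ-sum (c * c) y ⟨
        sum y * (c * c)                                    ≈⟨ *-congʳ sum-y≈0 ⟩
        0# * (c * c)                                       ≈⟨ zeroˡ (c * c) ⟩
        0#                                                 ∎

    -- Criticality is invoked in the direction εy, which still has sum zero and for which a branch
    -- is known to exist. The branch is carried from L + tεB to the Laplacian of x + tεy, because
    -- the two families agree only up to `_≈_`.
    critical⇒stationary : IsCritical G x μ → ∀ y → sum y ≈ 0# → dot (apply (laplacian G y) f) f ≈ 0#
    critical⇒stationary critical y sum-y≈0 =
      let ε , 0<ε , b , c₁≈0⇒stationary = branch-in-small-direction eigenpair (laplacian-symmetric y)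
          b′ , c₁≡ = branch-cong (λ t i j → sym (trans (perturbed-laplacian (λ e → ε * y e) t i j)
                       (+-congˡ (*-congˡ (laplacian-scale ε y i j))))) b
      in c₁≈0⇒stationary (trans (reflexive (≡.sym c₁≡))
           (derivative-0⇒coefficient-0 b′ (critical (λ e → ε * y e) (trans (sum-scale ε y) (trans (*-congˡ sum-y≈0) (zeroʳ ε))) b′)))

    critical⇒constant : IsCritical G x μ → ∃[ c ] (∀ u v → Adjacent u v → ∣ f u - f v ∣ ≈ c)
    critical⇒constant critical =
      let c , eq = constant (λ e → ∣ gradient f e ∣) equal
      in c , λ u v (e , joins) → trans (abs-gradient f joins) (eq e)
      where
      d² : Fin m → Carrier
      d² e = gradient f e * gradient f e
      difference : ∀ (e e′ : Fin m) (w : Vector Carrier m) → sum (λ k → (δ e k - δ e′ k) * w k) ≈ w e - w e′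
      difference e e′ w = begin-equality
        sum (λ k → (δ e k - δ e′ k) * w k)
          ≈⟨ sum-cong-≋ (λ k → solve 3 (λ a b w → (a :- b) :* w := a :* w :+ :- con (+ 1) :* (b :* w)) refl (δ e k) (δ e′ k) (w k)) ⟩
        sum (λ k → δ e k * w k + - 1# * (δ e′ k * w k))
          ≈⟨ trans (∑-distrib-+ (λ k → δ e k * w k) (λ k → - 1# * (δ e′ k * w k))) (+-congˡ (sum-scale (- 1#) (λ k → δ e′ k * w k))) ⟩
        sum (λ k → δ e k * w k) + - 1# * sum (λ k → δ e′ k * w k)
          ≈⟨ +-cong (sum-δ e w) (*-congˡ (sum-δ e′ w)) ⟩
        w e + - 1# * w e′
          ≈⟨ solve 2 (λ a b → a :+ :- con (+ 1) :* b := a :- b) refl (w e) (w e′) ⟩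
        w e - w e′ ∎
      equal-squares : ∀ e e′ → d² e ≈ d² e′
      equal-squares e e′ = begin-equality
        d² e                    ≈⟨ solve 2 (λ a b → a := (a :- b) :+ b) refl (d² e) (d² e′) ⟩
        (d² e - d² e′) + d² e′  ≈⟨ +-congʳ zero-difference ⟩
        0# + d² e′              ≈⟨ +-identityˡ (d² e′) ⟩
        d² e′                   ∎
        where
        -- The test direction moves weight from e′ to e, so its form at f is exactly d² e - d² e′.
        y : Vector Carrier m
        y k = δ e k - δ e′ k
        sum-y≈0 : sum y ≈ 0#
        sum-y≈0 = begin-equality
          sum y                    ≈⟨ sum-cong-≋ (λ k → *-identityʳ (y k)) ⟨
          sum (λ k → y k * 1#)     ≈⟨ difference e e′ (λ _ → 1#) ⟩
          1# - 1#                  ≈⟨ -‿inverseʳ 1# ⟩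
          0#                       ∎
        zero-difference : d² e - d² e′ ≈ 0#
        zero-difference = trans (sym (difference e e′ d²))
          (trans (sym (laplacian-form y f)) (critical⇒stationary critical y sum-y≈0))
      equal : ∀ e e′ → ∣ gradient f e ∣ ≈ ∣ gradient f e′ ∣
      equal e e′ = square-injective (abs-nonNeg (gradient f e)) (abs-nonNeg (gradient f e′))
        (trans (abs-square (gradient f e)) (trans (equal-squares e e′) (sym (abs-square (gradient f e′)))))

proposition2p6 : ExcludedMiddle 0ℓ →
    (R : CompleteOrderedField) →
    let open WeightedGraphs R in
    {n m : ℕ} (G : SimpleGraph n m) → SimpleGraph.Connected G →
    (x : Vector Carrier m) → InEdgePolytope G x →
    (μ : Carrier) → 0# < μ → IsSimpleEigenvalue (laplacian G x) μ →
    (f : Vector Carrier n) → IsEigenvector (laplacian G x) μ f →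
    IsCritical G x μ ⇔
    (∃[ c ] (∀ u v → SimpleGraph.Adjacent G u v → ∣ f u - f v ∣ ≈ c))
proposition2p6 em R G _ x _ μ _ simple f eigenvector =
  let open WithExcludedMiddle em R
      open Proposition G simple eigenvector
  in mk⇔ critical⇒constant (λ (c , eq) → constant⇒critical eq)
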